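{- Let $\Gamma$ be a thick locally finitely generated generalized $n$-gon with $n\in\{4,6\}$, and let $\gamma:\Gamma\to\Delta$ be an epimorphism, with $\Delta$ a thin $n$-gon of order $(s,1)$. Then $s=1$, and, after a suitable naming of the points of $\Delta$, $\gamma$ is of type (a) or of type (b) (the types for $n=4$, respectively $n=6$, being those defined in the context).
   Context: Polygons. A point-line geometry is a weak generalized $n$-gon ($n\ge 3$) if any two elements (points or lines) lie in a common ordinary sub $n$-gon and there are no ordinary sub $k$-gons for $2\le k<n$; it is thick (a generalized $n$-gon) if every point is on at least three lines and every line has at least three points, and thin if it is not thick. Order $(u,v)$: each line has $u+1$ points and each point is on $v+1$ lines (possibly infinite). A morphism maps points to points, lines to lines, and preserves incidence; an epimorphism is a morphism surjective on points and on lines. $x\sim y$ means collinear; $\overline{x}\overline{y}$ is the line joining distinct collinear points. The point-line dual is obtained by interchanging points and lines. Locally finitely generated. A sub $n$-gon is a (thin or thick) weak generalized $n$-gon whose points and lines are points and lines of $\Gamma$, with induced incidence. For a point set $S$ of $\Gamma$, $\langle S\rangle$ is the intersection of all (thin and thick) sub $n$-gons containing $S$. A thick generalized $n$-gon $\Gamma$ is locally finitely generated if for every finite point subset $S$ for which $\langle S\rangle$ is a (possibly thin) sub $n$-gon, $\langle S\rangle$ is finite. Type (a), $n=4$. $\Delta$ has points $\overline{a}\sim\overline{b}\sim\overline{c}\sim\overline{d}\sim\overline{a}$; write $\widetilde{X}=\gamma^{ -1}(\overline{x})$. There is a line $L$ of $\Gamma$ such that $(\widetilde{A},\widetilde{B})$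 is a partition of the points incident with $L$ into two nonempty sets; $\widetilde{C}$ (resp. $\widetilde{D}$) consists of the points not on $L$ collinear with a point of $\widetilde{B}$ (resp. $\widetilde{A}$); $\gamma^{ -1}(\overline{a}\overline{b})=\{L\}$; $\gamma^{ -1}(\overline{b}\overline{c})$ (resp. $\gamma^{ -1}(\overline{a}\overline{d})$) is the set of lines distinct from $L$ incident with a point of $\widetilde{B}$ (resp. $\widetilde{A}$); $\gamma^{ -1}(\overline{c}\overline{d})$ consists of the lines incident with at least one point of $\widetilde{C}$ and at least one point of $\widetilde{D}$. Type (a), $n=6$. $\Delta$ has points $\overline{a}\sim\overline{b}\sim\overline{c}\sim\overline{d}\sim\overline{e}\sim\overline{f}\sim\overline{a}$; write $\widetilde{X}=\gamma^{ -1}(\overline{x})$. There is a line $L$ of $\Gamma$ such that $(\widetilde{C},\widetilde{B})$ is a partition of the points incident with $L$ into two nonempty sets; $\widetilde{D}$ (resp. $\widetilde{A}$) consists of the points not on $L$ collinear with a point of $\widetilde{C}$ (resp. $\widetilde{B}$); $\widetilde{E}$ consists of the points not in $\widetilde{C}\cup\widetilde{D}$ collinear with a point of $\widetilde{D}$; $\widetilde{F}$ consists of the points not in $\widetilde{A}\cup\widetilde{B}$ collinear with a point of $\widetilde{A}$; $\gamma^{ -1}(\overline{b}\overline{c})=\{L\}$; $\gamma^{ -1}(\overline{c}\overline{d})$ (resp. $\gamma^{ -1}(\overline{a}\overline{b})$) is the set of lines distinct from $L$ incident with a point of $\widetilde{C}$ (resp. $\widetilde{B}$); $\gamma^{ -1}(\overline{d}\overline{e})$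 is the set of lines not in $\gamma^{ -1}(\overline{c}\overline{d})$ incident with a point of $\widetilde{D}$; $\gamma^{ -1}(\overline{f}\overline{a})$ is the set of lines not in $\gamma^{ -1}(\overline{a}\overline{b})$ incident with a point of $\widetilde{A}$; $\gamma^{ -1}(\overline{f}\overline{e})$ is the set of lines not in $\gamma^{ -1}(\overline{f}\overline{a})$ incident with a point of $\widetilde{F}$ (equivalently, the lines not in $\gamma^{ -1}(\overline{d}\overline{e})$ incident with a point of $\widetilde{E}$). Type (b). $\gamma$, regarded as an epimorphism from the point-line dual of $\Gamma$ onto the point-line dual of $\Delta$, is of type (a). -}

module Defs where

open import Data.Fin.Base using (Fin; toℕ)
open import Data.Fin.Patterns
open import Data.Nat.Base using (ℕ; zero; suc; _≤_; _<_)
open import Data.Nat.DivMod using (_mod_)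
open import Data.Product.Base using (Σ-syntax; ∃; ∃-syntax; _×_)
open import Data.Refinement using (Refinement-syntax; value)
open import Data.Sum.Base using (_⊎_; inj₁; inj₂)
open import Function.Definitions using (Injective; StrictlySurjective)
open import Level using (Level; _⊔_) renaming (suc to lsuc)
open import Relation.Binary.PropositionalEquality using (_≡_)
open import Relation.Nullary.Negation using (¬_)
open import Relation.Unary
  using (Pred; _∈_; _⊆_; _≐_; _∪_; _∩_; _∖_; _⊥_; ∁; ｛_｝; Satisfiable)

private
  variable
    a p l i ℓ ℓ₁ ℓ₂ ℓ₃ : Level


------------------------------------------------------------------------
-- Cardinalities of subsets

data ℕ∞ : Set where
  fin : ℕ → ℕ∞
  ∞   : ℕ∞

HasSize : {A : Set a} → Pred A ℓ → ℕ → Set (a ⊔ ℓ)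
HasSize {A = A} P k =
  Σ[ f ∈ (Fin k → A) ] Injective _≡_ _≡_ f × P ≐ (λ x → ∃[ j ] f j ≡ x)

Finite : {A : Set a} → Pred A ℓ → Set (a ⊔ ℓ)
Finite P = ∃[ k ] HasSize P k

-- P has u + 1 elements.  The value ∞ does not distinguish between
-- infinite cardinals.
HasSize1+ : {A : Set a} → Pred A ℓ → ℕ∞ → Set (a ⊔ ℓ)
HasSize1+ P (fin u) = HasSize P (suc u)
HasSize1+ P ∞       = ¬ Finite P

AtLeast : {A : Set a} → ℕ → Pred A ℓ → Set (a ⊔ ℓ)
AtLeast {A = A} k P =
  Σ[ f ∈ (Fin k → A) ] Injective _≡_ _≡_ f × (∀ j → f j ∈ P)

record IsPartition {A : Set a} (X : Pred A ℓ₁) (Y : Pred A ℓ₂) (Z : Pred A ℓ₃)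
       : Set (a ⊔ ℓ₁ ⊔ ℓ₂ ⊔ ℓ₃) where
  field
    covers    : Z ≐ X ∪ Y
    disjoint  : X ⊥ Y
    nonempty₁ : Satisfiable X
    nonempty₂ : Satisfiable Y

------------------------------------------------------------------------
-- Point-line geometries

record Geometry p l i : Set (lsuc (p ⊔ l ⊔ i)) where
  field
    Point : Set p
    Line  : Set l
    _I_   : Point → Line → Set i

  Element : Set (p ⊔ l)
  Element = Point ⊎ Line

  _∼_ : Point → Point → Set (l ⊔ i)
  x ∼ y = ∃[ M ] x I M × y I M

  CollinearWithSome : Pred Point ℓ → Pred Point (p ⊔ l ⊔ i ⊔ ℓ)
  CollinearWithSome S x = ∃[ y ] y ∈ S × x ∼ y

  IncidentWithSome : Pred Point ℓ → Pred Line (p ⊔ i ⊔ ℓ)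
  IncidentWithSome S M = ∃[ y ] y ∈ S × y I M

dual : Geometry p l i → Geometry l p i
dual G = record { Point = Line ; Line = Point ; _I_ = λ M x → x I M }
  where open Geometry G

------------------------------------------------------------------------
-- Weak generalized polygons

next : ∀ {k} → Fin k → Fin k
next {suc k} j = suc (toℕ j) mod suc k

-- Further incidences between the vertices and the sides are not
-- excluded.  A chord would split a k-gon into two smaller ones, so under
-- the axioms for weak generalized n-gons below this makes no difference:
-- the least k for which a k-gon exists is the same, and for that k every
-- k-gon carries exactly the incidences listed here.
record OrdinaryPolygon (G : Geometry p l i) (k : ℕ) : Set (p ⊔ l ⊔ i) where
  open Geometry G
  field
    vertex           : Fin k → Point
    side             : Fin k → Line
    vertex-injective : Injective _≡_ _≡_ vertex
    side-injective   : Injective _≡_ _≡_ side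
    incident         : ∀ j → vertex j I side j
    incident-next    : ∀ j → vertex (next j) I side j

  Contains : Pred Element (p ⊔ l)
  Contains (inj₁ x) = Level.Lift l (∃[ j ] vertex j ≡ x)
  Contains (inj₂ M) = Level.Lift p (∃[ j ] side j ≡ M)

record IsWeakPolygon (n : ℕ) (G : Geometry p l i) : Set (p ⊔ l ⊔ i) where
  open Geometry G
  open OrdinaryPolygon using (Contains)
  field
    3≤n           : 3 ≤ n
    nonempty      : Element
    common-n-gon  : ∀ (x y : Element) →
                    Σ[ O ∈ OrdinaryPolygon G n ] Contains O x × Contains O y
    no-small-gons : ∀ k → 2 ≤ k → k < n → ¬ OrdinaryPolygon G k

IsThick : Geometry p l i → Set (p ⊔ l ⊔ i)
IsThick G = (∀ x → AtLeast 3 (λ M → x I M)) × (∀ M → AtLeast 3 (λ x → x I M))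
  where open Geometry G

IsThickPolygon : ℕ → Geometry p l i → Set (p ⊔ l ⊔ i)
IsThickPolygon n G = IsWeakPolygon n G × IsThick G

IsThinPolygon : ℕ → Geometry p l i → Set (p ⊔ l ⊔ i)
IsThinPolygon n G = IsWeakPolygon n G × ¬ IsThick G

HasOrder : Geometry p l i → ℕ∞ → ℕ∞ → Set (p ⊔ l ⊔ i)
HasOrder G u v =
  (∀ M → HasSize1+ (λ x → x I M) u) × (∀ x → HasSize1+ (λ M → x I M) v)
  where open Geometry G

------------------------------------------------------------------------
-- Subpolygons and local finite generation

module _ (G : Geometry p l i) where
  open Geometry G

  -- Elements of a refinement type are equal as soon as their values are,
  -- so distinctness in the subgeometry is distinctness in G.
  induced : Pred Point ℓ₁ → Pred Line ℓ₂ → Geometry (p ⊔ ℓ₁) (l ⊔ ℓ₂) i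
  induced P Q = record
    { Point = [ x ∈ Point ∣ P x ]
    ; Line  = [ M ∈ Line ∣ Q M ]
    ; _I_   = λ x M → value x I value M
    }

  IsSubPolygon : ℕ → Pred Point ℓ₁ → Pred Line ℓ₂ → Set (p ⊔ l ⊔ i ⊔ ℓ₁ ⊔ ℓ₂)
  IsSubPolygon n P Q = IsWeakPolygon n (induced P Q)

-- A common level ℓ is used here for points, lines, incidence and subsets.
-- The two predicates below make up ⟨ S ⟩; they quantify over subsets and
-- therefore live one level higher.
module _ (G : Geometry ℓ ℓ ℓ) (n : ℕ) where
  open Geometry G

  ⟨_⟩ₚ : Pred Point ℓ → Pred Point (lsuc ℓ)
  ⟨ S ⟩ₚ x = ∀ (P : Pred Point ℓ) (Q : Pred Line ℓ) →
             IsSubPolygon G n P Q → S ⊆ P → x ∈ P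

  ⟨_⟩ₗ : Pred Point ℓ → Pred Line (lsuc ℓ)
  ⟨ S ⟩ₗ M = ∀ (P : Pred Point ℓ) (Q : Pred Line ℓ) →
             IsSubPolygon G n P Q → S ⊆ P → M ∈ Q

  LocallyFinitelyGenerated : Set (lsuc ℓ)
  LocallyFinitelyGenerated =
    ∀ (S : Pred Point ℓ) → Finite S →
    IsSubPolygon G n ⟨ S ⟩ₚ ⟨ S ⟩ₗ →
    Finite ⟨ S ⟩ₚ × Finite ⟨ S ⟩ₗ

------------------------------------------------------------------------
-- Epimorphisms

record Epimorphism {p₁ l₁ i₁ p₂ l₂ i₂}
       (Γ : Geometry p₁ l₁ i₁) (Δ : Geometry p₂ l₂ i₂)
       : Set (p₁ ⊔ l₁ ⊔ i₁ ⊔ p₂ ⊔ l₂ ⊔ i₂) where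
  private
    module Γ = Geometry Γ
    module Δ = Geometry Δ
  field
    onPoint            : Γ.Point → Δ.Point
    onLine             : Γ.Line → Δ.Line
    preserves-I        : ∀ {x M} → x Γ.I M → onPoint x Δ.I onLine M
    onPoint-surjective : StrictlySurjective _≡_ onPoint
    onLine-surjective  : StrictlySurjective _≡_ onLine

  γ⁻¹ₚ : Δ.Point → Pred Γ.Point p₂
  γ⁻¹ₚ x y = onPoint y ≡ x

  γ⁻¹ₗ : Δ.Line → Pred Γ.Line l₂
  γ⁻¹ₗ M K = onLine K ≡ M

dualEpi : ∀ {p₁ l₁ i₁ p₂ l₂ i₂}
          {Γ : Geometry p₁ l₁ i₁} {Δ : Geometry p₂ l₂ i₂} →
          Epimorphism Γ Δ → Epimorphism (dual Γ) (dual Δ)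
dualEpi γ = record
  { onPoint            = onLine
  ; onLine             = onPoint
  ; preserves-I        = preserves-I
  ; onPoint-surjective = onLine-surjective
  ; onLine-surjective  = onPoint-surjective
  }
  where open Epimorphism γ

-- The names of the points of an ordinary n-gon, in cyclic order; side j
-- is then the line joining vertex j and vertex (next j).
record Naming (n : ℕ) (Δ : Geometry p l i) : Set (p ⊔ l ⊔ i) where
  field
    polygon    : OrdinaryPolygon Δ n
    all-points : StrictlySurjective _≡_ (OrdinaryPolygon.vertex polygon)
  open OrdinaryPolygon polygon public

module _ {p₁ l₁ i₁ p₂ l₂ i₂}
         {Γ : Geometry p₁ l₁ i₁} {Δ : Geometry p₂ l₂ i₂}
         (γ : Epimorphism Γ Δ) where
  open Geometry Γ
  open Epimorphism γ

  record IsTypeA₄ (names : Naming 4 Δ) (L : Line)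
         : Set (p₁ ⊔ l₁ ⊔ i₁ ⊔ p₂ ⊔ l₂) where
    open Naming names

    Ã : Pred Point p₂
    Ã = γ⁻¹ₚ (vertex 0F)
    B̃ : Pred Point p₂
    B̃ = γ⁻¹ₚ (vertex 1F)
    C̃ : Pred Point p₂
    C̃ = γ⁻¹ₚ (vertex 2F)
    D̃ : Pred Point p₂
    D̃ = γ⁻¹ₚ (vertex 3F)

    γ⁻¹ab : Pred Line l₂
    γ⁻¹ab = γ⁻¹ₗ (side 0F)
    γ⁻¹bc : Pred Line l₂
    γ⁻¹bc = γ⁻¹ₗ (side 1F)
    γ⁻¹cd : Pred Line l₂
    γ⁻¹cd = γ⁻¹ₗ (side 2F)
    γ⁻¹da : Pred Line l₂
    γ⁻¹da = γ⁻¹ₗ (side 3F)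

    field
      partition : IsPartition Ã B̃ (_I L)
      C̃-points  : C̃ ≐ ∁ (_I L) ∩ CollinearWithSome B̃
      D̃-points  : D̃ ≐ ∁ (_I L) ∩ CollinearWithSome Ã
      ab-lines  : γ⁻¹ab ≐ ｛ L ｝
      bc-lines  : γ⁻¹bc ≐ IncidentWithSome B̃ ∖ ｛ L ｝
      da-lines  : γ⁻¹da ≐ IncidentWithSome Ã ∖ ｛ L ｝
      cd-lines  : γ⁻¹cd ≐ IncidentWithSome C̃ ∩ IncidentWithSome D̃

  record IsTypeA₆ (names : Naming 6 Δ) (L : Line)
         : Set (p₁ ⊔ l₁ ⊔ i₁ ⊔ p₂ ⊔ l₂) where
    open Naming names

    Ã : Pred Point p₂
    Ã = γ⁻¹ₚ (vertex 0F)
    B̃ : Pred Point p₂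
    B̃ = γ⁻¹ₚ (vertex 1F)
    C̃ : Pred Point p₂
    C̃ = γ⁻¹ₚ (vertex 2F)
    D̃ : Pred Point p₂
    D̃ = γ⁻¹ₚ (vertex 3F)
    Ẽ : Pred Point p₂
    Ẽ = γ⁻¹ₚ (vertex 4F)
    F̃ : Pred Point p₂
    F̃ = γ⁻¹ₚ (vertex 5F)

    γ⁻¹ab : Pred Line l₂
    γ⁻¹ab = γ⁻¹ₗ (side 0F)
    γ⁻¹bc : Pred Line l₂
    γ⁻¹bc = γ⁻¹ₗ (side 1F)
    γ⁻¹cd : Pred Line l₂
    γ⁻¹cd = γ⁻¹ₗ (side 2F)
    γ⁻¹de : Pred Line l₂
    γ⁻¹de = γ⁻¹ₗ (side 3F)
    γ⁻¹ef : Pred Line l₂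
    γ⁻¹ef = γ⁻¹ₗ (side 4F)
    γ⁻¹fa : Pred Line l₂
    γ⁻¹fa = γ⁻¹ₗ (side 5F)

    field
      partition : IsPartition C̃ B̃ (_I L)
      D̃-points  : D̃ ≐ ∁ (_I L) ∩ CollinearWithSome C̃
      Ã-points  : Ã ≐ ∁ (_I L) ∩ CollinearWithSome B̃
      Ẽ-points  : Ẽ ≐ CollinearWithSome D̃ ∖ (C̃ ∪ D̃)
      F̃-points  : F̃ ≐ CollinearWithSome Ã ∖ (Ã ∪ B̃)
      bc-lines  : γ⁻¹bc ≐ ｛ L ｝
      cd-lines  : γ⁻¹cd ≐ IncidentWithSome C̃ ∖ ｛ L ｝
      ab-lines  : γ⁻¹ab ≐ IncidentWithSome B̃ ∖ ｛ L ｝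
      de-lines  : γ⁻¹de ≐ IncidentWithSome D̃ ∖ γ⁻¹cd
      fa-lines  : γ⁻¹fa ≐ IncidentWithSome Ã ∖ γ⁻¹ab
      ef-lines  : γ⁻¹ef ≐ IncidentWithSome F̃ ∖ γ⁻¹fa

  data TypeA : ℕ → Set (p₁ ⊔ l₁ ⊔ i₁ ⊔ p₂ ⊔ l₂ ⊔ i₂) where
    quadrangle : ∀ names L → IsTypeA₄ names L → TypeA 4
    hexagon    : ∀ names L → IsTypeA₆ names L → TypeA 6

TypeB : ∀ {p₁ l₁ i₁ p₂ l₂ i₂}
        {Γ : Geometry p₁ l₁ i₁} {Δ : Geometry p₂ l₂ i₂} →
        Epimorphism Γ Δ → ℕ → Set (p₁ ⊔ l₁ ⊔ i₁ ⊔ p₂ ⊔ l₂ ⊔ i₂)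
TypeB γ n = TypeA (dualEpi γ) n

{-# OPTIONS --safe #-}
module Submission where

-- Suppose first that Γ is finite, and label its elements by an ordinary n-gon
-- e₀, e₁, … (retracting Δ onto an apartment).  Two elements in opposite cells
-- are opposite, so the number W_i of neighbours in cell i + 1 of an element of
-- cell i depends on i only, and W_{i+n} counts its neighbours in cell i - 1.
-- Counting a cell from an opposite element, and from an edge where walks fold
-- at most once, gives with w = W - 1, w̄_i = w_{i+n}
--
--   w_0 w̄_{n-1} = w_0 w̄_1 + w_1 w̄_2 + … + w_{n-2} w̄_{n-1} .
--
-- Reading w_i / (w_i + w̄_i) as the probability of independent events X_i, the
-- right side is the expected number of descents; equality leaves almost surely
-- at most one change among X_0, …, X_{n-1}, so n - 1 cyclically consecutive w_i
-- vanish.  The size of a cell is a product of n - 1 consecutive W_i, so some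
-- cell has one element.  In general, if every cell had two elements, so would
-- the cells of a finite thick subpolygon; hence some fibre of γ is a single
-- element.  If the lines of Δ had three points, common opposites would leave
-- only two lines through some point of Γ; so s = 1, and the single fibre is
-- {L} for type (a) or a point for type (b).

open import Axiom.ExcludedMiddle using (ExcludedMiddle)
open import Data.Bool.Base using (Bool; true; false; not)
open import Data.Bool.Properties using (not-¬; not-involutive)
open import Data.Empty using (⊥; ⊥-elim)
open import Data.Fin.Base using (Fin; zero; suc; toℕ; fromℕ<; _↑ˡ_)
open import Data.Fin.Patterns
open import Data.Fin.Properties using (toℕ-injective; toℕ<n; toℕ-fromℕ<; ↑ˡ-injective)
open import Data.Irrelevant using ([_])
open import Data.List.Base using (List; []; _∷_; _++_; concat; filter; tabulate; upTo) renaming (map to mapᴸ)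
open import Data.List.Membership.Propositional using (_∈_)
open import Data.List.Membership.Propositional.Properties
  using (∈-concat⁺′; ∈-filter⁺; ∈-filter⁻; ∈-map⁺; ∈-map⁻; ∈-tabulate⁺; ∈-upTo⁺; ∈-++⁺ˡ; ∈-++⁺ʳ)
open import Data.List.Relation.Unary.All as All using ([]; _∷_)
open import Data.List.Relation.Unary.AllPairs using ([]; _∷_)
open import Data.List.Relation.Unary.Any using (here; there)
open import Data.List.Relation.Unary.Unique.Propositional using (Unique)
open import Data.Nat.Base hiding (_⊔_; parity)
open import Data.Nat.DivMod
open import Data.Nat.Induction using (<-rec)
open import Data.Nat.ListAction using (sum)
open import Data.Nat.Properties
open import Data.Nat.Tactic.RingSolver using (solve-∀)
open import Data.Product.Base using (Σ-syntax; ∃; ∃-syntax; _×_; _,_; proj₁; proj₂)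
open import Data.Refinement using (Refinement; value) renaming (_,_ to _,ʳ_)
open import Data.Refinement.Properties using (value-injective)
open import Data.Sum.Base using (_⊎_; inj₁; inj₂; fromInj₁; fromInj₂)
open import Data.Sum.Properties using (inj₁-injective; inj₂-injective; ≡-dec)
open import Function.Base using (_∘_; id; case_of_)
open import Function.Definitions using (Injective)
open import Level using (Level; Lift; _⊔_; lift; lower) renaming (suc to lsuc)
open import Relation.Binary.Definitions using (DecidableEquality; tri<; tri≈; tri>)
open import Relation.Binary.PropositionalEquality
open import Relation.Nullary using (¬_; Dec; yes; no; recompute)
open import Relation.Nullary.Decidable using (True; map′; toWitness)
open import Relation.Unary using (Pred; Decidable; _⊆_)
open import Defs
import Data.List.Membership.DecPropositional
import Data.List.Relation.Unary.Unique.Propositional.Properties as Unique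
import Data.Refinement.Properties as Refinement

-- Points and lines become the two kinds of vertices of one bipartite graph, so an argument and its
-- dual are a single argument, and shortest walks of fewer than `n` edges are unique. The retraction
-- is needed because the lines of Δ may still be long, so Δ itself need not be one apartment; since
-- its apartment stays fixed, a one-element cell over Δ gives a one-element fibre. Local finite
-- generation speaks only of hulls already known to be sub n-gons. A hull is always convex, and it
-- becomes a thick n-gon once its generators account for three neighbours of each vertex of some
-- 2n-cycle; two further elements for each cell keep all cells large, against the count. The
-- evenness of `n` enters through the valencies: they alternate along the cycle between those of
-- points and those of lines, so the w_i have to be rescaled to a common total, and the two sides of
-- the descent equation then carry the same factor because `n - 1` is odd.

kindAfter : ℕ → Bool → Bool
kindAfter zero    c = c
kindAfter (suc k) c = kindAfter k (not c)

kindAfter-not : ∀ k c → kindAfter k (not c) ≡ not (kindAfter k c)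
kindAfter-not zero    c = refl
kindAfter-not (suc k) c = kindAfter-not k (not c)

kindAfter-step : ∀ k c → kindAfter (suc k) c ≢ kindAfter k c
kindAfter-step k c eq = not-¬ refl (trans (sym eq) (kindAfter-not k c))

-- Bipartite graphs and non-backtracking walks

record Graph (a b : Level) : Set (lsuc (a ⊔ b)) where
  infix 4 _~_
  field
    V      : Set a
    _~_    : V → V → Set b
    ~-sym  : ∀ {x y} → x ~ y → y ~ x
    kind   : V → Bool
    kind-~ : ∀ {x y} → x ~ y → kind y ≡ not (kind x)
    _≟ⱽ_    : DecidableEquality V

  -- A non-backtracking walk with k + 1 edges, of which x ~ y is the first
  -- and p ~ v the last.
  data Walk : V → V → ℕ → V → V → Set (a ⊔ b) where
    edge : ∀ {x y} → x ~ y → Walk x y 0 x y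
    cons : ∀ {x y z k p v} → x ~ y → z ≢ x → Walk y z k p v → Walk x y (suc k) p v

  Reach : V → V → ℕ → V → Set (a ⊔ b)
  Reach x y k v = ∃[ p ] Walk x y k p v

  first~ : ∀ {x y k p v} → Walk x y k p v → x ~ y
  first~ (edge xy)     = xy
  first~ (cons xy _ _) = xy

  last~ : ∀ {x y k p v} → Walk x y k p v → p ~ v
  last~ (edge xy)    = xy
  last~ (cons _ _ w) = last~ w

  join : ∀ {x y k p v c l q w} → Walk x y k p v → c ≢ p → Walk v c l q w →
         Walk x y (suc (k + l)) q w
  join (edge xy)       c≢p w′ = cons xy c≢p w′
  join (cons xy z≢x w) c≢p w′ = cons xy z≢x (join w c≢p w′)

  snoc : ∀ {x y k p v c} → Walk x y k p v → v ~ c → c ≢ p → Walk x y (suc k) v c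
  snoc (edge xy)       vc c≢p = cons xy c≢p (edge vc)
  snoc (cons xy z≢x w) vc c≢p = cons xy z≢x (snoc w vc c≢p)

  unsnoc : ∀ {x y k p v} → Walk x y (suc k) p v → ∃[ q ] Walk x y k q p × v ≢ q
  unsnoc (cons xy z≢x (edge yz)) = _ , edge xy , z≢x
  unsnoc (cons xy z≢x (cons yz t≢y w)) =
    let q , w′ , v≢q = unsnoc (cons yz t≢y w) in q , cons xy z≢x w′ , v≢q

  rev : ∀ {x y k p v} → Walk x y k p v → Walk v p k y x
  rev (edge xy)       = edge (~-sym xy)
  rev (cons xy z≢x w) = snoc (rev w) (~-sym xy) (≢-sym z≢x)

  kind-walk : ∀ {x y k p v} → Walk x y k p v → kind v ≡ kindAfter (suc k) (kind x)
  kind-walk (edge xy)             = kind-~ xy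
  kind-walk {k = k} (cons xy _ w) =
    trans (kind-walk w) (cong (kindAfter k) (kind-~ xy))

  irreflexive : ∀ {x y} → x ~ y → x ≢ y
  irreflexive xy refl = not-¬ refl (kind-~ xy)

  wrong-parity : ∀ {x y z k p q v} → Walk x y k p v → Walk x z (suc k) q v → ⊥
  wrong-parity {x} {k = k} w w′ =
    kindAfter-step (suc k) (kind x) (trans (sym (kind-walk w′)) (kind-walk w))

  wrong-parity~ : ∀ {x x′ y z k p q v} → x ~ x′ → Walk x y k p v → Walk x′ z k q v → ⊥
  wrong-parity~ {x} {k = k} xx′ w w′ = kindAfter-step (suc k) (kind x) (begin
    kindAfter (suc k) (not (kind x)) ≡⟨ cong (kindAfter (suc k)) (kind-~ xx′) ⟨
    kindAfter (suc k) (kind _)       ≡⟨ kind-walk w′ ⟨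
    kind _                           ≡⟨ kind-walk w ⟩
    kindAfter (suc k) (kind x)       ∎)
    where open ≡-Reasoning

  -- Past its end a walk stays at its last vertex, which makes `at` total; all uses keep the index
  -- at most `suc k`.
  at : ∀ {x y k p v} → Walk x y k p v → ℕ → V
  at (edge {x} _)      zero    = x
  at (edge {y = y} _)  (suc i) = y
  at (cons {x} _ _ _)  zero    = x
  at (cons _ _ w)      (suc i) = at w i

  at-0 : ∀ {x y k p v} (w : Walk x y k p v) → at w 0 ≡ x
  at-0 (edge _)     = refl
  at-0 (cons _ _ _) = refl

  at-1 : ∀ {x y k p v} (w : Walk x y k p v) → at w 1 ≡ y
  at-1 (edge _)     = refl
  at-1 (cons _ _ w) = at-0 w

  at-k : ∀ {x y k p v} (w : Walk x y k p v) → at w k ≡ p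
  at-k (edge _)     = refl
  at-k (cons _ _ w) = at-k w

  at-end : ∀ {x y k p v} (w : Walk x y k p v) → at w (suc k) ≡ v
  at-end (edge _)     = refl
  at-end (cons _ _ w) = at-end w

  at-step : ∀ {x y k p v} (w : Walk x y k p v) {i} → i ≤ k → at w i ~ at w (suc i)
  at-step (edge xy)     {zero}  _       = xy
  at-step (cons xy _ w) {zero}  _       = subst (_ ~_) (sym (at-0 w)) xy
  at-step (cons _ _ w)  {suc i} (s≤s l) = at-step w l

  at-turn : ∀ {x y k p v} (w : Walk x y k p v) {i} → i < k → at w (2 + i) ≢ at w i
  at-turn (cons _ z≢x w) {zero}  _       = z≢x ∘ trans (sym (at-1 w))
  at-turn (cons _ _ w)   {suc i} (s≤s l) = at-turn w l

  at-snoc : ∀ {x y k p v c} (w : Walk x y k p v) (vc : v ~ c) (c≢p : c ≢ p) {i} →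
            i ≤ suc k → at (snoc w vc c≢p) i ≡ at w i
  at-snoc (edge _)     vc c≢p {zero}        _ = refl
  at-snoc (edge _)     vc c≢p {suc zero}    _ = refl
  at-snoc (edge _)     vc c≢p {suc (suc i)} (s≤s ())
  at-snoc (cons _ _ w) vc c≢p {zero}        _ = refl
  at-snoc (cons _ _ w) vc c≢p {suc i}       (s≤s l) = at-snoc w vc c≢p l

  at-join : ∀ {x y k p v c l q u} (w : Walk x y k p v) (c≢p : c ≢ p) (w′ : Walk v c l q u) {i} →
            i ≤ suc k → at (join w c≢p w′) i ≡ at w i
  at-join (edge _)     c≢p w′ {zero}        _ = refl
  at-join (edge _)     c≢p w′ {suc zero}    _ = at-0 w′
  at-join (edge _)     c≢p w′ {suc (suc i)} (s≤s ())
  at-join (cons _ _ w) c≢p w′ {zero}        _ = refl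
  at-join (cons _ _ w) c≢p w′ {suc i}       (s≤s l) = at-join w c≢p w′ l

  -- Serves both to cut a stretch out of a walk and to read walks off a cycle.
  along : (f : ℕ → V) (m : ℕ) → (∀ {i} → i ≤ m → f i ~ f (suc i)) →
          (∀ {i} → i < m → f (2 + i) ≢ f i) →
          ∀ i d → d + i ≤ m → Walk (f i) (f (suc i)) d (f (d + i)) (f (suc d + i))
  along f m step turn i zero    l = edge (step l)
  along f m step turn i (suc d) l =
    snoc (along f m step turn i d (<⇒≤ l)) (step l) (turn l)

  slice : ∀ {x y k p v} (w : Walk x y k p v) i d → d + i ≤ k →
          Walk (at w i) (at w (suc i)) d (at w (d + i)) (at w (suc d + i))
  slice w = along (at w) _ (at-step w) (at-turn w)

  -- The index runs over all of ℕ so that no modular arithmetic is needed to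
  -- move along the cycle.
  record Cycle (L : ℕ) : Set (a ⊔ b) where
    field
      vtx    : ℕ → V
      step   : ∀ i → vtx i ~ vtx (suc i)
      turn   : ∀ i → vtx (2 + i) ≢ vtx i
      period : ∀ i → vtx (L + i) ≡ vtx i

    forth : ∀ i d → Walk (vtx i) (vtx (suc i)) d (vtx (d + i)) (vtx (suc d + i))
    forth i d = along vtx (d + i) (λ {j} _ → step j) (λ {j} _ → turn j) i d ≤-refl

  shift : ∀ {L} → ℕ → Cycle L → Cycle L
  shift {L} s C = record
    { vtx    = λ i → vtx (s + i)
    ; step   = λ i → subst (λ j → vtx (s + i) ~ vtx j) (sym (+-suc s i)) (step (s + i))
    ; turn   = λ i → subst (λ j → vtx j ≢ vtx (s + i))
                 (sym (trans (+-suc s (suc i)) (cong suc (+-suc s i)))) (turn (s + i))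
    ; period = λ i → trans (cong vtx (shuffle i)) (period (s + i))
    }
    where
    open Cycle C
    shuffle : ∀ i → s + (L + i) ≡ L + (s + i)
    shuffle i = trans (sym (+-assoc s L i)) (trans (cong (_+ i) (+-comm s L)) (+-assoc L s i))

-- Polygons as graphs of girth 2n and diameter n

record IsPolygonal {a b} (n : ℕ) (G : Graph a b) : Set (a ⊔ b) where
  open Graph G
  field
    3≤n    : 3 ≤ n
    -- A closed walk may turn back at `x` itself; cancelling its first and last edge then leaves a
    -- shorter closed walk.
    girth  : ∀ {x y k p} → Walk x y k p x → n + n ≤ suc k
    diam   : ∀ x v → x ≡ v ⊎ (∃[ y ] ∃[ k ] k < n × Reach x y k v)
    extend : ∀ p v → ∃[ c ] v ~ c × c ≢ p

  1≤n : 1 ≤ n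
  1≤n = ≤-trans (s≤s z≤n) 3≤n

  no-closed : ∀ {x y k p} → Walk x y k p x → suc k < n + n → ⊥
  no-closed w = ≤⇒≯ (girth w)

  -- If the first steps differed, one walk reversed and followed by the other would close up with
  -- fewer than `n + n` edges.
  unique-first : ∀ {x y y′ k k′ p p′ v} → Walk x y k p v → Walk x y′ k′ p′ v →
                 suc k + suc k′ < n + n → y ≡ y′
  unique-first {y = y} {y′} {k} {k′} w w′ short with y ≟ⱽ y′
  ... | yes y≡y′ = y≡y′
  ... | no  y≢y′ = ⊥-elim (no-closed (join (rev w) (≢-sym y≢y′) w′)
                     (subst (_< n + n) (cong suc (+-suc k k′)) short))

  unique-after : ∀ {x y k k′ p p′ v} → Walk x y k p v → Walk x y k′ p′ v →
                 k + k′ < n + n → k ≡ k′ × p ≡ p′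
  unique-after (edge _) (edge _) short = refl , refl
  unique-after (edge _) (cons _ _ w′) short = ⊥-elim (no-closed w′ short)
  unique-after {k = suc k} (cons _ _ w) (edge _) short =
    ⊥-elim (no-closed w (subst (_< n + n) (+-identityʳ (suc k)) short))
  unique-after {k = suc k} {suc k′} (cons _ _ w) (cons _ _ w′) short
    with refl ← unique-first w w′ short =
    let k≡k′ , p≡p′ = unique-after w w′ (≤-<-trans (+-mono-≤ (n≤1+n k) (n≤1+n k′)) short)
    in cong suc k≡k′ , p≡p′

  unique : ∀ {x y y′ k k′ p p′ v} → Walk x y k p v → Walk x y′ k′ p′ v →
           suc k + suc k′ < n + n → y ≡ y′ × k ≡ k′ × p ≡ p′
  unique {k = k} {k′} w w′ short with refl ← unique-first w w′ short =
    refl , unique-after w w′ (≤-<-trans (+-mono-≤ (n≤1+n k) (n≤1+n k′)) short)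

  unique-first-diff : ∀ {x y y′ k k′ p p′ v} → y ≢ y′ →
                      Walk x y k p v → Walk x y′ k′ p′ v → n + n ≤ suc k + suc k′
  unique-first-diff y≢y′ w w′ = ≮⇒≥ (y≢y′ ∘ unique-first w w′)

  unique-last-diff : ∀ {x y y′ k k′ p p′ v} → p ≢ p′ →
                     Walk x y k p v → Walk x y′ k′ p′ v → n + n ≤ suc k + suc k′
  unique-last-diff p≢p′ w w′ = unique-first-diff p≢p′ (rev w) (rev w′)

  -- `x` and `z` are opposite. The distance from `x` to `q` is at most `n` and not `n` by parity, so
  -- it must be `n - 1`. This is the projection that matches the neighbours of opposite vertices.
  opposite-nbr : ∀ {x b k p z q} → suc k ≡ n → Walk x b k p z → z ~ q →
                 ∃[ c ] Walk x c k q z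
  opposite-nbr {x} {b} {k} {p} {z} {q} refl w zq with p ≟ⱽ q
  ... | yes refl = b , w
  ... | no  p≢q with diam x q
  ...   | inj₁ refl = ⊥-elim (<⇒≢ (≤-trans (s≤s z≤n) (≤-pred 3≤n))
                        (proj₁ (proj₂ (unique (edge (~-sym zq)) w
                          (+-monoˡ-≤ (suc k) (≤-trans (s≤s (s≤s z≤n)) 3≤n))))))
  ...   | inj₂ (c , k′ , k′<n , r , w′) with r ≟ⱽ z
  ...     | no r≢z with snoc w′ (~-sym zq) (≢-sym r≢z)
  ...       | w″ with m<1+n⇒m<n∨m≡n k′<n
  ...         | inj₂ refl = ⊥-elim (wrong-parity w w″)
  ...         | inj₁ k′<k = c , subst (λ m → Walk x c m q z)
                  (≤-antisym k′<k (≤-pred (+-cancelʳ-≤ n n _ (unique-last-diff (≢-sym p≢q) w″ w)))) w″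
  opposite-nbr {x} {k = k} {z = z} {q} refl w zq | no p≢q
          | inj₂ (c , zero , k′<n , r , edge _) | yes refl =
            ⊥-elim (no-closed w (m<m+n (suc k) (s≤s z≤n)))
  opposite-nbr {x} {k = k} {z = z} {q} refl w zq | no p≢q
          | inj₂ (c , suc k′ , k′<n , r , w′) | yes refl =
            let _ , w″ , _ = unsnoc w′
            in ⊥-elim (<⇒≢ (≤-pred k′<n)
                 (proj₁ (proj₂ (unique w″ w (+-monoˡ-< (suc k) k′<n)))))

  vertices-distinct : ∀ {x y k p} (w : Walk x y k p x) → suc k ≡ n + n →
                      ∀ {i j} → i < j → j ≤ k → at w i ≢ at w j
  vertices-distinct w sk≡ {i} i<j j≤k eq with d , refl ← m≤n⇒∃[o]m+o≡n i<j =
    no-closed (subst (Walk _ _ d _) (trans (cong (at w ∘ suc) (+-comm d i)) (sym eq))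
                 (slice w i d (≤-trans (≤-reflexive (+-comm d i)) (<⇒≤ j≤k))))
      (≤-trans (s≤s (≤-trans (s≤s (m≤n+m d i)) j≤k)) (≤-reflexive sk≡))

  cycle-distinct : (C : Cycle (n + n)) → let open Cycle C in
                   ∀ i d → suc d < n + n → vtx (suc d + i) ≢ vtx i
  cycle-distinct C i d short eq = no-closed (subst (Walk _ _ d _) eq (Cycle.forth C i d)) short

  prolong : ∀ {x y k p v} (w : Walk x y k p v) m → k ≤ m →
            ∃[ q ] ∃[ u ] Σ[ w′ ∈ Walk x y m q u ] (∀ {i} → i ≤ suc k → at w′ i ≡ at w i)
  prolong {k = k} w m k≤m with m≤n⇒m<n∨m≡n k≤m
  ... | inj₂ refl = _ , _ , w , λ _ → refl
  prolong w (suc m) _ | inj₁ (s≤s k≤m) =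
    let q , u , w′ , same = prolong w m k≤m
        c , uc , c≢q      = extend q u
    in u , c , snoc w′ uc c≢q ,
       λ l → trans (at-snoc w′ uc c≢q (≤-trans l (s≤s k≤m))) (same l)

  circuit : ∀ {x y k p v c} (w : Walk x y k p v) → k < n → x ~ c → c ≢ y →
            ∃[ K ] suc K ≡ n + n × (Σ[ w′ ∈ Walk x y K c x ]
              (∀ {i} → i ≤ suc k → at w′ i ≡ at w i))
  circuit {x} {y} {k} {c = c} w k<n xc c≢y =
    let m         = pred n
        1+m≡n     = suc-pred n ⦃ >-nonZero 1≤n ⦄
        k≤m       = ≤-pred (≤-trans k<n (≤-reflexive (sym 1+m≡n)))
        q , z , w₁ , same = prolong w m k≤m
        q′ , w₂   = opposite-nbr 1+m≡n (rev w₁) xc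
        q′≢q      = λ eq → c≢y (sym (proj₂ (unique-after (rev w₁)
                      (subst (λ t → Walk z t m c x) eq w₂)
                      (+-mono-< (≤-reflexive 1+m≡n) (≤-reflexive 1+m≡n)))))
        w′        = join w₁ q′≢q w₂
    in suc (m + m) ,
       trans (cong suc (sym (+-suc m m))) (cong₂ _+_ 1+m≡n 1+m≡n) ,
       w′ ,
       λ l → trans (at-join w₁ q′≢q w₂ (≤-trans l (s≤s k≤m))) (same l)

  -- Distances to z of adjacent vertices differ by at most one.
  nbr-distance : ∀ {x f k f′ z x′} → Walk x f k f′ z → suc k ≤ n → x ~ x′ →
                 (x′ ≡ z × k ≡ 0) ⊎
                 (∃[ g ] ∃[ l ] ∃[ g′ ] Walk x′ g l g′ z × suc l ≤ n × k ≤ suc l)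
  nbr-distance {x} {f} {k} {f′} {z} {x′} w k<n xx′ with x′ ≟ⱽ f
  nbr-distance (edge _) k<n xx′ | yes refl = inj₁ (refl , refl)
  nbr-distance (cons _ _ w) k<n xx′ | yes refl = inj₂ (_ , _ , _ , w , <⇒≤ k<n , ≤-refl)
  ... | no x′≢f with m≤n⇒m<n∨m≡n k<n
  ...   | inj₁ short = inj₂ (_ , _ , _ , cons (~-sym xx′) (≢-sym x′≢f) w , short , ≤-trans (n≤1+n k) (n≤1+n (suc k)))
  ...   | inj₂ refl with opposite-nbr refl (rev w) xx′
  nbr-distance (edge _) k<n xx′ | no x′≢f | inj₂ refl | _ = ⊥-elim (<⇒≱ (s≤s (s≤s z≤n)) 3≤n)
  nbr-distance {k = suc k} w k<n xx′ | no x′≢f | inj₂ refl | _ , w′ =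
    let _ , w″ , _ = unsnoc w′ in inj₂ (_ , _ , _ , rev w″ , n≤1+n (suc k) , ≤-refl)

  irreflexive-walk : ∀ {x y k p} → k < n → Walk x y k p x → ⊥
  irreflexive-walk k<n w = no-closed w (≤-<-trans k<n (m<m+n n 1≤n))

  opposite-ends : ∀ {x y d d′ v} → Reach x y d v → Reach y x d′ v → d < n → d′ < n → ⊥
  opposite-ends (_ , edge _) (_ , w′) d<n d′<n = irr w′ d′<n
    where
    irr : ∀ {x y k p} → Walk x y k p x → k < n → ⊥
    irr w k<n = no-closed w (≤-<-trans k<n (m<m+n n 1≤n))
  opposite-ends {d = suc d} {d′} (_ , cons _ z≢x w) (_ , w′) d<n d′<n =
    z≢x (unique-first w w′ (+-mono-<-≤ d<n d′<n))

  same-end : ∀ {x y d d′ v} → Reach x y d v → Reach x y d′ v → d < n → d′ < n → d ≡ d′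
  same-end (_ , w) (_ , w′) d<n d′<n = proj₁ (unique-after w w′ (+-mono-< d<n d′<n))

  -- The walk starts with the edge itself, so `d` is the distance of `v` from the nearer end.
  -- Distance `n` from both ends would contradict bipartiteness.
  divide : ∀ {x y} → x ~ y → ∀ v → ∃[ d ] d < n × (Reach x y d v ⊎ Reach y x d v)
  divide {x} {y} xy v with diam x v
  ... | inj₁ refl = 0 , 1≤n , inj₂ (_ , edge (~-sym xy))
  ... | inj₂ (c , k , k<n , p , w) with c ≟ⱽ y
  ...   | yes refl = k , k<n , inj₁ (p , w)
  ...   | no  c≢y with m≤n⇒m<n∨m≡n k<n
  ...     | inj₁ short = suc k , short , inj₂ (p , cons (~-sym xy) c≢y w)
  ...     | inj₂ refl with diam y v
  ...       | inj₁ refl = 0 , s≤s z≤n , inj₁ (_ , edge xy)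
  ...       | inj₂ (c′ , k′ , k′<n , p′ , w′) with c′ ≟ⱽ x
  ...         | yes refl = k′ , k′<n , inj₂ (p′ , w′)
  ...         | no  c′≢x with m≤n⇒m<n∨m≡n k′<n
  ...           | inj₁ short = suc k′ , short , inj₁ (p′ , cons xy c′≢x w′)
  ...           | inj₂ refl = ⊥-elim (wrong-parity~ xy w w′)

  nbr-same-side : ∀ {x y d d′ u v} → d < n → d′ < n → Reach x y d u → Reach x y d′ v → u ~ v →
                  d′ ≡ suc d ⊎ d ≡ suc d′
  nbr-same-side {v = v} d<n d′<n (p , w) r uv with v ≟ⱽ p
  nbr-same-side d<n d′<n (p , edge _) (_ , w′) uv | yes refl =
    ⊥-elim (no-closed w′ (≤-<-trans d′<n (m<m+n n 1≤n)))
  nbr-same-side {d = suc d} d<n d′<n (p , w@(cons _ _ _)) r uv | yes refl =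
    let _ , w″ , _ = unsnoc w in inj₂ (cong suc (same-end (_ , w″) r (<⇒≤ d<n) d′<n))
  nbr-same-side d<n d′<n (p , w) (_ , w′) uv | no v≢p =
    inj₁ (sym (proj₁ (unique-after (snoc w uv v≢p) w′ (+-mono-≤-< d<n d′<n))))

  -- An edge between the two sides is the dividing edge itself or joins vertices at the greatest
  -- distance `n - 1` from it; any other would close a short cycle.
  nbr-other-side : ∀ {x y d d′ u v} → d < n → d′ < n → Reach x y d u → Reach y x d′ v → u ~ v →
                   (d ≡ 0 × d′ ≡ 0) ⊎ (suc d ≡ n × suc d′ ≡ n)
  nbr-other-side {v = v} d<n d′<n (p , w) r uv with v ≟ⱽ p
  nbr-other-side d<n d′<n (p , edge _) (_ , w′) uv | yes refl =
    inj₁ (refl , proj₁ (unique-after w′ (edge uv) (≤-<-trans (≤-reflexive (+-identityʳ _)) (≤-trans d′<n (m≤m+n n n)))))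
  nbr-other-side {d = suc d} d<n d′<n (p , w@(cons _ _ _)) r uv | yes refl =
    let _ , w″ , _ = unsnoc w in ⊥-elim (opposite-ends (_ , w″) r (<⇒≤ d<n) d′<n)
  nbr-other-side {d = d} {d′} d<n d′<n (p , w) (_ , w′) uv | no v≢p = inj₂ (go (snoc w uv v≢p))
    where
    go : Walk _ _ (suc d) _ _ → _
    go (cons _ z≢x w″) =
      let long = unique-first-diff z≢x w″ w′ in
      ≤-antisym d<n (+-cancelʳ-≤ n n (suc d) (≤-trans long (+-monoʳ-≤ (suc d) d′<n))) ,
      ≤-antisym d′<n (+-cancelˡ-≤ n n (suc d′) (≤-trans long (+-monoˡ-≤ (suc d′) d<n)))

-- Incidence graphs and ordinary polygons

halve : ∀ i → ∃[ j ] (i ≡ j + j ⊎ i ≡ suc (j + j))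
halve zero    = 0 , inj₁ refl
halve (suc i) with halve i
... | j , inj₁ refl = j , inj₂ refl
... | j , inj₂ refl = suc j , inj₁ (cong suc (sym (+-suc j j)))

double-cancel-≤ : ∀ {i j} → i + i ≤ j + j → i ≤ j
double-cancel-≤ {i} {j} l = ≮⇒≥ λ j<i → <⇒≱ (+-mono-< j<i j<i) l

double-cancel-< : ∀ {i j} → i + i < j + j → i < j
double-cancel-< {i} {j} l = ≰⇒> λ j≤i → <⇒≱ l (+-mono-≤ j≤i j≤i)

odd<even : ∀ {i m} → i < m → suc (i + i) < m + m
odd<even {i} {m} i<m = ≤-trans (≤-reflexive (cong suc (sym (+-suc i i)))) (+-mono-≤ i<m i<m)

toℕ-next : ∀ {m} (j : Fin m) → (suc (toℕ j) < m × toℕ (next j) ≡ suc (toℕ j))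
                             ⊎ (suc (toℕ j) ≡ m × toℕ (next j) ≡ 0)
toℕ-next {suc m} j with m≤n⇒m<n∨m≡n (toℕ<n j)
... | inj₁ l  = inj₁ (l , trans (toℕ-fromℕ< _) (m<n⇒m%n≡m l))
... | inj₂ eq = inj₂ (eq , trans (toℕ-fromℕ< _) (trans (cong (_% suc m) eq) (n%n≡0 (suc m))))

module _ {p l i} (G : Geometry p l i) where
  open Geometry G

  infix 4 _↔_
  data _↔_ : Element → Element → Set (p ⊔ l ⊔ i) where
    pl : ∀ {x M} → x I M → inj₁ x ↔ inj₂ M
    lp : ∀ {x M} → x I M → inj₂ M ↔ inj₁ x

  isPoint : Element → Bool
  isPoint (inj₁ _) = true
  isPoint (inj₂ _) = false

  incidenceGraph : DecidableEquality Point → DecidableEquality Line →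
                   Graph (p ⊔ l) (p ⊔ l ⊔ i)
  incidenceGraph _≟P_ _≟L_ = record
    { V      = Element
    ; _~_    = _↔_
    ; ~-sym  = λ { (pl xM) → lp xM ; (lp xM) → pl xM }
    ; kind   = isPoint
    ; kind-~ = λ { (pl _) → refl ; (lp _) → refl }
    ; _≟ⱽ_   = ≡-dec _≟P_ _≟L_
    }

module Incidence {p l i} (G : Geometry p l i)
                 (_≟P_ : DecidableEquality (Geometry.Point G))
                 (_≟L_ : DecidableEquality (Geometry.Line G)) where
  open Geometry G
  graph : Graph (p ⊔ l) (p ⊔ l ⊔ i)
  graph = incidenceGraph G _≟P_ _≟L_
  open Graph graph hiding (V)

  the-point : ∀ v → kind v ≡ true → ∃[ x ] inj₁ x ≡ v
  the-point (inj₁ x) _ = x , refl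

  the-line : ∀ v → kind v ≡ false → ∃[ M ] inj₂ M ≡ v
  the-line (inj₂ M) _ = M , refl

  incident : ∀ {x M u v} → inj₁ x ≡ u → inj₂ M ≡ v → u ~ v → x I M
  incident refl refl (pl xM) = xM

  -- Even positions become vertices and odd positions sides, which is why the sequence has to start
  -- at a point.
  module FromClosed (m : ℕ) (f : ℕ → Element)
                    (step : ∀ {i} → i < m + m → f i ~ f (suc i))
                    (closed : f (m + m) ≡ f 0)
                    (distinct : ∀ {i j} → i < j → j < m + m → f i ≢ f j)
                    (point₀ : kind (f 0) ≡ true) where

    kind-even : ∀ j → j + j ≤ m + m → kind (f (j + j)) ≡ true
    kind-even zero    _ = point₀
    kind-even (suc j) h rewrite +-suc j j =
      trans (kind-~ (step h)) (trans (cong not (kind-~ (step (<⇒≤ h))))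
        (trans (not-involutive _) (kind-even j (<⇒≤ (<⇒≤ h)))))

    kind-odd : ∀ j → j < m → kind (f (suc (j + j))) ≡ false
    kind-odd j j<m = trans (kind-~ (step (+-mono-< j<m j<m)))
                           (cong not (kind-even j (<⇒≤ (+-mono-< j<m j<m))))

    vertex∃ : (j : Fin m) → ∃[ x ] inj₁ x ≡ f (toℕ j + toℕ j)
    vertex∃ j = the-point _ (kind-even (toℕ j) (<⇒≤ (+-mono-< (toℕ<n j) (toℕ<n j))))

    side∃ : (j : Fin m) → ∃[ M ] inj₂ M ≡ f (suc (toℕ j + toℕ j))
    side∃ j = the-line _ (kind-odd (toℕ j) (toℕ<n j))

    f-injective : ∀ {i j} → i < m + m → j < m + m → f i ≡ f j → i ≡ j
    f-injective {i} {j} hi hj eq with <-cmp i j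
    ... | tri< i<j _ _ = ⊥-elim (distinct i<j hj eq)
    ... | tri≈ _ i≡j _ = i≡j
    ... | tri> _ _ j<i = ⊥-elim (distinct j<i hi (sym eq))

    after : ∀ (j : Fin m) → f (toℕ (next j) + toℕ (next j)) ≡ f (suc (suc (toℕ j + toℕ j)))
    after j with toℕ-next j
    ... | inj₁ (_ , eq) rewrite eq = cong (f ∘ suc) (+-suc (toℕ j) (toℕ j))
    ... | inj₂ (j≡m , eq) rewrite eq = trans (sym closed)
            (cong f (trans (cong₂ _+_ (sym j≡m) (sym j≡m)) (cong suc (+-suc (toℕ j) (toℕ j)))))

    halves-equal : ∀ {i j : Fin m} → toℕ i + toℕ i ≡ toℕ j + toℕ j → i ≡ j
    halves-equal eq = toℕ-injective (≤-antisym (double-cancel-≤ (≤-reflexive eq))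
                                               (double-cancel-≤ (≤-reflexive (sym eq))))

    polygon : OrdinaryPolygon G m
    polygon = record
      { vertex           = proj₁ ∘ vertex∃
      ; side             = proj₁ ∘ side∃
      ; vertex-injective = λ {i} {j} eq → halves-equal (f-injective
          (+-mono-< (toℕ<n i) (toℕ<n i)) (+-mono-< (toℕ<n j) (toℕ<n j))
          (trans (sym (proj₂ (vertex∃ i))) (trans (cong inj₁ eq) (proj₂ (vertex∃ j)))))
      ; side-injective   = λ {i} {j} eq → halves-equal (suc-injective (f-injective
          (odd<even (toℕ<n i)) (odd<even (toℕ<n j))
          (trans (sym (proj₂ (side∃ i))) (trans (cong inj₂ eq) (proj₂ (side∃ j))))))
      ; incident         = λ j → incident (proj₂ (vertex∃ j)) (proj₂ (side∃ j))
          (step (+-mono-< (toℕ<n j) (toℕ<n j)))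
      ; incident-next    = λ j → incident
          (trans (proj₂ (vertex∃ (next j))) (after j)) (proj₂ (side∃ j))
          (~-sym (step (odd<even (toℕ<n j))))
      }

    contains : ∀ {v} i → i < m + m → f i ≡ v → OrdinaryPolygon.Contains polygon v
    contains i h eq with halve i
    ... | j , inj₁ refl = go _ (trans (proj₂ (vertex∃ j′)) (trans (cong (λ t → f (t + t)) j′≡j) eq))
      where
      j<m = double-cancel-< h
      j′ = fromℕ< j<m
      j′≡j : toℕ j′ ≡ j
      j′≡j = toℕ-fromℕ< j<m
      go : ∀ v → inj₁ (proj₁ (vertex∃ j′)) ≡ v → OrdinaryPolygon.Contains polygon v
      go _ refl = lift (j′ , refl)
    ... | j , inj₂ refl = go _ (trans (proj₂ (side∃ j′)) (trans (cong (λ t → f (suc (t + t))) j′≡j) eq))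
      where
      j<m = double-cancel-< (<⇒≤ h)
      j′ = fromℕ< j<m
      j′≡j : toℕ j′ ≡ j
      j′≡j = toℕ-fromℕ< j<m
      go : ∀ v → inj₂ (proj₁ (side∃ j′)) ≡ v → OrdinaryPolygon.Contains polygon v
      go _ refl = lift (j′ , refl)

  module FromPolygon {k : ℕ} (2≤k : 2 ≤ k) (O : OrdinaryPolygon G k) where
    open OrdinaryPolygon O renaming (incident to incident-same)

    instance
      k≢0 : NonZero k
      k≢0 = >-nonZero (<⇒≤ 2≤k)

    -- The element `i` steps after vertex `j`. Recursion in steps of two keeps halving out of the
    -- definition, and `j` is reduced modulo `k` only when an element is read off.
    elt : ℕ → ℕ → Element
    elt j zero          = inj₁ (vertex (j mod k))
    elt j (suc zero)    = inj₂ (side (j mod k))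
    elt j (suc (suc i)) = elt (suc j) i

    toℕ-mod : ∀ j → toℕ (j mod k) ≡ j % k
    toℕ-mod j = toℕ-fromℕ< (m%n<n j k)

    mod-next : ∀ j → suc j mod k ≡ next (j mod k)
    mod-next j = toℕ-injective (trans (toℕ-mod (suc j)) (go (toℕ-next (j mod k))))
      where
      suc% : suc j % k ≡ suc (j % k) % k
      suc% = trans (%-distribˡ-+ 1 j k) (cong (λ t → (t + j % k) % k) (m<n⇒m%n≡m 2≤k))
      go : _ → suc j % k ≡ toℕ (next (j mod k))
      go (inj₁ (l , eq)) = trans suc% (trans
        (m<n⇒m%n≡m (subst (λ t → suc t < k) (toℕ-mod j) l))
        (sym (trans eq (cong suc (toℕ-mod j)))))
      go (inj₂ (l , eq)) = trans suc% (trans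
        (trans (cong (_% k) (trans (cong suc (sym (toℕ-mod j))) l)) (n%n≡0 k)) (sym eq))

    mod-next-≢ : ∀ j → suc j mod k ≢ j mod k
    mod-next-≢ j eq with toℕ-next (j mod k)
    ... | inj₁ (_ , e) = 1+n≢n (trans (sym e) (cong toℕ (trans (sym (mod-next j)) eq)))
    ... | inj₂ (e , z) = <⇒≢ 2≤k (trans (cong suc (trans (sym z)
                           (cong toℕ (trans (sym (mod-next j)) eq)))) e)

    elt-step : ∀ j i → elt j i ~ elt j (suc i)
    elt-step j zero          = pl (incident-same (j mod k))
    elt-step j (suc zero)    = lp (subst (λ t → vertex t I side (j mod k)) (sym (mod-next j))
                                         (incident-next (j mod k)))
    elt-step j (suc (suc i)) = elt-step (suc j) i

    elt-turn : ∀ j i → elt (suc j) i ≢ elt j i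
    elt-turn j zero          = mod-next-≢ j ∘ vertex-injective ∘ inj₁-injective
    elt-turn j (suc zero)    = mod-next-≢ j ∘ side-injective ∘ inj₂-injective
    elt-turn j (suc (suc i)) = elt-turn (suc j) i

    elt-double : ∀ j m i → elt j (m + m + i) ≡ elt (m + j) i
    elt-double j zero    i = refl
    elt-double j (suc m) i rewrite +-suc m m | sym (+-suc m j) = elt-double (suc j) m i

    elt-mod : ∀ {j j′} → j mod k ≡ j′ mod k → ∀ i → elt j i ≡ elt j′ i
    elt-mod eq zero          = cong (inj₁ ∘ vertex) eq
    elt-mod eq (suc zero)    = cong (inj₂ ∘ side) eq
    elt-mod {j} {j′} eq (suc (suc i)) =
      elt-mod (trans (mod-next j) (trans (cong next eq) (sym (mod-next j′)))) i

    toℕ-mod-id : ∀ (j : Fin k) → toℕ j mod k ≡ j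
    toℕ-mod-id j = toℕ-injective (trans (toℕ-mod (toℕ j)) (m<n⇒m%n≡m (toℕ<n j)))

    cycle : Cycle (k + k)
    cycle = record
      { vtx    = elt 0
      ; step   = elt-step 0
      ; turn   = elt-turn 0
      ; period = λ i → trans (elt-double 0 k i) (elt-mod (toℕ-injective
          (trans (toℕ-mod (k + 0)) (trans k%k≡0%k (sym (toℕ-mod 0))))) i)
      }
      where
      k%k≡0%k : (k + 0) % k ≡ 0 % k
      k%k≡0%k = trans (cong (_% k) (+-comm k 0)) ([m+n]%n≡m%n 0 k)

    vtx-vertex : ∀ j → elt 0 (toℕ j + toℕ j) ≡ inj₁ (vertex j)
    vtx-vertex j = trans (cong (elt 0) (sym (+-identityʳ (toℕ j + toℕ j)))) (trans (elt-double 0 (toℕ j) 0)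
      (cong (inj₁ ∘ vertex) (trans (cong (_mod k) (+-identityʳ (toℕ j))) (toℕ-mod-id j))))

    vtx-side : ∀ j → elt 0 (suc (toℕ j + toℕ j)) ≡ inj₂ (side j)
    vtx-side j = trans (cong (elt 0) (+-comm 1 (toℕ j + toℕ j))) (trans (elt-double 0 (toℕ j) 1)
      (cong (inj₂ ∘ side) (trans (cong (_mod k) (+-identityʳ (toℕ j))) (toℕ-mod-id j))))

    contained : ∀ {v} → Contains v → ∃[ i ] i < k + k × elt 0 i ≡ v
    contained {inj₁ _} (lift (j , refl)) = _ , +-mono-< (toℕ<n j) (toℕ<n j) , vtx-vertex j
    contained {inj₂ _} (lift (j , refl)) = _ , odd<even (toℕ<n j) , vtx-side j

  -- From weak n-gons to graphs

  module FromWeak {n} (weak : IsWeakPolygon n G) where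
    open IsWeakPolygon weak

    2≤n : 2 ≤ n
    2≤n = <⇒≤ 3≤n

    even-period : ∀ k c → kindAfter k c ≡ c → ∃[ m ] k ≡ m + m
    even-period k c eq with halve k
    ... | m , inj₁ k≡ = m , k≡
    ... | m , inj₂ refl = ⊥-elim (kindAfter-step (m + m) c (trans eq (sym (even m c))))
      where
      even : ∀ m c → kindAfter (m + m) c ≡ c
      even zero    c = refl
      even (suc m) c rewrite +-suc m m | not-involutive c = even m c

    ShortClosed : ℕ → Set _
    ShortClosed k = ∀ {x y p} → Walk x y k p x → suc k < n + n → ⊥

    -- A repeated vertex cuts out a shorter closed walk, left to induction; without repetition the
    -- walk is an ordinary polygon with fewer than `n` vertices.
    closed-at-point : ∀ {k} → (∀ {k′} → k′ < k → ShortClosed k′) →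
                      ∀ {x y p} → Walk x y k p x → kind x ≡ true → suc k < n + n → ⊥
    closed-at-point {k} ih {x} w x-point short
      with anyUpTo? (λ j → anyUpTo? (λ i → at w i ≟ⱽ at w j) j) (suc k)
    ... | yes (j , s≤s j≤k , i , i<j , eq) with d , refl ← m≤n⇒∃[o]m+o≡n i<j =
      ih (≤-trans (s≤s (m≤n+m d i)) j≤k)
         (subst (Walk _ _ d _) (trans (cong (at w ∘ suc) (+-comm d i)) (sym eq))
           (slice w i d (≤-trans (≤-reflexive (+-comm d i)) (<⇒≤ j≤k))))
         (≤-<-trans (s≤s (≤-trans (m≤n+m d i) (<⇒≤ j≤k))) short)
    ... | no none with even-period (suc k) (kind x) (sym (kind-walk w))
    -- The axiom on small polygons starts at two vertices; a closed walk of two edges is excluded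
    -- because it turns straight back.
    ...   | suc zero , refl = case w of λ { (cons _ z≢x (edge _)) → z≢x refl }
    ...   | suc (suc m) , 1+k≡ = no-small-gons (suc (suc m)) (s≤s (s≤s z≤n))
            (double-cancel-< (subst (_< n + n) 1+k≡ short))
            (FromClosed.polygon (suc (suc m)) (at w)
              (λ {i} l → at-step w (≤-pred (subst (i <_) (sym 1+k≡) l)))
              (trans (cong (at w) (sym 1+k≡)) (trans (at-end w) (sym (at-0 w))))
              (λ {i} {j} i<j j<L eq → none (j , subst (j <_) (sym 1+k≡) j<L , i , i<j , eq))
              (trans (cong kind (at-0 w)) x-point))

    -- A walk that starts at a line is rotated by one step, or shortened at both ends if it turns
    -- back at its start.
    short-closed : ∀ k → (∀ {k′} → k′ < k → ShortClosed k′) → ShortClosed k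
    short-closed k ih {x} w short with kind x in x-kind
    ... | true = closed-at-point ih w x-kind short
    short-closed k ih (edge xx) short | false = irreflexive xx refl
    short-closed (suc k) ih {x} {y} {p} (cons xy z≢x w) short | false with p ≟ⱽ y
    ... | no p≢y = closed-at-point ih (snoc w xy (≢-sym p≢y)) (trans (kind-~ xy) (cong not x-kind)) short
    short-closed (suc zero) ih (cons xy z≢x (edge _)) short | false | yes refl = z≢x refl
    short-closed (suc (suc k)) ih (cons xy z≢x w) short | false | yes refl =
      let _ , w′ , _ = unsnoc w in ih (s≤s (n≤1+n k)) w′ (<⇒≤ (<⇒≤ short))

    girth : ∀ {x y k p} → Walk x y k p x → n + n ≤ suc k
    girth w = ≮⇒≥ (<-rec ShortClosed short-closed _ w)

    cycle-through : ∀ u v → Σ[ C ∈ Cycle (n + n) ] let open Cycle C in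
                    (∃[ i ] i < n + n × vtx i ≡ u) × (∃[ j ] j < n + n × vtx j ≡ v)
    cycle-through u v = let O , u∈O , v∈O = common-n-gon u v in
      FromPolygon.cycle 2≤n O , FromPolygon.contained 2≤n O u∈O , FromPolygon.contained 2≤n O v∈O

    extend : ∀ q v → ∃[ c ] v ~ c × c ≢ q
    extend q v with cycle-through v v
    ... | C , (i , _ , refl) , _ = go
      where
      open Cycle C
      -- One step back on the cycle is `pred (n + n)` steps forward.
      j = pred (n + n) + i
      v≡ : vtx (suc j) ≡ vtx i
      v≡ = trans (cong (λ t → vtx (t + i)) (suc-pred (n + n) ⦃ >-nonZero (≤-trans (<⇒≤ 2≤n) (m≤m+n n n)) ⦄))
                 (period i)
      go : ∃[ c ] vtx i ~ c × c ≢ q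
      go with vtx j ≟ⱽ q
      ... | no j≢q  = vtx j , subst (_~ vtx j) v≡ (~-sym (step j)) , j≢q
      ... | yes j≡q = vtx (2 + j) , subst (_~ vtx (2 + j)) v≡ (step (suc j)) ,
                      λ eq → turn j (trans eq (sym j≡q))

    on-cycle : (C : Cycle (n + n)) → let open Cycle C in ∀ i j → i < j → j < n + n →
               (∃[ k ] k < n × ∃[ y ] Reach (vtx i) y k (vtx j)) ×
               (∃[ k ] k < n × ∃[ y ] Reach (vtx j) y k (vtx i))
    on-cycle C i j i<j j<2n with d , refl ← m≤n⇒∃[o]m+o≡n i<j
      with e , eq ← m≤n⇒∃[o]m+o≡n j<2n = go (d <? n)
      where
      open Cycle C
      -- The two arcs between the positions have `suc d` and `suc (e + i)` edges, together `n + n`,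
      -- so one of them has at most `n`.
      w : Walk (vtx i) (vtx (suc i)) d (vtx (d + i)) (vtx (suc i + d))
      w = subst (Walk _ _ d _) (cong (vtx ∘ suc) (+-comm d i)) (forth i d)
      e≡ : suc (e + i) + (suc i + d) ≡ n + n + i
      e≡ = begin
        suc (e + i) + (suc i + d) ≡⟨ cong suc (+-assoc e i (suc i + d)) ⟩
        suc (e + (i + (suc i + d))) ≡⟨ cong (λ t → suc (e + t)) (+-comm i (suc i + d)) ⟩
        suc (e + (suc i + d + i)) ≡⟨ cong suc (sym (+-assoc e (suc i + d) i)) ⟩
        suc (e + (suc i + d) + i) ≡⟨ cong (λ t → suc (t + i)) (+-comm e (suc i + d)) ⟩
        suc (suc i + d + e) + i ≡⟨ cong (_+ i) eq ⟩
        n + n + i ∎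
        where open ≡-Reasoning
      w′ : Walk (vtx (suc i + d)) (vtx (suc (suc i + d))) (e + i) (vtx (e + i + (suc i + d))) (vtx i)
      w′ = subst (Walk _ _ (e + i) _) (trans (cong vtx e≡) (period i)) (forth (suc i + d) (e + i))
      go : Dec (d < n) → _
      go (yes d<n) = (d , d<n , _ , _ , w) , (d , d<n , _ , _ , rev w)
      go (no  d≮n) = (e + i , e+i<n , _ , _ , rev w′) , (e + i , e+i<n , _ , _ , w′)
        where
        e+i<n : e + i < n
        e+i<n = +-cancelʳ-< d (e + i) n (begin-strict
          e + i + d         ≡⟨ +-assoc e i d ⟩
          e + (i + d)       ≡⟨ +-comm e (i + d) ⟩
          i + d + e         <⟨ s≤s (+-monoˡ-≤ e (n≤1+n (i + d))) ⟩
          suc (suc i + d + e) ≡⟨ eq ⟩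
          n + n             ≤⟨ +-monoʳ-≤ n (≮⇒≥ d≮n) ⟩
          n + d             ∎)
          where open ≤-Reasoning

    diam : ∀ x v → x ≡ v ⊎ (∃[ y ] ∃[ k ] k < n × Reach x y k v)
    diam x v with cycle-through x v
    ... | C , (i , i<L , refl) , (j , j<L , refl) with <-cmp i j
    ...   | tri≈ _ refl _ = inj₁ refl
    ...   | tri< i<j _ _ = let (k , k<n , y , r) , _ = on-cycle C i j i<j j<L in inj₂ (y , k , k<n , r)
    ...   | tri> _ _ j<i = let _ , (k , k<n , y , r) = on-cycle C j i j<i i<L in inj₂ (y , k , k<n , r)

    polygonal : IsPolygonal n graph
    polygonal = record { 3≤n = 3≤n ; girth = girth ; diam = diam ; extend = extend }

    some-cycle : Cycle (n + n)
    some-cycle = proj₁ (cycle-through nonempty nonempty)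

  -- From graphs back to weak n-gons

  module ToWeak {n} (polygonal : IsPolygonal n graph) where
    open IsPolygonal polygonal

    polygon-on : ∀ {x y K c} (w : Walk x y K c x) → suc K ≡ n + n → kind x ≡ true →
                 Σ[ O ∈ OrdinaryPolygon G n ] (∀ {v} i → i ≤ K → at w i ≡ v → OrdinaryPolygon.Contains O v)
    polygon-on {x} {y} {K} {c} w 1+K≡ x-point = polygon , λ i i≤K → contains i (subst (i <_) 1+K≡ (s≤s i≤K))
      where
      open FromClosed n (at w)
        (λ {i} l → at-step w (≤-pred (subst (i <_) (sym 1+K≡) l)))
        (trans (cong (at w) (sym 1+K≡)) (trans (at-end w) (sym (at-0 w))))
        (λ {i} {j} i<j j<L → vertices-distinct w 1+K≡ i<j (≤-pred (subst (j <_) (sym 1+K≡) j<L)))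
        (trans (cong kind (at-0 w)) x-point)

    n≤K : ∀ {K} → suc K ≡ n + n → n ≤ K
    n≤K eq = ≤-pred (≤-trans (+-monoˡ-≤ n 1≤n) (≤-reflexive (sym eq)))

    -- Polygons are read off from a point, so the circuit starts at the neighbour `b` of the line
    -- `x` and closes through `x`.
    common-from-line : ∀ {x b c k p y} → kind x ≡ false → x ~ b → c ≢ x → k < n → Walk b c k p y →
                       Σ[ O ∈ OrdinaryPolygon G n ]
                         let open OrdinaryPolygon O in Contains x × Contains b × Contains y
    common-from-line x-line xb c≢x k<n w =
      let K , 1+K≡ , w′ , same = circuit w k<n (~-sym xb) (≢-sym c≢x)
          O , on = polygon-on w′ 1+K≡ (trans (kind-~ xb) (cong not x-line))
      in O , on K ≤-refl (at-k w′) , on 0 z≤n (at-0 w′) ,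
         on _ (≤-trans k<n (n≤K 1+K≡)) (trans (same ≤-refl) (at-end w))

    common-from-point : ∀ {x b k p y} → kind x ≡ true → k < n → Walk x b k p y →
                        Σ[ O ∈ OrdinaryPolygon G n ]
                          let open OrdinaryPolygon O in Contains x × Contains y
    common-from-point {x} {b} x-point k<n w =
      let c , xc , c≢b = extend b x
          K , 1+K≡ , w′ , same = circuit w k<n xc c≢b
          O , on = polygon-on w′ 1+K≡ x-point
      in O , on 0 z≤n (at-0 w′) , on _ (≤-trans k<n (n≤K 1+K≡)) (trans (same ≤-refl) (at-end w))

    common-n-gon : ∀ x y → Σ[ O ∈ OrdinaryPolygon G n ]
                     let open OrdinaryPolygon O in Contains x × Contains y
    common-n-gon x y with kind x in x-kind | diam x y
    ... | true | inj₁ refl =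
      let b , xb , _ = extend x x
          O , x∈ , _ = common-from-point x-kind 1≤n (edge xb)
      in O , x∈ , x∈
    ... | true | inj₂ (_ , _ , k<n , _ , w) = common-from-point x-kind k<n w
    ... | false | inj₁ refl =
      let b , xb , _   = extend x x
          c , bc , c≢x = extend x b
          O , x∈ , _   = common-from-line x-kind xb c≢x 1≤n (edge bc)
      in O , x∈ , x∈
    ... | false | inj₂ (b , zero , _ , _ , edge xb) =
      let c , bc , c≢x    = extend x b
          O , x∈ , b∈ , _ = common-from-line x-kind xb c≢x 1≤n (edge bc)
      in O , x∈ , b∈
    ... | false | inj₂ (b , suc k , k<n , _ , cons xb z≢x w) =
      let O , x∈ , _ , y∈ = common-from-line x-kind xb z≢x (<⇒≤ k<n) w in O , x∈ , y∈

    no-small-gons : ∀ k → 2 ≤ k → k < n → ¬ OrdinaryPolygon G k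
    no-small-gons k 2≤k k<n O = no-closed
      (subst (Walk _ _ (pred (k + k)) _)
        (trans (cong (λ t → vtx (t + 0)) 1+≡) (period 0)) (forth 0 (pred (k + k))))
      (subst (_< n + n) (sym 1+≡) (+-mono-< k<n k<n))
      where
      open Cycle (FromPolygon.cycle 2≤k O)
      1+≡ : suc (pred (k + k)) ≡ k + k
      1+≡ = suc-pred (k + k) ⦃ >-nonZero (≤-trans (<⇒≤ 2≤k) (m≤m+n k k)) ⦄

    weak : Element → IsWeakPolygon n G
    weak e = record
      { 3≤n = 3≤n ; nonempty = e ; common-n-gon = common-n-gon ; no-small-gons = no-small-gons }

-- Convex subgeometries

avoid : ∀ {a} {A : Set a} → DecidableEquality A → (f : Fin 3 → A) → Injective _≡_ _≡_ f →
        ∀ u v → ∃[ j ] f j ≢ u × f j ≢ v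
avoid _≟_ f inj u v with f 0F ≟ u | f 0F ≟ v | f 1F ≟ u | f 1F ≟ v
... | no ≢u    | no ≢v    | _        | _        = 0F , ≢u , ≢v
... | _        | _        | no ≢u    | no ≢v    = 1F , ≢u , ≢v
... | yes refl | _        | yes e    | _        = case inj e of λ ()
... | _        | yes refl | _        | yes e    = case inj e of λ ()
... | yes refl | _        | _        | yes refl = 2F , (λ e → case inj e of λ ()) , (λ e → case inj e of λ ())
... | _        | yes refl | yes refl | _        = 2F , (λ e → case inj e of λ ()) , (λ e → case inj e of λ ())

module Subgeometry {p l i c} (G : Geometry p l i)
                   (_≟P_ : DecidableEquality (Geometry.Point G))
                   (_≟L_ : DecidableEquality (Geometry.Line G))
                   (P : Pred (Geometry.Point G) c) (Q : Pred (Geometry.Line G) c)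
                   (P? : Decidable P) (Q? : Decidable Q) where
  open Geometry G
  open Incidence G _≟P_ _≟L_ using (graph)
  open Graph graph hiding (V)

  sub : Geometry (p ⊔ c) (l ⊔ c) i
  sub = induced G P Q

  module Sub = Incidence sub (Refinement._≟_ _≟P_) (Refinement._≟_ _≟L_)
  module S = Graph Sub.graph

  Member : Pred Element c
  Member (inj₁ x) = P x
  Member (inj₂ M) = Q M

  ι : S.V → Element
  ι (inj₁ x) = inj₁ (value x)
  ι (inj₂ M) = inj₂ (value M)

  ι-injective : Injective _≡_ _≡_ ι
  ι-injective {inj₁ _} {inj₁ _} eq = cong inj₁ (value-injective (inj₁-injective eq))
  ι-injective {inj₂ _} {inj₂ _} eq = cong inj₂ (value-injective (inj₂-injective eq))

  ι-member : ∀ u → Member (ι u)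
  ι-member (inj₁ (x ,ʳ [ px ])) = recompute (P? x) px
  ι-member (inj₂ (M ,ʳ [ qM ])) = recompute (Q? M) qM

  ι⁻¹ : ∀ v → Member v → ∃[ u ] ι u ≡ v
  ι⁻¹ (inj₁ x) px = inj₁ (x ,ʳ [ px ]) , refl
  ι⁻¹ (inj₂ M) qM = inj₂ (M ,ʳ [ qM ]) , refl

  ι-~ : ∀ {u v} → u S.~ v → ι u ~ ι v
  ι-~ (pl xM) = pl xM
  ι-~ (lp xM) = lp xM

  ι-~⁻ : ∀ {u v} → ι u ~ ι v → u S.~ v
  ι-~⁻ {inj₁ _} {inj₂ _} (pl xM) = pl xM
  ι-~⁻ {inj₂ _} {inj₁ _} (lp xM) = lp xM

  ι-walk : ∀ {x y k q v} → S.Walk x y k q v → Walk (ι x) (ι y) k (ι q) (ι v)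
  ι-walk (S.edge xy)       = edge (ι-~ xy)
  ι-walk (S.cons xy z≢x w) = cons (ι-~ xy) (z≢x ∘ ι-injective) (ι-walk w)

  module _ {n} (polygonal : IsPolygonal n graph) where
    open IsPolygonal polygonal

    -- Convexity: applied repeatedly, it puts the whole shortest walk between two members that are
    -- not opposite into the subset.
    Closed : Set _
    Closed = ∀ {x b k q y} → Walk x b k q y → suc k < n → Member x → Member y → Member b

    -- The sub n-gon has its own walk between the two members, and by uniqueness it begins like the
    -- given one.
    closed-of-sub : IsPolygonal n Sub.graph → Closed
    closed-of-sub sub-polygonal {x} {y = y} w k+1<n x∈ y∈ with ι⁻¹ x x∈ | ι⁻¹ y y∈
    ... | x′ , refl | y′ , refl with IsPolygonal.diam sub-polygonal x′ y′
    ...   | inj₁ refl = ⊥-elim (no-closed w (≤-trans k+1<n (m≤m+n n n)))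
    ...   | inj₂ (b′ , k′ , k′<n , _ , w′) =
      subst Member (unique-first (ι-walk w′) w (+-mono-≤-< k′<n k+1<n)) (ι-member b′)

    module _ (closed : Closed) where
      ι⁻¹-walk : ∀ {x b k q y} → Walk (ι x) b k q (ι y) → suc k < n →
                 ∃[ b′ ] ∃[ q′ ] S.Walk x b′ k q′ y × ι b′ ≡ b × ι q′ ≡ q
      ι⁻¹-walk {x} {y = y} (edge xy) _ = y , x , S.edge (ι-~⁻ xy) , refl , refl
      ι⁻¹-walk {x} {b} {y = y} w@(cons xb z≢x w′) short with ι⁻¹ b (closed w short (ι-member x) (ι-member y))
      ... | b′ , refl with ι⁻¹-walk w′ (<⇒≤ short)
      ...   | z′ , q′ , w″ , refl , refl =
        b′ , q′ , S.cons (ι-~⁻ xb) (z≢x ∘ cong ι) w″ , refl , refl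

      module _ (C : Cycle (n + n))
               (thick : ∀ j → AtLeast 3 (λ v → Cycle.vtx C j ~ v × Member v)) where
        open Cycle C

        -- Of the two neighbours on the cycle, one always continues the walk without turning back,
        -- so its end can be moved away from `x` until it is opposite; `f` in `go` is the number of
        -- steps still missing.
        opposite-on-cycle : ∀ x → ∃[ j ] ∃[ b ] ∃[ k ] ∃[ q ] suc k ≡ n × Walk x b k q (vtx j)
        opposite-on-cycle x = start (diam x (vtx 0))
          where
          Result = ∃[ j ] ∃[ b ] ∃[ k ] ∃[ q ] suc k ≡ n × Walk x b k q (vtx j)
          before : ℕ → ℕ
          before j = pred (n + n) + j
          after-before : ∀ j → vtx (suc (before j)) ≡ vtx j
          after-before j = trans
            (cong (λ t → vtx (t + j)) (suc-pred (n + n) ⦃ >-nonZero (≤-trans 1≤n (m≤m+n n n)) ⦄)) (period j)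
          go : ∀ f j {b k q} → f + suc k ≡ n → Walk x b k q (vtx j) → Result
          go zero    j eq w = _ , _ , _ , _ , eq , w
          go (suc f) j {b} {k} {q} eq w with vtx (before j) ≟ⱽ q
          ... | no  j′≢q = go f (before j) (trans (+-suc f (suc k)) eq)
            (snoc (subst (Walk x b k q) (sym (after-before j)) w) (~-sym (step (before j))) j′≢q)
          ... | yes j′≡q = go f (2 + before j) (trans (+-suc f (suc k)) eq)
            (snoc (subst (Walk x b k q) (sym (after-before j)) w) (step (suc (before j)))
              (λ e → turn (before j) (trans e (sym j′≡q))))
          start : _ → Result
          start (inj₁ refl) = _ , _ , _ , _ , suc-pred n ⦃ >-nonZero 1≤n ⦄ , forth 0 (pred n)
          start (inj₂ (b , k , k<n , q , w)) with d , eq ← m≤n⇒∃[o]m+o≡n k<n =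
            go d 0 (trans (+-comm d (suc k)) eq) w

        -- The three members next to an opposite vertex of the cycle project to three neighbours of
        -- `u`, and convexity puts these into the subset.
        sub-thick : ∀ u → AtLeast 3 (u S.~_)
        sub-thick u with opposite-on-cycle (ι u)
        ... | j , b , k , q , 1+k≡n , w with thick j
        ...   | f , f-inj , f∈ = g , g-inj , λ t → ι-~⁻ (subst (ι u ~_) (sym (g≡ t)) (first~ (proj₂ (nbr t))))
          where
          nbr : ∀ t → ∃[ c ] Walk (ι u) c k (f t) (vtx j)
          nbr t = opposite-nbr 1+k≡n w (proj₁ (f∈ t))
          member : ∀ {c r s k′} → suc k′ ≡ n → Walk (ι u) c k′ r s → Member r → Member c
          member {k′ = zero}   1≡n  w _  = ⊥-elim (<⇒≱ (s≤s (s≤s z≤n)) (≤-trans 3≤n (≤-reflexive (sym 1≡n))))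
          member {k′ = suc k′} refl w r∈ =
            let _ , w′ , _ = unsnoc w in closed w′ ≤-refl (ι-member u) r∈
          nbr∈ : ∀ t → Member (proj₁ (nbr t))
          nbr∈ t = member 1+k≡n (proj₂ (nbr t)) (proj₂ (f∈ t))
          g : Fin 3 → S.V
          g t = proj₁ (ι⁻¹ (proj₁ (nbr t)) (nbr∈ t))
          g≡ : ∀ t → ι (g t) ≡ proj₁ (nbr t)
          g≡ t = proj₂ (ι⁻¹ (proj₁ (nbr t)) (nbr∈ t))
          g-inj : Injective _≡_ _≡_ g
          g-inj {s} {t} eq = f-inj (proj₂ (unique-after
            (subst (λ c → Walk (ι u) c k (f s) (vtx j)) (trans (sym (g≡ s)) (trans (cong ι eq) (g≡ t))) (proj₂ (nbr s)))
            (proj₂ (nbr t)) (+-mono-< (≤-reflexive 1+k≡n) (≤-reflexive 1+k≡n))))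

        sub-extend : ∀ q v → ∃[ c ] v S.~ c × c ≢ q
        sub-extend q v with sub-thick v
        ... | f , f-inj , f~ with avoid S._≟ⱽ_ f f-inj q q
        ...   | j , ≢q , _ = f j , f~ j , ≢q

        sub-diam : ∀ x v → x ≡ v ⊎ (∃[ y ] ∃[ k ] k < n × S.Reach x y k v)
        sub-diam x v with diam (ι x) (ι v)
        ... | inj₁ eq = inj₁ (ι-injective eq)
        ... | inj₂ (b , k , k<n , _ , w) with m≤n⇒m<n∨m≡n k<n
        ...   | inj₁ short with ι⁻¹-walk w short
        ...     | b′ , q′ , w′ , _ = inj₂ (b′ , k , k<n , q′ , w′)
        sub-diam x v | inj₂ (b , zero , k<n , _ , w) | inj₂ 1≡n =
          ⊥-elim (<⇒≱ (s≤s (s≤s z≤n)) (≤-trans 3≤n (≤-reflexive (sym 1≡n))))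
        -- Convexity does not apply to opposite vertices. The walk is led through a neighbour `c` of
        -- `v` in the subset, which is at distance `n - 1` from `x`.
        sub-diam x v | inj₂ (b , suc k , k<n , _ , w) | inj₂ refl with sub-extend v v
        ... | c , vc , _ with opposite-nbr refl w (ι-~ vc)
        ...   | b′ , w′ with unsnoc w′
        ...     | _ , w″ , v≢q with ι⁻¹-walk w″ ≤-refl
        ...       | b″ , q″ , w‴ , _ , refl =
          inj₂ (b″ , suc k , k<n , c , S.snoc w‴ (S.~-sym vc) (v≢q ∘ cong ι))

        sub-polygonal : IsPolygonal n Sub.graph
        sub-polygonal = record
          { 3≤n    = 3≤n
          ; girth  = λ w → girth (ι-walk w)
          ; diam   = sub-diam
          ; extend = sub-extend
          }

-- Hulls of point sets

lower-em : ∀ {ℓ} → ExcludedMiddle (lsuc ℓ) → ExcludedMiddle ℓ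
lower-em em {A} = map′ lower lift (em {Lift _ A})

module Hull {ℓ} (em : ExcludedMiddle (lsuc ℓ)) (Γ : Geometry ℓ ℓ ℓ)
            (_≟P_ : DecidableEquality (Geometry.Point Γ))
            (_≟L_ : DecidableEquality (Geometry.Line Γ))
            {n : ℕ} (polygonal : IsPolygonal n (Incidence.graph Γ _≟P_ _≟L_))
            (S : Pred (Geometry.Point Γ) ℓ) where
  open Geometry Γ
  open Incidence Γ _≟P_ _≟L_ using (graph)
  open Graph graph hiding (V)
  open IsPolygonal polygonal
  open Subgeometry Γ _≟P_ _≟L_ (⟨_⟩ₚ Γ n S) (⟨_⟩ₗ Γ n S) (λ _ → em) (λ _ → em) public hiding (module S)

  module Other (P : Pred Point ℓ) (Q : Pred Line ℓ) where
    open Subgeometry Γ _≟P_ _≟L_ P Q (λ _ → lower-em em) (λ _ → lower-em em) public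

  InAll : Element → Set (lsuc ℓ)
  InAll v = ∀ P Q → IsSubPolygon Γ n P Q → S ⊆ P → Other.Member P Q v

  member⇒inAll : ∀ v → Member v → InAll v
  member⇒inAll (inj₁ x) x∈ = x∈
  member⇒inAll (inj₂ M) M∈ = M∈

  inAll⇒member : ∀ v → InAll v → Member v
  inAll⇒member (inj₁ x) x∈ = x∈
  inAll⇒member (inj₂ M) M∈ = M∈

  -- Every sub n-gon containing `S` is convex, and convexity passes to intersections.
  hull-closed : Closed polygonal
  hull-closed {x} {b} {y = y} w short x∈ y∈ = inAll⇒member b λ P Q sub-weak S⊆P →
    Other.closed-of-sub P Q polygonal (Incidence.FromWeak.polygonal _ _ _ sub-weak) w short
      (member⇒inAll x x∈ P Q sub-weak S⊆P) (member⇒inAll y y∈ P Q sub-weak S⊆P)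

  generators-in : ∀ {x} → S x → Member (inj₁ x)
  generators-in x∈S P Q _ S⊆P = S⊆P x∈S

  -- Only points generate; a line is forced into the hull by two of its points, whose distance 2 is
  -- less than `n`.
  joins-in : ∀ {x y M} → S x → S y → x ≢ y → x I M → y I M → Member (inj₂ M)
  joins-in x∈S y∈S x≢y xM yM =
    hull-closed (cons (pl xM) (λ { refl → x≢y refl }) (edge (lp yM))) 3≤n
      (generators-in x∈S) (generators-in y∈S)

-- Homomorphisms and distances

record Hom {a b c d} (G : Graph a b) (H : Graph c d) : Set (a ⊔ b ⊔ c ⊔ d) where
  private
    module G = Graph G
    module H = Graph H
  field
    map   : G.V → H.V
    map-~ : ∀ {u v} → u G.~ v → map u H.~ map v
    map-kind : ∀ v → H.kind (map v) ≡ G.kind v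

module HomFacts {a b c d} {G : Graph a b} {H : Graph c d} {n}
                (polyG : IsPolygonal n G) (polyH : IsPolygonal n H) (h : Hom G H) where
  private
    module G where
      open Graph G public
      open IsPolygonal polyG public
    module H where
      open Graph H public
      open IsPolygonal polyH public
  open Hom h

  -- Homomorphisms do not increase distances, and the bound `suc k ≤ n` makes the walk in `H` a
  -- shortest one.
  far : ∀ {v u j ζ y f k f′} → G.Walk v u j ζ y → H.Walk (map v) f k f′ (map y) → suc k ≤ n → k ≤ j
  far (G.edge vy) w k<n = ≤-reflexive (sym (proj₁ (proj₂
    (H.unique (H.edge (map-~ vy)) w (≤-trans (s≤s (s≤s k<n)) (+-monoˡ-≤ n (≤-trans (s≤s (s≤s z≤n)) H.3≤n)))))))
  far (G.cons vu _ w′) w k<n with H.nbr-distance w k<n (map-~ vu)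
  ... | inj₁ (_ , refl) = z≤n
  ... | inj₂ (_ , _ , _ , w″ , l<n , k≤1+l) = ≤-trans k≤1+l (s≤s (far w′ w″ l<n))

  kind-map-walk : ∀ {v u j ζ y} → G.Walk v u j ζ y →
                  H.kind (map y) ≡ kindAfter (suc j) (H.kind (map v))
  kind-map-walk {v} {j = j} {y = y} w =
    trans (map-kind y) (trans (G.kind-walk w) (cong (kindAfter (suc j)) (sym (map-kind v))))

  -- Otherwise `map u` would be farther from `map y` than `u` is from `y`.
  first-image : ∀ {v y u k ζ f f′} → G.Walk v u k ζ y → H.Walk (map v) f k f′ (map y) → suc k < n →
                map u ≡ f
  first-image {u = u} {f = f} w w′ short with map u H.≟ⱽ f
  ... | yes eq = eq
  ... | no ≢f with H.cons (H.~-sym (map-~ (G.first~ w))) (≢-sym ≢f) w′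
  first-image (G.edge _)     w′ short | no _ | w″ = ⊥-elim (H.irreflexive-walk short w″)
  first-image (G.cons _ _ w) w′ short | no _ | w″ = ⊥-elim (<⇒≱ (n≤1+n _) (far w w″ short))

  last-image : ∀ {v y u k ζ f f′} → G.Walk v u k ζ y → H.Walk (map v) f k f′ (map y) → suc k < n →
               map ζ ≡ f′
  last-image w w′ = first-image (G.rev w) (H.rev w′)

  -- The distance of `v` and `y` is at least `n - 1` by `far`, and parity excludes `n`. So
  -- prescribed first and last steps in `H` can be followed in `G`.
  lift-walk : ∀ {v y f k f′} → H.Walk (map v) f k f′ (map y) → suc (suc k) ≡ n →
              ∃[ u ] ∃[ ζ ] G.Walk v u k ζ y × map u ≡ f × map ζ ≡ f′
  lift-walk {v} {y} {f} {k} {f′} w refl with G.diam v y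
  ... | inj₁ refl = ⊥-elim (H.irreflexive-walk (n≤1+n _) w)
  ... | inj₂ (u , k′ , k′<n , ζ , w′) with m≤n⇒m<n∨m≡n (far w′ w (n≤1+n _))
  ...   | inj₂ refl = u , ζ , w′ , first-image w′ w ≤-refl , last-image w′ w ≤-refl
  ...   | inj₁ k<k′ with ≤-antisym (≤-pred k′<n) k<k′
  ...     | refl = ⊥-elim (kindAfter-step (suc k) _ (trans (sym (kind-map-walk w′)) (H.kind-walk w)))

-- The retraction onto an apartment

module Apartment {c d} {H : Graph c d} {n} (polygonal : IsPolygonal n H) (C : Graph.Cycle H (n + n)) where
  open Graph H
  open IsPolygonal polygonal
  open Cycle C public

  instance
    2n≢0 : NonZero (n + n)
    2n≢0 = >-nonZero (≤-trans 1≤n (m≤m+n n n))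

  representative : ∀ i → ∃[ r ] r < n + n × (∀ k → vtx (k + i) ≡ vtx (k + r))
  representative i = i % (n + n) , m%n<n i (n + n) ,
    λ k → trans (cong (λ t → vtx (k + t)) (m≡m%n+[m/n]*n i (n + n))) (turns k (i / (n + n)))
    where
    r = i % (n + n)
    turns : ∀ k q → vtx (k + (r + q * (n + n))) ≡ vtx (k + r)
    turns k zero    = cong (λ t → vtx (k + t)) (+-identityʳ r)
    turns k (suc q) = begin
      vtx (k + (r + (n + n + q * (n + n)))) ≡⟨ cong (λ t → vtx (k + t)) (+-comm r _) ⟩
      vtx (k + (n + n + q * (n + n) + r))   ≡⟨ cong vtx (+-comm k _) ⟩
      vtx (n + n + q * (n + n) + r + k)     ≡⟨ cong (λ t → vtx (t + k)) (+-assoc (n + n) _ r) ⟩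
      vtx (n + n + (q * (n + n) + r) + k)   ≡⟨ cong vtx (+-assoc (n + n) _ k) ⟩
      vtx (n + n + (q * (n + n) + r + k))   ≡⟨ period _ ⟩
      vtx (q * (n + n) + r + k)             ≡⟨ cong vtx (+-comm (q * (n + n) + r) k) ⟩
      vtx (k + (q * (n + n) + r))           ≡⟨ cong (λ t → vtx (k + t)) (+-comm (q * (n + n)) r) ⟩
      vtx (k + (r + q * (n + n)))           ≡⟨ turns k q ⟩
      vtx (k + r)                           ∎
      where open ≡-Reasoning

  vtx-injective : ∀ {i j} → i < n + n → j < n + n → vtx i ≡ vtx j → i ≡ j
  vtx-injective {i} {j} i< j< eq with <-cmp i j
  ... | tri≈ _ i≡j _ = i≡j
  ... | tri< l _ _ with e , refl ← m≤n⇒∃[o]m+o≡n l = ⊥-elim (cycle-distinct C i e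
          (≤-<-trans (s≤s (m≤n+m e i)) j<) (trans (cong (vtx ∘ suc) (+-comm e i)) (sym eq)))
  ... | tri> _ _ l with e , refl ← m≤n⇒∃[o]m+o≡n l = ⊥-elim (cycle-distinct C j e
          (≤-<-trans (s≤s (m≤n+m e j)) i<) (trans (cong (vtx ∘ suc) (+-comm e j)) eq))

  vtx-shift : ∀ {i j} → vtx i ≡ vtx j → ∀ k → vtx (k + i) ≡ vtx (k + j)
  vtx-shift {i} {j} eq k with representative i | representative j
  ... | r , r< , i≡r | s , s< , j≡s with vtx-injective r< s< (trans (sym (i≡r 0)) (trans eq (j≡s 0)))
  ...   | refl = trans (i≡r k) (sym (j≡s k))

  vtx-unshift : ∀ {i j} → vtx (suc i) ≡ vtx (suc j) → vtx i ≡ vtx j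
  vtx-unshift {i} {j} eq = trans (sym (around i)) (trans (vtx-shift eq (pred (n + n))) (around j))
    where
    around : ∀ i → vtx (pred (n + n) + suc i) ≡ vtx i
    around i = trans (cong vtx (trans (+-suc (pred (n + n)) i) (cong (_+ i) (suc-pred (n + n))))) (period i)

  back : ∀ {j d} → d + j ≡ n + n → Walk (vtx 1) (vtx 0) d (vtx (suc j)) (vtx j)
  back {j} {d} eq = subst₂ (λ s t → Walk s t d (vtx (suc j)) (vtx j))
    (trans (cong (vtx ∘ suc) (trans eq (sym (+-identityʳ _)))) (trans (sym (cong vtx (+-suc (n + n) 0))) (period 1)))
    (trans (cong vtx (trans eq (sym (+-identityʳ _)))) (period 0))
    (rev (forth j d))

  -- The retraction onto the cycle centred at the edge vtx 0 ~ vtx 1.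
  data Label (v : V) : ℕ → Set (c ⊔ d) where
    ahead  : ∀ {m} → m < n → Reach (vtx 0) (vtx 1) m v → Label v (suc m)
    behind : ∀ {m j} → m < n → m + j ≡ n + n → Reach (vtx 1) (vtx 0) m v → Label v j

  label∃ : ∀ v → ∃[ j ] Label v j
  label∃ v with divide (step 0) v
  ... | m , m<n , inj₁ r = suc m , ahead m<n r
  ... | m , m<n , inj₂ r = n + n ∸ m , behind m<n (m+[n∸m]≡n (≤-trans (<⇒≤ m<n) (m≤m+n n n))) r

  label-unique : ∀ {v i j} → Label v i → Label v j → i ≡ j
  label-unique (ahead l r)     (ahead l′ r′)      = cong suc (same-end r r′ l l′)
  label-unique (ahead l r)     (behind l′ _ r′)   = ⊥-elim (opposite-ends r r′ l l′)
  label-unique (behind l _ r)  (ahead l′ r′)      = ⊥-elim (opposite-ends r′ r l′ l)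
  label-unique (behind {m} l e r) (behind l′ e′ r′) with refl ← same-end r r′ l l′ =
    +-cancelˡ-≡ m _ _ (trans e (sym e′))

  label-vtx : ∀ i → i < n + n → ∃[ j ] Label (vtx i) j × vtx j ≡ vtx i
  -- `vtx 0` lies behind the base edge and gets the label `n + n`; labels run from 1 to `n + n`.
  label-vtx zero _ = n + n , behind 1≤n refl (_ , edge (~-sym (step 0))) ,
                     trans (cong vtx (sym (+-identityʳ (n + n)))) (period 0)
  label-vtx (suc m) i<2n with m <? n
  ... | yes m<n = suc m ,
    ahead m<n (_ , subst (λ t → Walk _ _ m (vtx t) (vtx (suc t))) (+-identityʳ m) (forth 0 m)) , refl
  ... | no  m≮n with e , eq ← m≤n⇒∃[o]m+o≡n (<⇒≤ i<2n) =
    suc m , behind e<n eq′ (_ , back eq′) , refl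
    where
    eq′ : e + suc m ≡ n + n
    eq′ = trans (+-comm e (suc m)) eq
    e<n : e < n
    e<n = +-cancelʳ-< n e n (≤-trans (≤-reflexive (sym (+-suc e n)))
      (≤-trans (+-monoʳ-≤ e (s≤s (≮⇒≥ m≮n))) (≤-reflexive eq′)))

  fold : V → V
  fold v = vtx (proj₁ (label∃ v))

  fold-fixes : ∀ i → fold (vtx i) ≡ vtx i
  fold-fixes i with representative i
  ... | r , r<2n , same with label-vtx r r<2n
  ...   | j , lab , eq = trans (cong fold (same 0)) (trans
    (cong vtx (label-unique (proj₂ (label∃ (vtx r))) lab)) (trans eq (sym (same 0))))

  fold-kind : ∀ v → kind (fold v) ≡ kind v
  fold-kind v = go (proj₂ (label∃ v))
    where
    go : ∀ {j} → Label v j → kind (vtx j) ≡ kind v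
    go (ahead {m} _ (_ , w)) = trans (cong (kind ∘ vtx ∘ suc) (sym (+-identityʳ m)))
      (trans (kind-walk (forth 0 m)) (sym (kind-walk w)))
    go (behind {m} _ eq (_ , w)) = trans (kind-walk (back eq)) (sym (kind-walk w))

  vtx-next : ∀ {i} → i ≡ n + n → vtx 1 ≡ vtx (suc i)
  vtx-next refl = sym (trans (cong vtx (sym (+-comm (n + n) 1))) (period 1))

  -- Neighbours on the same side have consecutive labels. Between the sides, `n + n` meets 1 at the
  -- base edge and `n` meets `n + 1` at the far end, and these are consecutive on the cycle as well.
  label-nbr : ∀ {u v i j} → u ~ v → Label u i → Label v j → vtx j ≡ vtx (suc i) ⊎ vtx i ≡ vtx (suc j)
  label-nbr uv (ahead l r) (ahead l′ r′) with nbr-same-side l l′ r r′ uv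
  ... | inj₁ refl = inj₁ refl
  ... | inj₂ refl = inj₂ refl
  label-nbr uv (behind {m} l e r) (behind {j = j} l′ e′ r′) with nbr-same-side l l′ r r′ uv
  ... | inj₁ refl = inj₂ (cong vtx (+-cancelˡ-≡ m _ _ (trans e (trans (sym e′) (sym (+-suc m j))))))
  ... | inj₂ refl = inj₁ (cong vtx (+-cancelˡ-≡ _ _ _ (trans e′ (trans (sym e) (sym (+-suc _ _))))))
  label-nbr uv (ahead l r) (behind l′ e′ r′) with nbr-other-side l l′ r r′ uv
  ... | inj₁ (refl , refl) = inj₂ (vtx-next e′)
  ... | inj₂ (refl , sn) = inj₁ (cong vtx (wrap sn e′))
    where
    wrap : ∀ {m m′ j} → suc m′ ≡ suc m → m′ + j ≡ suc m + suc m → j ≡ suc (suc m)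
    wrap {m} refl e = +-cancelˡ-≡ m _ _ (trans e (sym (+-suc m (suc m))))
  label-nbr uv (behind l e r) (ahead l′ r′) with nbr-other-side l′ l r′ r (~-sym uv)
  ... | inj₁ (refl , refl) = inj₁ (vtx-next e)
  ... | inj₂ (refl , sn) = inj₂ (cong vtx (wrap sn e))
    where
    wrap : ∀ {m m′ j} → suc m′ ≡ suc m → m′ + j ≡ suc m + suc m → j ≡ suc (suc m)
    wrap {m} refl e = +-cancelˡ-≡ m _ _ (trans e (sym (+-suc m (suc m))))

  fold-nbr : ∀ {u v i} → u ~ v → fold u ≡ vtx (suc i) → fold v ≡ vtx i ⊎ fold v ≡ vtx (suc (suc i))
  fold-nbr {u} {v} uv eq with label-nbr uv (proj₂ (label∃ u)) (proj₂ (label∃ v))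
  ... | inj₁ next = inj₂ (trans next (vtx-shift eq 1))
  ... | inj₂ prev = inj₁ (vtx-unshift (trans (sym prev) eq))

  fold-~ : ∀ {u v} → u ~ v → fold u ~ fold v
  fold-~ {u} {v} uv with label-nbr uv (proj₂ (label∃ u)) (proj₂ (label∃ v))
  ... | inj₁ next = subst (fold u ~_) (sym next) (step _)
  ... | inj₂ prev = subst (_~ fold v) (sym prev) (~-sym (step _))

-- Counting in a finite type

+-swap-middle : ∀ a b c d → (a + b) + (c + d) ≡ (a + c) + (b + d)
+-swap-middle a b c d = begin
  (a + b) + (c + d) ≡⟨ +-assoc a b (c + d) ⟩
  a + (b + (c + d)) ≡⟨ cong (a +_) (+-assoc b c d) ⟨
  a + ((b + c) + d) ≡⟨ cong (λ t → a + (t + d)) (+-comm b c) ⟩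
  a + ((c + b) + d) ≡⟨ cong (a +_) (+-assoc c b d) ⟩
  a + (c + (b + d)) ≡⟨ +-assoc a c (b + d) ⟨
  (a + c) + (b + d) ∎
  where open ≡-Reasoning

module Count {a} (em : ExcludedMiddle a) {V : Set a} (vs : List V)
             (vs-unique : Unique vs) (vs-complete : ∀ v → v ∈ vs) where

  indicator : ∀ {P : Set a} → Dec P → ℕ
  indicator (yes _) = 1
  indicator (no _)  = 0

  ⟦_⟧ : Set a → ℕ
  ⟦ P ⟧ = indicator (em {P})

  ⟦⟧-yes : ∀ {P} → P → ⟦ P ⟧ ≡ 1
  ⟦⟧-yes {P} p with em {P}
  ... | yes _ = refl
  ... | no ¬p = ⊥-elim (¬p p)

  ⟦⟧-no : ∀ {P} → ¬ P → ⟦ P ⟧ ≡ 0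
  ⟦⟧-no {P} ¬p with em {P}
  ... | yes p = ⊥-elim (¬p p)
  ... | no _  = refl

  ⟦⟧-cong : ∀ {P Q} → (P → Q) → (Q → P) → ⟦ P ⟧ ≡ ⟦ Q ⟧
  ⟦⟧-cong {P} {Q} f g with em {P}
  ... | yes p = sym (⟦⟧-yes (f p))
  ... | no ¬p = sym (⟦⟧-no (¬p ∘ g))

  ⟦⟧-⊎ : ∀ {P Q} → (P → Q → ⊥) → ⟦ P ⊎ Q ⟧ ≡ ⟦ P ⟧ + ⟦ Q ⟧
  ⟦⟧-⊎ {P} {Q} disj with em {P} | em {Q}
  ... | yes p | yes q = ⊥-elim (disj p q)
  ... | yes p | no _  = ⟦⟧-yes (inj₁ p)
  ... | no _  | yes q = ⟦⟧-yes (inj₂ q)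
  ... | no ¬p | no ¬q = ⟦⟧-no λ { (inj₁ p) → ¬p p ; (inj₂ q) → ¬q q }

  ∑ : List V → (V → ℕ) → ℕ
  ∑ xs f = sum (mapᴸ f xs)

  ∑-cong : ∀ xs {f g} → (∀ v → f v ≡ g v) → ∑ xs f ≡ ∑ xs g
  ∑-cong []       eq = refl
  ∑-cong (x ∷ xs) eq = cong₂ _+_ (eq x) (∑-cong xs eq)

  ∑-+ : ∀ xs f g → ∑ xs (λ v → f v + g v) ≡ ∑ xs f + ∑ xs g
  ∑-+ []       f g = refl
  ∑-+ (x ∷ xs) f g = trans (cong (f x + g x +_) (∑-+ xs f g)) (+-swap-middle (f x) (g x) (∑ xs f) (∑ xs g))

  ∑-* : ∀ xs f m → ∑ xs (λ v → f v * m) ≡ ∑ xs f * m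
  ∑-* []       f m = refl
  ∑-* (x ∷ xs) f m = trans (cong (f x * m +_) (∑-* xs f m)) (sym (*-distribʳ-+ m (f x) (∑ xs f)))

  ∑-zero : ∀ xs → ∑ xs (λ _ → 0) ≡ 0
  ∑-zero []       = refl
  ∑-zero (_ ∷ xs) = ∑-zero xs

  ∑-swap : ∀ xs ys (f : V → V → ℕ) → ∑ xs (λ x → ∑ ys (f x)) ≡ ∑ ys (λ y → ∑ xs (λ x → f x y))
  ∑-swap []       ys f = sym (∑-zero ys)
  ∑-swap (x ∷ xs) ys f = trans (cong (∑ ys (f x) +_) (∑-swap xs ys f)) (sym (∑-+ ys (f x) _))

  # : (V → Set a) → ℕ
  # P = ∑ vs (λ v → ⟦ P v ⟧)

  #-cong : ∀ {P Q} → (∀ {v} → P v → Q v) → (∀ {v} → Q v → P v) → # P ≡ # Q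
  #-cong f g = ∑-cong vs λ v → ⟦⟧-cong f g

  #-⊎ : ∀ {P Q} → (∀ {v} → P v → Q v → ⊥) → # (λ v → P v ⊎ Q v) ≡ # P + # Q
  #-⊎ {P} {Q} disj = trans (∑-cong vs λ v → ⟦⟧-⊎ (disj {v})) (∑-+ vs (λ v → ⟦ P v ⟧) (λ v → ⟦ Q v ⟧))

  #-none : ∀ {P} → (∀ {v} → P v → ⊥) → # P ≡ 0
  #-none none = trans (∑-cong vs λ v → ⟦⟧-no none) (∑-zero vs)

  #-one : ∀ {P} x → P x → (∀ {v} → P v → v ≡ x) → # P ≡ 1
  #-one {P} x px only = go vs vs-unique (vs-complete x)
    where
    zeros : ∀ {xs} → All.All (x ≢_) xs → ∑ xs (λ v → ⟦ P v ⟧) ≡ 0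
    zeros []            = refl
    zeros (x≢y ∷ x≢ys) = cong₂ _+_ (⟦⟧-no (λ py → x≢y (sym (only py)))) (zeros x≢ys)
    go : ∀ xs → Unique xs → x ∈ xs → ∑ xs (λ v → ⟦ P v ⟧) ≡ 1
    go (_ ∷ xs) (x≢xs ∷ _)  (here refl) = cong₂ _+_ (⟦⟧-yes px) (zeros x≢xs)
    go (y ∷ xs) (y≢xs ∷ u) (there x∈) =
      cong₂ _+_ (⟦⟧-no (λ py → All.lookup y≢xs x∈ (only py))) (go xs u x∈)

  #-fibres : ∀ {A P : V → Set a} {R : V → V → Set a} {m} →
             (∀ {c} → A c → # (R c) ≡ m) →
             (∀ {v} → P v → ∃[ c ] A c × R c v) →
             (∀ {c v} → A c → R c v → P v) →
             (∀ {c c′ v} → A c → A c′ → R c v → R c′ v → c ≡ c′) →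
             # P ≡ # A * m
  #-fibres {A} {P} {R} {m} size covers sound one = begin
    # P                                     ≡⟨ ∑-cong vs fibre ⟩
    -- The pairs `(c , v)` with `A c` and `R c v` are counted twice: each `v` in `P` occurs in one
    -- of them, each `c` in `A` in `m`.
    ∑ vs (λ v → # (λ c → A c × R c v))      ≡⟨ ∑-swap vs vs (λ v c → ⟦ A c × R c v ⟧) ⟩
    ∑ vs (λ c → # (λ v → A c × R c v))      ≡⟨ ∑-cong vs row ⟩
    ∑ vs (λ c → ⟦ A c ⟧ * m)                ≡⟨ ∑-* vs (λ c → ⟦ A c ⟧) m ⟩
    # A * m                                 ∎
    where
    open ≡-Reasoning
    fibre : ∀ v → ⟦ P v ⟧ ≡ # (λ c → A c × R c v)
    fibre v with em {P v}
    ... | yes pv = let c , ac , rcv = covers pv in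
                   sym (#-one c (ac , rcv) λ (ac′ , rc′v) → one ac′ ac rc′v rcv)
    ... | no ¬pv = sym (#-none λ (ac , rcv) → ¬pv (sound ac rcv))
    row : ∀ c → # (λ v → A c × R c v) ≡ ⟦ A c ⟧ * m
    row c with em {A c}
    ... | yes ac = trans (#-cong proj₂ (ac ,_)) (trans (size ac) (sym (+-identityʳ m)))
    ... | no ¬ac = #-none λ (ac , _) → ¬ac ac

  #-bijection : ∀ {A B : V → Set a} (R : V → V → Set a) →
                (∀ {x} → A x → ∃[ y ] B y × R x y) →
                (∀ {y} → B y → ∃[ x ] A x × R x y) →
                (∀ {x y y′} → R x y → R x y′ → y ≡ y′) →
                (∀ {x x′ y} → R x y → R x′ y → x ≡ x′) →
                # A ≡ # B
  #-bijection {A} {B} R to from fun inj = sym (trans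
    (#-fibres {A} {B} {λ x y → B y × R x y} {1}
      (λ ax → let y , by , r = to ax in #-one y (by , r) λ (_ , r′) → fun r′ r)
      (λ by → let x , ax , r = from by in x , ax , by , r)
      (λ _ → proj₁)
      (λ _ _ (_ , r) (_ , r′) → inj r r′))
    (*-identityʳ (# A)))

  #-remove : ∀ {P} x → P x → # P ≡ suc (# (λ v → P v × v ≢ x))
  #-remove {P} x px = trans (#-cong split merge) (trans (#-⊎ (λ v≡x (_ , v≢x) → v≢x v≡x))
    (cong (_+ # (λ v → P v × v ≢ x)) (#-one x refl id)))
    where
    split : ∀ {v} → P v → v ≡ x ⊎ (P v × v ≢ x)
    split {v} pv with em {v ≡ x}
    ... | yes v≡x = inj₁ v≡x
    ... | no  v≢x = inj₂ (pv , v≢x)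
    merge : ∀ {v} → v ≡ x ⊎ (P v × v ≢ x) → P v
    merge (inj₁ refl)     = px
    merge (inj₂ (pv , _)) = pv

-- Expected numbers of descents

-- U i / M is the probability of independent events Xᵢ.  The number of
-- descents (Xᵢ and not Xᵢ₊₁) is at least 1 when X₀ and not X_N; if the
-- expectations agree, then almost surely there is at most one change.
module Descents (U Ū : ℕ → ℕ) (M : ℕ) (M≢0 : NonZero M) (sum≡M : ∀ i → U i + Ū i ≡ M) where

  drop : ℕ → ℕ → ℕ
  drop i j = U i * Ū j

  -- Up to the factor M³, the probability that the three events change twice, as no, yes, no or as
  -- yes, no, yes.
  slack : ℕ → ℕ → ℕ → ℕ
  slack i j k = Ū i * (U j * Ū k) + U i * (Ū j * U k)

  -- Patterns with a single drop are counted once on both sides, so the left exceeds `drop i k` by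
  -- the double changes only. The factor `M` is the total weight of the event that a `drop` leaves
  -- out.
  triangle : ∀ i j k → M * (drop i j + drop j k) ≡ M * drop i k + slack i j k
  triangle i j k = begin
    M * (U i * Ū j + U j * Ū k)
      ≡⟨ *-distribˡ-+ M (U i * Ū j) (U j * Ū k) ⟩
    M * (U i * Ū j) + M * (U j * Ū k)
      ≡⟨ cong₂ _+_ (cong (_* (U i * Ū j)) (sym (sum≡M k))) (cong (_* (U j * Ū k)) (sym (sum≡M i))) ⟩
    (U k + Ū k) * (U i * Ū j) + (U i + Ū i) * (U j * Ū k)
      ≡⟨ identity (U i) (Ū i) (U j) (Ū j) (U k) (Ū k) ⟩
    (U j + Ū j) * (U i * Ū k) + slack i j k
      ≡⟨ cong (λ t → t * (U i * Ū k) + slack i j k) (sum≡M j) ⟩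
    M * drop i k + slack i j k ∎
    where
    open ≡-Reasoning
    identity : ∀ a a′ b b′ c c′ → (c + c′) * (a * b′) + (a + a′) * (b * c′) ≡
               (b + b′) * (a * c′) + (a′ * (b * c′) + a * (b′ * c))
    identity = solve-∀

  drop-triangle : ∀ i j k → drop i k ≤ drop i j + drop j k
  drop-triangle i j k = *-cancelˡ-≤ M ⦃ M≢0 ⦄
    (≤-trans (m≤m+n _ (slack i j k)) (≤-reflexive (sym (triangle i j k))))

  descents : ℕ → ℕ → ℕ
  descents i zero    = 0
  descents i (suc l) = drop i (suc i) + descents (suc i) l

  descents-split : ∀ i l m → descents i (l + m) ≡ descents i l + descents (l + i) m
  descents-split i zero    m = refl
  descents-split i (suc l) m = trans (cong (drop i (suc i) +_)
    (trans (descents-split (suc i) l m) (cong (λ t → descents (suc i) l + descents t m) (+-suc l i))))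
    (sym (+-assoc (drop i (suc i)) _ _))

  drop≤descents : ∀ i l → drop i (suc l + i) ≤ descents i (suc l)
  drop≤descents i zero    = m≤m+n _ 0
  drop≤descents i (suc l) = ≤-trans (drop-triangle i (suc i) (suc (suc l) + i))
    (+-monoʳ-≤ (drop i (suc i)) (subst (λ t → drop (suc i) t ≤ descents (suc i) (suc l))
      (cong suc (+-suc l i)) (drop≤descents (suc i) l)))

  module _ {N} (tight : drop 0 N ≡ descents 0 N) where

    no-slack : ∀ {x y} → M * x + y ≤ M * x → y ≡ 0
    no-slack {x} {y} l = n≤0⇒n≡0 (+-cancelˡ-≤ (M * x) y 0 (≤-trans l (≤-reflexive (sym (+-identityʳ _)))))

    -- The descents amount to at least `drop 0 j + drop j k` and the rest, which exceeds `drop 0 N`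
    -- by at least the slack up to the factor `M`; equality leaves no slack.
    slack≡0 : ∀ a b c → suc b + suc a + c ≡ N → slack 0 (suc a) (suc b + suc a) ≡ 0
    slack≡0 a b c refl = no-slack {drop 0 (k + c)} (begin
      M * drop 0 (k + c) + slack 0 j k              ≤⟨ bound c ⟩
      M * (drop 0 j + drop j k + descents k c)      ≤⟨ *-monoʳ-≤ M (+-monoˡ-≤ (descents k c) low) ⟩
      M * (descents 0 k + descents k c)             ≡⟨ cong (M *_) (trans (cong (λ t → descents 0 k + descents t c)
                                                             (sym (+-identityʳ k))) (sym (descents-split 0 k c))) ⟩
      M * descents 0 (k + c)                        ≡⟨ cong (M *_) tight ⟨
      M * drop 0 (k + c)                            ∎)
      where
      open ≤-Reasoning
      j = suc a
      k = suc b + suc a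
      low : drop 0 j + drop j k ≤ descents 0 k
      low = ≤-trans (+-mono-≤ (subst (λ t → drop 0 t ≤ descents 0 j) (+-identityʳ j) (drop≤descents 0 a))
                                (drop≤descents j b))
                (≤-reflexive (trans (cong (λ t → descents 0 j + descents t (suc b)) (sym (+-identityʳ j)))
                  (trans (sym (descents-split 0 j (suc b))) (cong (descents 0) (+-comm j (suc b))))))
      bound : ∀ c → M * drop 0 (k + c) + slack 0 j k ≤ M * (drop 0 j + drop j k + descents k c)
      -- An empty rest needs its own case: `drop k k` may be positive while `descents k 0` is 0.
      bound zero = begin
        M * drop 0 (k + 0) + slack 0 j k     ≡⟨ cong (λ t → M * drop 0 t + slack 0 j k) (+-identityʳ k) ⟩
        M * drop 0 k + slack 0 j k           ≡⟨ triangle 0 j k ⟨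
        M * (drop 0 j + drop j k)            ≡⟨ cong (M *_) (+-identityʳ _) ⟨
        M * (drop 0 j + drop j k + 0)        ∎
      bound (suc c) = begin
        M * drop 0 (k + suc c) + slack 0 j k
          ≤⟨ +-monoˡ-≤ (slack 0 j k) (*-monoʳ-≤ M (drop-triangle 0 k (k + suc c))) ⟩
        M * (drop 0 k + drop k (k + suc c)) + slack 0 j k
          ≡⟨ cong (_+ slack 0 j k) (*-distribˡ-+ M (drop 0 k) (drop k (k + suc c))) ⟩
        M * drop 0 k + M * drop k (k + suc c) + slack 0 j k
          ≡⟨ shuffle (M * drop 0 k) (M * drop k (k + suc c)) (slack 0 j k) ⟩
        M * drop 0 k + slack 0 j k + M * drop k (k + suc c)
          ≡⟨ cong (_+ M * drop k (k + suc c)) (triangle 0 j k) ⟨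
        M * (drop 0 j + drop j k) + M * drop k (k + suc c)
          ≡⟨ *-distribˡ-+ M (drop 0 j + drop j k) (drop k (k + suc c)) ⟨
        M * (drop 0 j + drop j k + drop k (k + suc c))
          ≤⟨ *-monoʳ-≤ M (+-monoʳ-≤ (drop 0 j + drop j k)
               (subst (λ t → drop k t ≤ descents k (suc c)) (+-comm (suc c) k) (drop≤descents k c))) ⟩
        M * (drop 0 j + drop j k + descents k (suc c)) ∎
        where
        shuffle : ∀ x y z → x + y + z ≡ x + z + y
        shuffle = solve-∀

module Windows (N : ℕ) (2≤N : 2 ≤ N) where

  -- Only the event at `k` may be mixed: those before it almost surely fail, those after it almost
  -- surely hold.
  Window : (ℕ → ℕ) → (ℕ → ℕ) → Set
  Window U Ū = ∃[ k ] k ≤ N × (∀ m → m < k → U m ≡ 0) × (∀ m → k < m → m ≤ N → Ū m ≡ 0)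

  -- One half of the vanishing slack; the other half arises by exchanging `U` and `Ū`.
  NoReturn : (ℕ → ℕ) → (ℕ → ℕ) → Set
  NoReturn U Ū = ∀ j k → 0 < j → j < k → k ≤ N → Ū 0 * (U j * Ū k) ≡ 0

  first-nonzero : ∀ (U : ℕ → ℕ) N → (∀ m → m ≤ N → U m ≡ 0) ⊎
                  (∃[ k ] k ≤ N × U k ≢ 0 × (∀ m → m < k → U m ≡ 0))
  first-nonzero U zero with U 0 ≟ 0
  ... | yes z = inj₁ λ { .0 z≤n → z }
  ... | no nz = inj₂ (0 , z≤n , nz , λ _ ())
  first-nonzero U (suc N) with first-nonzero U N
  ... | inj₂ (k , k≤N , rest) = inj₂ (k , m≤n⇒m≤1+n k≤N , rest)
  ... | inj₁ zeros with U (suc N) ≟ 0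
  ...   | no nz = inj₂ (suc N , ≤-refl , nz , λ { m (s≤s m≤N) → zeros m m≤N })
  ...   | yes z = inj₁ λ m m≤ → extend m (m≤n⇒m<n∨m≡n m≤)
    where
    extend : ∀ m → m < suc N ⊎ m ≡ suc N → U m ≡ 0
    extend m (inj₁ m<1+N) = zeros m (≤-pred m<1+N)
    extend m (inj₂ refl)  = z

  *-zeroʳ⁻ : ∀ m {n} → m ≢ 0 → m * n ≡ 0 → n ≡ 0
  *-zeroʳ⁻ m m≢0 eq with m*n≡0⇒m≡0∨n≡0 m eq
  ... | inj₁ m≡0 = ⊥-elim (m≢0 m≡0)
  ... | inj₂ n≡0 = n≡0

  start-pure : ∀ U Ū → NoReturn U Ū → U 0 ≡ 0 → Ū 0 ≢ 0 → Window U Ū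
  start-pure U Ū none U₀≡0 Ū₀≢0 with first-nonzero U N
  ... | inj₁ zeros = N , ≤-refl , (λ m m<N → zeros m (<⇒≤ m<N)) , (λ m N<m m≤N → ⊥-elim (<⇒≱ N<m m≤N))
  ... | inj₂ (zero , _ , U₀≢0 , _) = ⊥-elim (U₀≢0 U₀≡0)
  ... | inj₂ (suc k , k≤N , Uₖ≢0 , zeros) = suc k , k≤N , zeros , λ m k<m m≤N →
    *-zeroʳ⁻ (U (suc k)) Uₖ≢0 (*-zeroʳ⁻ (Ū 0) Ū₀≢0 (none (suc k) m (s≤s z≤n) k<m m≤N))

  -- A mixed event 0 forces all later events to be pure and of one kind, so the window is at 0. If
  -- event 0 is pure, the window is at the first place where the other outcome is possible.
  window : ∀ U Ū → (∀ m → U m ≢ 0 ⊎ Ū m ≢ 0) → NoReturn U Ū → NoReturn Ū U → Window U Ū ⊎ Window Ū U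
  window U Ū pos none none′ with U 0 ≟ 0 | Ū 0 ≟ 0 | pos 0
  ... | yes z | _     | inj₁ nz = ⊥-elim (nz z)
  ... | yes z | _     | inj₂ nz = inj₁ (start-pure U Ū none z nz)
  ... | _     | yes z | inj₂ nz = ⊥-elim (nz z)
  ... | _     | yes z | inj₁ nz = inj₂ (start-pure Ū U none′ z nz)
  ... | no U₀≢0 | no Ū₀≢0 | _ with U 1 ≟ 0
  ...   | yes U₁≡0 = inj₂ (0 , z≤n , (λ _ ()) , rest)
    where
    Ū₁≢0 : Ū 1 ≢ 0
    Ū₁≢0 = fromInj₂ (λ nz → ⊥-elim (nz U₁≡0)) (pos 1)
    rest : ∀ m → 0 < m → m ≤ N → U m ≡ 0
    rest (suc zero)    _ _   = U₁≡0
    rest (suc (suc m)) _ m≤N = *-zeroʳ⁻ (Ū 1) Ū₁≢0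
      (*-zeroʳ⁻ (U 0) U₀≢0 (none′ 1 (suc (suc m)) (s≤s z≤n) (s≤s (s≤s z≤n)) m≤N))
  ...   | no U₁≢0 = inj₁ (0 , z≤n , (λ _ ()) , rest)
    where
    later : ∀ m → 1 < m → m ≤ N → Ū m ≡ 0
    later m 1<m m≤N = *-zeroʳ⁻ (U 1) U₁≢0 (*-zeroʳ⁻ (Ū 0) Ū₀≢0 (none 1 m (s≤s z≤n) 1<m m≤N))
    -- A third index is used here: with `U 0` and `U 2` positive, a positive `Ū 1` would allow yes,
    -- no, yes.
    U₂≢0 : U 2 ≢ 0
    U₂≢0 = fromInj₁ (λ nz → ⊥-elim (nz (later 2 ≤-refl 2≤N))) (pos 2)
    Ū₁≡0 : Ū 1 ≡ 0
    Ū₁≡0 = *-zeroʳ⁻ (U 2) U₂≢0 (trans (*-comm (U 2) (Ū 1))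
             (*-zeroʳ⁻ (U 0) U₀≢0 (none′ 1 2 (s≤s z≤n) ≤-refl 2≤N)))
    rest : ∀ m → 0 < m → m ≤ N → Ū m ≡ 0
    rest (suc zero)    _ _   = Ū₁≡0
    rest (suc (suc m)) _ m≤N = later (suc (suc m)) (s≤s (s≤s z≤n)) m≤N

-- Cells of a finite polygon over an apartment

module Finite {a c d} (em : ExcludedMiddle a) {G : Graph a a} {H : Graph c d} {κ : ℕ}
              (polyG : IsPolygonal (3 + κ) G) (polyH : IsPolygonal (3 + κ) H) (h : Hom G H)
              (C : Graph.Cycle H (3 + κ + (3 + κ)))
              (vs : List (Graph.V G)) (vs-unique : Unique vs) (vs-complete : ∀ v → v ∈ vs)
              (third : ∀ m u v → ∃[ t ] Graph._~_ G m t × t ≢ u × t ≢ v)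
              -- Equivalent to lying over `vtx i`, but at the level at which subsets are counted.
              (E : ℕ → Graph.V G → Set a)
              (E⇒ : ∀ {i v} → E i v → Hom.map h v ≡ Graph.Cycle.vtx C i)
              (⇒E : ∀ {i v} → Hom.map h v ≡ Graph.Cycle.vtx C i → E i v)
              (E-step : ∀ {i u v} → Graph._~_ G u v → E (suc i) u → E i v ⊎ E (suc (suc i)) v)
              (inhabited : ∀ i → ∃[ v ] E i v) where
  open Graph G hiding (Cycle)
  open IsPolygonal polyG
  open Hom h
  open HomFacts polyG polyH h
  open Count em vs vs-unique vs-complete
  private
    module H where
      open Graph H public
    module A = Apartment polyH C
    n L : ℕ
    n = 3 + κ
    L = n + n

  E-≡ : ∀ {i j v} → i ≡ j → E i v → E j v
  E-≡ refl e = e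

  E-up : ∀ {i v} → E i v → E (L + i) v
  E-up e = ⇒E (trans (E⇒ e) (sym (A.period _)))

  E-down : ∀ {i v} → E (L + i) v → E i v
  E-down e = ⇒E (trans (E⇒ e) (A.period _))

  E-turn : ∀ {i v} → E i v → E (2 + i) v → ⊥
  E-turn e e′ = A.turn _ (trans (sym (E⇒ e′)) (E⇒ e))

  E-far : ∀ {i x y k p v m} → Walk x y k p v → E i x → E (suc m + i) v → suc m ≤ n → m ≤ k
  E-far {i} {k = k} {m = m} w ex ev l =
    far w (subst₂ (λ s t → H.Walk s (A.vtx (suc i)) m (A.vtx (m + i)) t) (sym (E⇒ ex)) (sym (E⇒ ev)) (A.forth i m)) l

  E-lift : ∀ {i x v} → E i x → E (2 + κ + i) v →
           ∃[ y ] ∃[ q ] Walk x y (suc κ) q v × E (suc i) y × E (suc κ + i) q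
  E-lift {i} ex ev =
    let y , q , w , y≡ , q≡ = lift-walk (subst₂ (λ s t → H.Walk s (A.vtx (suc i)) (suc κ) (A.vtx (suc κ + i)) t)
                                (sym (E⇒ ex)) (sym (E⇒ ev)) (A.forth i (suc κ))) refl
    in y , q , w , ⇒E y≡ , ⇒E q≡

  forward : ∀ {i v} → E i v → ∃[ u ] v ~ u × E (suc i) u
  forward {i} ev = let y , e , w , ey , _ = E-lift ev (proj₂ (inhabited (2 + κ + i))) in y , first~ w , ey

  -- Opposite cells

  Next Prev : ℕ → V → V → Set a
  Next i v u = v ~ u × E (suc i) u
  Prev i y z = y ~ z × E i z

  -- Lift the walk of `n - 1` edges from `y` and put `x` in front of it; it does not turn back at
  -- `y`, because cells `i` and `2 + i` differ.
  reach-opposite : ∀ {i x y v} → E i x → x ~ y → E (suc i) y → E (n + i) v →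
                   ∃[ q ] Walk x y (2 + κ) q v × E (2 + κ + i) q
  reach-opposite {i} ex xy ey ev =
    let z , q , w , ez , eq = E-lift ey (E-≡ (sym (+-suc (2 + κ) i)) ev)
    in q , cons xy (λ { refl → E-turn ex ez }) w , E-≡ (+-suc (suc κ) i) eq

  reach-opposite′ : ∀ {i x z v} → E i x → v ~ z → E (2 + κ + i) z → E (n + i) v →
                    ∃[ y ] Walk x y (2 + κ) z v × E (suc i) y
  reach-opposite′ {i} ex vz ez ev =
    let y , q , w , ey , eq = E-lift ex ez
    in y , snoc w (~-sym vz) (λ { refl → E-turn eq ev }) , ey

  -- `v` and `y` are opposite, and the walks of `n` edges between them pair the forward neighbours
  -- of `v` with the backward neighbours of `y`.
  next-prev : ∀ {i v y} → E i v → E (n + i) y → # (Next i v) ≡ # (Prev (2 + κ + i) y)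
  next-prev {i} {v} {y} ev ey = #-bijection (λ u z → Walk v u (2 + κ) z y)
    (λ (vu , eu) → let z , w , ez = reach-opposite ev vu eu ey in z , (~-sym (last~ w) , ez) , w)
    (λ (yz , ez) → let u , w , eu = reach-opposite′ ev yz ez ey in u , (first~ w , eu) , w)
    (λ w w′ → proj₂ (unique-after w w′ (+-mono-< (n<1+n (2 + κ)) (n<1+n (2 + κ)))))
    (λ w w′ → proj₂ (unique-after (rev w) (rev w′) (+-mono-< (n<1+n (2 + κ)) (n<1+n (2 + κ)))))

  centre : ℕ → V
  centre i = proj₁ (inhabited i)

  centre∈ : ∀ i → E i (centre i)
  centre∈ i = proj₂ (inhabited i)

  -- W i is the number of forward neighbours of a vertex of cell i.  Opposition
  -- exchanges forward and backward, so suc (w̄ i) is its number of backward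
  -- neighbours.
  w W w̄ : ℕ → ℕ
  w i = # (λ u → Next i (centre i) u × u ≢ proj₁ (forward (centre∈ i)))
  W i = suc (w i)
  w̄ i = w (n + i)

  W-next : ∀ {i v} → E i v → # (Next i v) ≡ W i
  W-next {i} ev = trans (next-prev ev (centre∈ (n + i)))
    (trans (sym (next-prev (centre∈ i) (centre∈ (n + i)))) (#-remove _ (proj₂ (forward (centre∈ i)))))

  W-prev : ∀ {j y} → E (suc j) y → # (Prev j y) ≡ suc (w̄ (suc j))
  W-prev {j} {y} ey = trans
    (#-cong (λ (yz , ez) → yz , E-≡ shuffle (E-up ez)) (λ (yz , ez) → yz , E-down (E-≡ (sym shuffle) ez)))
    (trans (sym (next-prev (centre∈ (n + suc j)) (E-≡ (+-assoc n n (suc j)) (E-up ey)))) (W-next (centre∈ (n + suc j))))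
    where
    shuffle : L + j ≡ 2 + κ + (n + suc j)
    shuffle = solve′ κ j
      where
      solve′ : ∀ κ j → 3 + κ + (3 + κ) + j ≡ 2 + κ + (3 + κ + suc j)
      solve′ = solve-∀

  w-next : ∀ {i v x} → E i v → Next i v x → # (λ u → Next i v u × u ≢ x) ≡ w i
  w-next ev nx = suc-injective (trans (sym (#-remove _ nx)) (W-next ev))

  w-prev : ∀ {j y x} → E (suc j) y → Prev j y x → # (λ z → Prev j y z × z ≢ x) ≡ w̄ (suc j)
  w-prev ey px = suc-injective (trans (sym (#-remove _ px)) (W-prev ey))

  w-periodic : ∀ i → w (L + i) ≡ w i
  w-periodic i = suc-injective (trans (sym (W-next (E-up (centre∈ i))))
    (trans (#-cong (λ (vu , eu) → vu , E-down (E-≡ (sym (+-suc L i)) eu)) (λ (vu , eu) → vu , E-≡ (+-suc L i) (E-up eu)))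
      (W-next (centre∈ i))))

  -- Walks counted by the number of folds

  Reaching : V → V → ℕ → ℕ → V → Set a
  Reaching x y k j v = Reach x y k v × E j v

  -- The number of walks that go forward for `k` more steps after a fixed first edge out of cell
  -- `i`.
  P : ℕ → ℕ → ℕ
  P i zero    = 1
  P i (suc k) = W (suc i) * P (suc i) k

  short : ∀ {k k′} → k ≤ 2 + κ → k′ ≤ 2 + κ → k + k′ < L
  short l l′ = ≤-trans (s≤s (+-mono-≤ l l′)) (+-monoʳ-≤ n (n≤1+n (2 + κ)))

  -- From `c` only `k` edges are left to advance `2 + k` cells.
  not-behind : ∀ {i k b c p v} → Walk b c k p v → E i c → E (suc k + suc i) v → suc k ≤ 2 + κ → ⊥
  not-behind (edge _) ec ev _ = E-turn ec ev
  not-behind {i} {suc k} (cons _ _ w) ec ev l =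
    <⇒≱ (n≤1+n _) (E-far w ec (E-≡ (+-suc (2 + k) i) ev) (s≤s l))

  E-near : ∀ {i u v} → u ~ v → E i u → E (suc i) v ⊎ (∃[ j ] suc j ≡ L + i × E j v)
  E-near uv eu with E-step uv (E-up eu)
  ... | inj₁ ev = inj₂ (_ , refl , ev)
  ... | inj₂ ev = inj₁ (E-down (E-≡ (sym (+-suc L _)) ev))

  -- As many cells are advanced as there are edges, so no step goes back, and each step contributes
  -- the next factor `W`.
  no-fold : ∀ k {i x y} → E i x → x ~ y → E (suc i) y → k ≤ 2 + κ → # (Reaching x y k (k + suc i)) ≡ P i k
  no-fold zero ex xy ey _ = #-one _ ((_ , edge xy) , ey) λ { ((_ , edge _) , _) → refl }
  no-fold (suc k) {i} {x} {y} ex xy ey l = begin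
    # (Reaching x y (suc k) (suc k + suc i)) ≡⟨ #-fibres {Next (suc i) y} {R = λ c → Reaching y c k (k + suc (suc i))}
        (λ (yc , ec) → no-fold k ey yc ec (<⇒≤ l)) covers
        (λ (yc , ec) ((p , w) , ev) → (p , cons xy (λ { refl → E-turn ex ec }) w) , E-≡ (+-suc k (suc i)) ev)
        (λ _ _ ((_ , w) , _) ((_ , w′) , _) → unique-first w w′ (short l l)) ⟩
    # (Next (suc i) y) * P (suc i) k         ≡⟨ cong (_* P (suc i) k) (W-next ey) ⟩
    P i (suc k) ∎
    where
    open ≡-Reasoning
    covers : ∀ {v} → Reaching x y (suc k) (suc k + suc i) v → ∃[ c ] Next (suc i) y c × Reaching y c k (k + suc (suc i)) v
    covers ((p , cons _ c≢x w) , ev) with E-step (first~ w) ey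
    ... | inj₁ ec = ⊥-elim (not-behind w ec ev l)
    ... | inj₂ ec = _ , (first~ w , ec) , (p , w) , E-≡ (sym (+-suc k (suc i))) ev

  -- The first edge goes back to cell `i` and all others go forward; since the walk must not return
  -- to `x`, the first factor is `w i` and not `W i`.
  turn-first : ∀ k {i x y} → E (suc i) x → x ~ y → E i y → suc k ≤ 2 + κ →
               # (Reaching x y (suc k) (k + suc i)) ≡ w i * P i k
  turn-first k {i} {x} {y} ex xy ey l = begin
    # (Reaching x y (suc k) (k + suc i)) ≡⟨ #-fibres {λ c → Next i y c × c ≢ x} {R = λ c → Reaching y c k (k + suc i)}
        (λ ((yc , ec) , _) → no-fold k ey yc ec (<⇒≤ l)) covers
        (λ ((yc , ec) , c≢x) ((p , w) , ev) → (p , cons xy c≢x w) , ev)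
        (λ _ _ ((_ , w) , _) ((_ , w′) , _) → unique-first w w′ (short l l)) ⟩
    # (λ c → Next i y c × c ≢ x) * P i k ≡⟨ cong (_* P i k) (w-next ey (~-sym xy , ex)) ⟩
    w i * P i k ∎
    where
    open ≡-Reasoning
    covers : ∀ {v} → Reaching x y (suc k) (k + suc i) v → ∃[ c ] (Next i y c × c ≢ x) × Reaching y c k (k + suc i) v
    covers ((p , cons _ c≢x w) , ev) with E-near (first~ w) ey
    ... | inj₂ (j , eq , ec) = ⊥-elim (not-behind w ec (E-≡ (shuffle k j i eq) (E-up ev)) l)
      where
      shuffle : ∀ k j i → suc j ≡ L + i → L + (k + suc i) ≡ suc k + suc j
      shuffle k j i eq = trans (shuffle′ L k i) (cong (suc k +_) (sym eq))
        where
        shuffle′ : ∀ L k i → L + (k + suc i) ≡ suc k + (L + i)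
        shuffle′ = solve-∀
    ... | inj₁ ec = _ , ((first~ w , ec) , c≢x) , (p , w) , ev

  -- P i k * B i k counts the walks with a single fold; the summand
  -- w j * w̄ (suc j) belongs to those that turn back at cell suc j and forward
  -- again at cell j.
  B : ℕ → ℕ → ℕ
  B i zero    = w i * w̄ (suc i) + W (suc i) * w̄ (2 + i)
  B i (suc k) = w i * w̄ (suc i) + B (suc i) k

  -- After the first edge there are two more steps than cells to advance, so exactly one step goes
  -- back: at once in `Down`, later in `Up`, and at the very end in the base case of `up-size`.
  one-fold : ∀ k {i x y} → E i x → x ~ y → E (suc i) y → 2 + k ≤ 2 + κ →
             # (Reaching x y (2 + k) (k + suc i)) ≡ P i k * B i k
  one-fold k {i} {x} {y} ex xy ey l = begin
    # (Reaching x y (2 + k) (k + suc i))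
      ≡⟨ #-cong split merge ⟩
    # (λ v → Up v ⊎ Down v)
      ≡⟨ #-⊎ disjoint ⟩
    # Up + # Down
      ≡⟨ cong₂ _+_ (#-fibres {A = Next (suc i) y} {R = λ c → Reaching y c (suc k) (k + suc i)}
                      (λ (yc , ec) → up-size k l ey yc ec) id
                      (λ ac r → _ , ac , r)
                      (λ _ _ ((_ , w) , _) ((_ , w′) , _) → unique-first w w′ (short l l)))
                    (#-fibres {A = λ c → Prev i y c × c ≢ x} {R = λ c → Reaching y c (suc k) (k + suc i)}
                      (λ ((yc , ec) , _) → turn-first k ey yc ec (<⇒≤ l)) id
                      (λ ac r → _ , ac , r)
                      (λ _ _ ((_ , w) , _) ((_ , w′) , _) → unique-first w w′ (short l l))) ⟩
    # (Next (suc i) y) * up k + # (λ c → Prev i y c × c ≢ x) * (w i * P i k)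
      ≡⟨ cong₂ _+_ (cong (_* up k) (W-next ey)) (cong (_* (w i * P i k)) (w-prev ey (~-sym xy , ex))) ⟩
    W (suc i) * up k + w̄ (suc i) * (w i * P i k)
      ≡⟨ final k ⟩
    P i k * B i k ∎
    where
    open ≡-Reasoning
    up : ℕ → ℕ
    up zero    = w̄ (2 + i)
    up (suc k) = P (suc i) k * B (suc i) k
    Up Down : V → Set a
    Up v   = ∃[ c ] Next (suc i) y c × Reaching y c (suc k) (k + suc i) v
    Down v = ∃[ c ] (Prev i y c × c ≢ x) × Reaching y c (suc k) (k + suc i) v
    split : ∀ {v} → Reaching x y (2 + k) (k + suc i) v → Up v ⊎ Down v
    split ((p , cons _ c≢x w) , ev) with E-step (first~ w) ey
    ... | inj₁ ec = inj₂ (_ , ((first~ w , ec) , c≢x) , (p , w) , ev)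
    ... | inj₂ ec = inj₁ (_ , (first~ w , ec) , (p , w) , ev)
    merge : ∀ {v} → Up v ⊎ Down v → Reaching x y (2 + k) (k + suc i) v
    merge (inj₁ (c , (yc , ec) , (p , w) , ev)) = (p , cons xy (λ { refl → E-turn ex ec }) w) , ev
    merge (inj₂ (c , (_ , c≢x) , (p , w) , ev)) = (p , cons xy c≢x w) , ev
    disjoint : ∀ {v} → Up v → Down v → ⊥
    disjoint (_ , (_ , ec) , (_ , w) , _) (_ , ((_ , ec′) , _) , (_ , w′) , _)
      with refl ← unique-first w w′ (short l l) = E-turn ec′ ec
    up-size : ∀ k {c} → 2 + k ≤ 2 + κ → E (suc i) y → y ~ c → E (2 + i) c → # (Reaching y c (suc k) (k + suc i)) ≡ up k
    up-size zero {c} _ ey yc ec = trans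
      (#-cong (λ { ((_ , cons _ v≢y (edge cv)) , ev) → (cv , ev) , v≢y })
              (λ ((cv , ev) , v≢y) → (_ , cons yc v≢y (edge cv)) , ev))
      (w-prev ec (~-sym yc , ey))
    up-size (suc k) {c} l ey yc ec = trans
      (#-cong (λ (r , ev) → r , E-≡ (sym (+-suc k (suc i))) ev) (λ (r , ev) → r , E-≡ (+-suc k (suc i)) ev))
      (one-fold k ey yc ec (<⇒≤ l))
    final : ∀ k → W (suc i) * up k + w̄ (suc i) * (w i * P i k) ≡ P i k * B i k
    final zero = identity (W (suc i)) (w̄ (2 + i)) (w̄ (suc i)) (w i)
      where
      identity : ∀ A b c d → A * b + c * (d * 1) ≡ 1 * (d * c + A * b)
      identity = solve-∀
    final (suc k) = identity (W (suc i)) (P (suc i) k) (B (suc i) k) (w̄ (suc i)) (w i)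
      where
      identity : ∀ A p b c d → A * (p * b) + c * (d * (A * p)) ≡ A * p * (d * c + b)
      identity = solve-∀

  -- The size of a cell, counted in two ways

  cell-size : ∀ i → # (E (n + i)) ≡ P i (2 + κ)
  cell-size i = let x = centre i
                    ex = centre∈ i
                    y , xy , ey = forward ex
    in trans (#-cong (λ ev → let q , w , _ = reach-opposite ex xy ey ev in (q , w) , E-≡ (sym (+-suc (2 + κ) i)) ev)
                     (λ (_ , ev) → E-≡ (+-suc (2 + κ) i) ev))
             (no-fold (2 + κ) ex xy ey ≤-refl)

  E-parity : ∀ {i x y k p v} → Walk x y k p v → E i x → E (suc κ + i) v → k ≢ suc κ
  E-parity {i} {x} {v = v} w ex ev refl = kindAfter-step (suc κ) (kind x) (trans (sym (kind-walk w)) (begin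
    kind v                                ≡⟨ map-kind v ⟨
    H.kind (map v)                        ≡⟨ cong H.kind (E⇒ ev) ⟩
    H.kind (A.vtx (suc κ + i))            ≡⟨ H.kind-walk (A.forth i κ) ⟩
    kindAfter (suc κ) (H.kind (A.vtx i))  ≡⟨ cong (kindAfter (suc κ) ∘ H.kind) (E⇒ ex) ⟨
    kindAfter (suc κ) (H.kind (map x))    ≡⟨ cong (kindAfter (suc κ)) (map-kind x) ⟩
    kindAfter (suc κ) (kind x)            ∎))
    where open ≡-Reasoning

  -- The target is `n - 2` cells ahead, hence at distance at least `n - 2`, and parity excludes
  -- `n - 1`.
  near-target : ∀ {i x y k p v} → Walk x y k p v → E i x → E (suc κ + i) v → k < n → k ≡ κ ⊎ k ≡ 2 + κ
  near-target w ex ev (s≤s k≤2+κ) with m≤n⇒m<n∨m≡n (E-far w ex ev (≤-trans (n≤1+n _) (n≤1+n _)))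
  ... | inj₂ κ≡k = inj₁ (sym κ≡k)
  ... | inj₁ κ<k with m≤n⇒m<n∨m≡n κ<k
  ...   | inj₂ eq = ⊥-elim (E-parity w ex ev (sym eq))
  ...   | inj₁ l = inj₂ (≤-antisym k≤2+κ l)

  -- Seen from an edge `x ~ y`, an element of this cell is reached straight through `y`, or through
  -- `x` avoiding `y`, or through `y` with one fold; `divide` makes these cases exhaustive and
  -- exclusive.
  cell-size′ : ∀ i → # (E (κ + suc i)) ≡ P i κ + w i * P i κ + P i κ * B i κ
  cell-size′ i = begin
    # (E (κ + suc i))
      ≡⟨ #-cong covers sound ⟩
    # (λ v → (Straight v ⊎ Turned v) ⊎ Folded v)
      ≡⟨ #-⊎ disjoint ⟩
    # (λ v → Straight v ⊎ Turned v) + # Folded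
      ≡⟨ cong₂ _+_ (trans (#-⊎ λ (r , _) (r′ , _) → opposite-ends r r′ (≤-trans (n≤1+n _) (n≤1+n _)) (n≤1+n _))
                     (cong₂ _+_ (no-fold κ ex xy ey (≤-trans (n≤1+n _) (n≤1+n _))) (turn-first κ ey (~-sym xy) ex (n≤1+n _))))
                   (one-fold κ ex xy ey ≤-refl) ⟩
    P i κ + w i * P i κ + P i κ * B i κ ∎
    where
    open ≡-Reasoning
    x = centre i
    ex = centre∈ i
    y = proj₁ (forward ex)
    xy = proj₁ (proj₂ (forward ex))
    ey = proj₂ (proj₂ (forward ex))
    Straight Turned Folded : V → Set a
    Straight = Reaching x y κ (κ + suc i)
    Turned   = Reaching y x (suc κ) (κ + suc i)
    Folded   = Reaching x y (2 + κ) (κ + suc i)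
    covers : ∀ {v} → E (κ + suc i) v → (Straight v ⊎ Turned v) ⊎ Folded v
    covers {v} ev with divide xy v
    ... | k , k<n , inj₁ (p , w) with near-target w ex (E-≡ (+-suc κ i) ev) k<n
    ...   | inj₁ refl = inj₁ (inj₁ ((p , w) , ev))
    ...   | inj₂ refl = inj₂ ((p , w) , ev)
    covers {v} ev | k , k<n , inj₂ (p , edge _) =
      ⊥-elim (IsPolygonal.irreflexive-walk polyH (s≤s (≤-trans (n≤1+n _) (n≤1+n _)))
        (subst (λ t → H.Walk (A.vtx i) (A.vtx (suc i)) κ (A.vtx (κ + i)) t)
          (trans (sym (E⇒ (E-≡ (+-suc κ i) ev))) (E⇒ ex)) (A.forth i κ)))
    covers {v} ev | suc k , k<n , inj₂ (p , cons yx z≢y w) with near-target w ex (E-≡ (+-suc κ i) ev) (<⇒≤ k<n)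
    ...   | inj₁ refl = inj₁ (inj₂ ((p , cons yx z≢y w) , ev))
    ...   | inj₂ refl = ⊥-elim (<-irrefl refl k<n)
    sound : ∀ {v} → (Straight v ⊎ Turned v) ⊎ Folded v → E (κ + suc i) v
    sound (inj₁ (inj₁ (_ , ev))) = ev
    sound (inj₁ (inj₂ (_ , ev))) = ev
    sound (inj₂ (_ , ev))        = ev
    disjoint : ∀ {v} → Straight v ⊎ Turned v → Folded v → ⊥
    disjoint (inj₁ (r , _)) (r′ , _) = <⇒≢ (s≤s (n≤1+n κ)) (same-end r r′ (≤-trans (n≤1+n _) (n≤1+n _)) ≤-refl)
    disjoint (inj₂ (r , _)) (r′ , _) = opposite-ends r′ r ≤-refl (n≤1+n _)

  P≢0 : ∀ i k → NonZero (P i k)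
  P≢0 i zero    = _
  P≢0 i (suc k) = m*n≢0 (W (suc i)) (P (suc i) k) ⦃ _ ⦄ ⦃ P≢0 (suc i) k ⦄

  desc : ℕ → ℕ → ℕ
  desc i zero    = 0
  desc i (suc l) = w i * w̄ (suc i) + desc (suc i) l

  desc-last : ∀ i l → desc i (suc l) ≡ desc i l + w (l + i) * w̄ (suc l + i)
  desc-last i zero    = +-identityʳ _
  desc-last i (suc l) = begin
    w i * w̄ (suc i) + desc (suc i) (suc l)
      ≡⟨ cong (w i * w̄ (suc i) +_) (desc-last (suc i) l) ⟩
    w i * w̄ (suc i) + (desc (suc i) l + w (l + suc i) * w̄ (suc l + suc i))
      ≡⟨ sym (+-assoc (w i * w̄ (suc i)) _ _) ⟩
    desc i (suc l) + w (l + suc i) * w̄ (suc (l + suc i))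
      ≡⟨ cong (λ t → desc i (suc l) + w t * w̄ (suc t)) (+-suc l i) ⟩
    desc i (suc l) + w (suc l + i) * w̄ (suc (suc l) + i) ∎
    where open ≡-Reasoning

  B≡desc : ∀ k i → B i k ≡ desc i (suc k) + W (suc k + i) * w̄ (2 + k + i)
  B≡desc zero i = cong (_+ W (suc i) * w̄ (2 + i)) (sym (+-identityʳ (w i * w̄ (suc i))))
  B≡desc (suc k) i = begin
    w i * w̄ (suc i) + B (suc i) k
      ≡⟨ cong (w i * w̄ (suc i) +_) (B≡desc k (suc i)) ⟩
    w i * w̄ (suc i) + (desc (suc i) (suc k) + W (suc k + suc i) * w̄ (2 + k + suc i))
      ≡⟨ sym (+-assoc (w i * w̄ (suc i)) _ _) ⟩
    desc i (2 + k) + W (suc (k + suc i)) * w̄ (2 + (k + suc i))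
      ≡⟨ cong (λ t → desc i (2 + k) + W (suc t) * w̄ (2 + t)) (+-suc k i) ⟩
    desc i (2 + k) + W (2 + k + i) * w̄ (3 + k + i) ∎
    where open ≡-Reasoning

  -- Cell `n + i` is counted by `cell-size i` from an opposite element and by `cell-size′ (2 + i)`
  -- from an edge two cells further on; the common factor `P (2 + i) κ` cancels. The base `2 + i`
  -- leaves room for the two indices before it.
  descents-equation : ∀ i → w (2 + i) * w̄ (2 + κ + (2 + i)) ≡ desc (2 + i) (2 + κ)
  descents-equation i = +-cancelʳ-≡ W₁′ _ _ (begin
    w₂ * w̄ (2 + κ + (2 + i)) + W₁′    ≡⟨ cong (λ t → w₂ * t + t) w̄≡ ⟩
    w₂ * w₁ + w₁                      ≡⟨ identity₁ w₂ w₁ ⟩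
    w₁ * W (2 + i)                    ≡⟨ sized ⟩
    B (2 + i) κ                       ≡⟨ B≡desc κ (2 + i) ⟩
    desc (2 + i) (suc κ) + W (suc κ + (2 + i)) * w̄ (2 + κ + (2 + i))
                                      ≡⟨ identity₂ (desc (2 + i) (suc κ)) (w (suc κ + (2 + i))) (w̄ (2 + κ + (2 + i))) ⟩
    desc (2 + i) (suc κ) + w (suc κ + (2 + i)) * w̄ (2 + κ + (2 + i)) + W₁′
                                      ≡⟨ cong (_+ W₁′) (desc-last (2 + i) (suc κ)) ⟨
    desc (2 + i) (2 + κ) + W₁′        ∎)
    where
    open ≡-Reasoning
    w₁ = w (suc i)
    w₂ = w (2 + i)
    W₁′ = w̄ (2 + κ + (2 + i))
    shuffle : ∀ κ i → 3 + κ + (2 + κ + (2 + i)) ≡ 3 + κ + (3 + κ) + suc i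
    shuffle = solve-∀
    w̄≡ : W₁′ ≡ w₁
    w̄≡ = trans (cong w (shuffle κ i)) (w-periodic (suc i))
    identity₁ : ∀ x y → x * y + y ≡ y * suc x
    identity₁ = solve-∀
    identity₂ : ∀ d x y → d + suc x * y ≡ d + x * y + y
    identity₂ = solve-∀
    p = P (2 + i) κ
    identity₃ : ∀ x y p → p * (suc x * suc y) ≡ suc x * (suc y * p)
    identity₃ = solve-∀
    identity₄ : ∀ y p b → p + y * p + p * b ≡ p * (suc y + b)
    identity₄ = solve-∀
    counted : p * (suc w₁ * suc w₂) ≡ p * (suc w₂ + B (2 + i) κ)
    counted = begin
      p * (suc w₁ * suc w₂)          ≡⟨ identity₃ w₁ w₂ p ⟩
      P i (2 + κ)                    ≡⟨ cell-size i ⟨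
      # (E (n + i))                  ≡⟨ #-cong (E-≡ (sym (shuffle′ κ i))) (E-≡ (shuffle′ κ i)) ⟩
      # (E (κ + suc (2 + i)))        ≡⟨ cell-size′ (2 + i) ⟩
      p + w₂ * p + p * B (2 + i) κ   ≡⟨ identity₄ w₂ p (B (2 + i) κ) ⟩
      p * (suc w₂ + B (2 + i) κ)     ∎
      where
      shuffle′ : ∀ κ i → κ + suc (2 + i) ≡ 3 + κ + i
      shuffle′ = solve-∀
    sized : w₁ * suc w₂ ≡ B (2 + i) κ
    sized = +-cancelˡ-≡ (suc w₂) _ _ (*-cancelˡ-≡ _ _ p ⦃ P≢0 (2 + i) κ ⦄ counted)

  -- Valencies

  degree : V → ℕ
  degree v = # (v ~_)

  degree-opposite : ∀ {x y p z} → Walk x y (2 + κ) p z → degree x ≡ degree z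
  degree-opposite {x} {z = z} w₀ = #-bijection (λ u q → Walk x u (2 + κ) q z)
    (λ xu → let q , w = opposite-nbr refl (rev w₀) xu in q , first~ w , rev w)
    (λ zq → let u , w = opposite-nbr refl w₀ zq in u , first~ w , w)
    (λ w w′ → proj₂ (unique-after w w′ (short ≤-refl ≤-refl)))
    (λ w w′ → proj₂ (unique-after (rev w) (rev w′) (short ≤-refl ≤-refl)))

  -- A walk that leaves `m` through a third neighbour ends at a vertex opposite both `u` and `v`.
  degree-two-apart : ∀ {u m v} → u ~ m → m ~ v → degree u ≡ degree v
  degree-two-apart {u} {m} {v} um mv with third m u v
  ... | t , mt , t≢u , t≢v with prolong (edge mt) (suc κ) z≤n
  ...   | _ , _ , w , _ = trans (degree-opposite (cons um t≢u w)) (sym (degree-opposite (cons (~-sym mv) t≢v w)))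

  σ : ℕ → ℕ
  σ i = w i + w̄ i

  degree-σ : ∀ {j v} → E (suc j) v → degree v ≡ 2 + σ (suc j)
  degree-σ {j} {v} ev = begin
    # (v ~_)                              ≡⟨ #-cong split merge ⟩
    # (λ u → Next (suc j) v u ⊎ Prev j v u) ≡⟨ #-⊎ (λ (_ , e) (_ , e′) → E-turn e′ e) ⟩
    # (Next (suc j) v) + # (Prev j v)     ≡⟨ cong₂ _+_ (W-next ev) (W-prev ev) ⟩
    suc (w (suc j)) + suc (w̄ (suc j))     ≡⟨ cong suc (+-suc (w (suc j)) (w̄ (suc j))) ⟩
    2 + σ (suc j)                         ∎
    where
    open ≡-Reasoning
    split : ∀ {u} → v ~ u → Next (suc j) v u ⊎ Prev j v u
    split vu with E-step vu ev
    ... | inj₁ eu = inj₂ (vu , eu)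
    ... | inj₂ eu = inj₁ (vu , eu)
    merge : ∀ {u} → Next (suc j) v u ⊎ Prev j v u → v ~ u
    merge (inj₁ (vu , _)) = vu
    merge (inj₂ (vu , _)) = vu

  σ-periodic : ∀ j → σ (3 + j) ≡ σ (suc j)
  σ-periodic j =
    let u , vu , eu = forward (centre∈ (suc j))
        t , ut , et = forward eu
    in +-cancelˡ-≡ 2 _ _ (trans (sym (degree-σ et)) (trans (sym (degree-two-apart vu ut)) (degree-σ (centre∈ (suc j)))))

  σ-even : ∀ m → σ (m + m + 2) ≡ σ 2
  σ-even zero    = refl
  σ-even (suc m) = trans (cong (λ t → σ (suc (t + 2))) (+-suc m m)) (trans (cong σ (cong (2 +_) (+-comm (m + m) 2)))
    (trans (σ-periodic (suc (m + m))) (trans (cong σ (+-comm 2 (m + m))) (σ-even m))))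

  #-positive : ∀ {Q : V → Set a} x → Q x → # Q ≢ 0
  #-positive x qx eq = case trans (sym (#-remove x qx)) eq of λ ()

  backward : ∀ {j y} → E (suc j) y → ∃[ z ] Prev j y z
  backward {j} {y} ey with em {∃ (Prev j y)}
  ... | yes found = found
  ... | no  none  = case trans (sym (#-none λ {z} pz → none (z , pz))) (W-prev ey) of λ ()

  σ≢0 : ∀ j → σ (suc j) ≢ 0
  σ≢0 j eq =
    let v = centre (suc j)
        ev = centre∈ (suc j)
        x , vx , ex = forward ev
        y , vy , ey = backward ev
        t , vt , t≢x , t≢y = third v x y
    in case E-step vt ev of λ
      { (inj₁ et) → #-positive t ((vt , et) , t≢y) (trans (w-prev ev (vy , ey)) (m+n≡0⇒n≡0 (w (suc j)) eq))
      ; (inj₂ et) → #-positive t ((vt , et) , t≢x) (trans (w-next ev (vx , ex)) (m+n≡0⇒m≡0 (w (suc j)) eq)) }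

  -- w and w̄ are scaled so that lines and points get the same total M.
  module _ {h} (κ-odd : κ ≡ suc (h + h)) where

    U Ū : ℕ → ℕ
    U m = w (2 + m) * σ (3 + m)
    Ū m = w̄ (2 + m) * σ (3 + m)

    M : ℕ
    M = σ 2 * σ 3

    σσ≡M : ∀ m → σ (2 + m) * σ (3 + m) ≡ M
    σσ≡M zero    = refl
    σσ≡M (suc m) = trans (cong (σ (3 + m) *_) (σ-periodic (suc m))) (trans (*-comm (σ (3 + m)) (σ (2 + m))) (σσ≡M m))

    M≢0 : NonZero M
    M≢0 = m*n≢0 (σ 2) (σ 3) ⦃ ≢-nonZero (σ≢0 1) ⦄ ⦃ ≢-nonZero (σ≢0 2) ⦄

    sum≡M : ∀ m → U m + Ū m ≡ M
    sum≡M m = trans (sym (*-distribʳ-+ (σ (3 + m)) (w (2 + m)) (w̄ (2 + m)))) (σσ≡M m)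

    module D = Descents U Ū M M≢0 sum≡M

    regroup : ∀ a b c d → a * b * (c * d) ≡ a * c * (b * d)
    regroup = solve-∀

    descents≡ : ∀ i l → D.descents i l ≡ desc (2 + i) l * M
    descents≡ i zero    = refl
    descents≡ i (suc l) = trans (cong₂ _+_
      (trans (regroup (w (2 + i)) (σ (3 + i)) (w̄ (3 + i)) (σ (4 + i))) (cong (w (2 + i) * w̄ (3 + i) *_) (σσ≡M (suc i))))
      (descents≡ (suc i) l))
      (sym (*-distribʳ-+ M (w (2 + i) * w̄ (3 + i)) (desc (3 + i) l)))

    N = 2 + κ

    -- Scaling multiplies each product by the values of `σ` one place further on. For consecutive
    -- places these give `M`; for the places 0 and `N` they give `M` as well because `N` is odd.
    tight : D.drop 0 N ≡ D.descents 0 N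
    tight = begin
      w 2 * σ 3 * (w̄ (2 + N) * σ (3 + N))   ≡⟨ regroup (w 2) (σ 3) (w̄ (2 + N)) (σ (3 + N)) ⟩
      w 2 * w̄ (2 + N) * (σ 3 * σ (3 + N))
        ≡⟨ cong₂ (λ s t → w 2 * w̄ s * (σ 3 * σ t)) (+-comm 2 N) (trans (cong (5 +_) κ-odd) (even h)) ⟩
      w 2 * w̄ (N + 2) * (σ 3 * σ (2 + h + (2 + h) + 2))
        ≡⟨ cong₂ _*_ (descents-equation 0) (trans (cong (σ 3 *_) (σ-even (2 + h))) (*-comm (σ 3) (σ 2))) ⟩
      desc 2 N * M                          ≡⟨ descents≡ 0 N ⟨
      D.descents 0 N ∎
      where
      open ≡-Reasoning
      even : ∀ h → 5 + suc (h + h) ≡ 2 + h + (2 + h) + 2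
      even = solve-∀

    open Windows N (s≤s (s≤s z≤n))

    no-slack : ∀ j k → 0 < j → j < k → k ≤ N → D.slack 0 j k ≡ 0
    no-slack (suc a) k _ j<k k≤N with b , refl ← m≤n⇒∃[o]m+o≡n j<k | c , eq ← m≤n⇒∃[o]m+o≡n k≤N =
      subst (λ t → D.slack 0 (suc a) (suc t) ≡ 0) (+-comm b (suc a))
        (D.slack≡0 tight a b c (trans (cong (λ t → suc t + c) (+-comm b (suc a))) eq))

    positive : ∀ m → U m ≢ 0 ⊎ Ū m ≢ 0
    positive m with U m ≟ 0
    ... | no nz = inj₁ nz
    ... | yes z = inj₂ λ z′ → ≢-nonZero⁻¹ M ⦃ M≢0 ⦄ (trans (sym (sum≡M m)) (cong₂ _+_ z z′))

    window∃ : Window U Ū ⊎ Window Ū U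
    window∃ = window U Ū positive
      (λ j k p q r → m+n≡0⇒m≡0 _ (no-slack j k p q r))
      (λ j k p q r → m+n≡0⇒n≡0 (Ū 0 * (U j * Ū k)) (no-slack j k p q r))

    unscale : ∀ x m → x * σ (3 + m) ≡ 0 → x ≡ 0
    unscale x m eq with m*n≡0⇒m≡0∨n≡0 x eq
    ... | inj₁ z = z
    ... | inj₂ z = ⊥-elim (σ≢0 (2 + m) z)

    P≡1 : ∀ i k → (∀ t → t < k → w (t + suc i) ≡ 0) → P i k ≡ 1
    P≡1 i zero    zeros = refl
    P≡1 i (suc k) zeros = cong₂ (λ x y → suc x * y) (zeros 0 (s≤s z≤n))
      (P≡1 (suc i) k λ t t<k → trans (cong w (+-suc t (suc i))) (zeros (suc t) (s≤s t<k)))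

    -- The window may wrap around: w̄ continues w, and w continues w̄.
    zeros-from : (f g : ℕ → ℕ) → (∀ m → g m ≡ f (n + m)) → ∀ k → k ≤ N →
                 (∀ m → k < m → m ≤ N → f m ≡ 0) → (∀ m → m < k → g m ≡ 0) →
                 ∀ t → t < N → f (t + suc k) ≡ 0
    zeros-from f g g≡ k k≤N after before t t<N with t + suc k ≤? N
    ... | yes l = after _ (m≤n+m (suc k) t) l
    ... | no ¬l with m , eq ← m≤n⇒∃[o]m+o≡n (≰⇒> ¬l) = trans (cong f (sym eq)) (trans (sym (g≡ m))
            (before m (+-cancelˡ-≤ N (suc m) k (≤-trans (≤-reflexive (trans (+-suc N m) eq))
              (≤-trans (≤-reflexive (+-suc t k)) (+-monoˡ-≤ k t<N))))))

    -- The product starts right after the mixed place `k`. If it is `w̄` that vanishes there, half a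
    -- turn, by `n`, makes it `w`.
    P≡1∃ : ∃[ i ] P i N ≡ 1
    P≡1∃ with window∃
    ... | inj₂ (k , k≤N , before , after) = 2 + k , P≡1 (2 + k) N λ t t<N →
      trans (cong w (shift₁ t k)) (zeros-from (λ m → w (2 + m)) (λ m → w̄ (2 + m)) (λ m → cong w (shift₂ κ m)) k k≤N
        (λ m k<m m≤N → unscale (w (2 + m)) m (after m k<m m≤N))
        (λ m m<k → unscale (w̄ (2 + m)) m (before m m<k)) t t<N)
      where
      shift₁ : ∀ t k → t + suc (2 + k) ≡ 2 + (t + suc k)
      shift₁ = solve-∀
      shift₂ : ∀ κ m → 3 + κ + (2 + m) ≡ 2 + (3 + κ + m)
      shift₂ = solve-∀
    ... | inj₁ (k , k≤N , before , after) = n + (2 + k) , P≡1 (n + (2 + k)) N λ t t<N →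
      trans (cong w (shift₁ κ t k)) (zeros-from (λ m → w̄ (2 + m)) (λ m → w (2 + m))
        (λ m → trans (sym (w-periodic (2 + m))) (cong w (shift₂ κ m))) k k≤N
        (λ m k<m m≤N → unscale (w̄ (2 + m)) m (after m k<m m≤N))
        (λ m m<k → unscale (w (2 + m)) m (before m m<k)) t t<N)
      where
      shift₁ : ∀ κ t k → t + suc (3 + κ + (2 + k)) ≡ 3 + κ + (2 + (t + suc k))
      shift₁ = solve-∀
      shift₂ : ∀ κ m → 3 + κ + (3 + κ) + (2 + m) ≡ 3 + κ + (2 + (3 + κ + m))
      shift₂ = solve-∀

    singleton-cell : ∃[ i ] (∀ {u v} → E i u → E i v → u ≡ v)
    singleton-cell with P≡1∃
    ... | i , P≡1 = n + i , λ {u} {v} eu ev → only u v eu ev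
      where
      only : ∀ u v → E (n + i) u → E (n + i) v → u ≡ v
      only u v eu ev with u ≟ⱽ v
      ... | yes u≡v = u≡v
      ... | no  u≢v = ⊥-elim (#-positive u (eu , u≢v)
        (suc-injective (trans (sym (#-remove v ev)) (trans (cell-size i) P≡1))))

-- Reading the types off an ordinary n-gon with a single fibre

module _ {p₁ l₁ i₁ p₂ l₂ i₂} {Γ : Geometry p₁ l₁ i₁} {Δ : Geometry p₂ l₂ i₂} (γ : Epimorphism Γ Δ) where
  private
    module Γ = Geometry Γ
    module Δ = Geometry Δ
  open Epimorphism γ

  onElement : Γ.Element → Δ.Element
  onElement (inj₁ x) = inj₁ (onPoint x)
  onElement (inj₂ M) = inj₂ (onLine M)

  onElement-↔ : ∀ {u v} → _↔_ Γ u v → _↔_ Δ (onElement u) (onElement v)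
  onElement-↔ (pl xM) = pl (preserves-I xM)
  onElement-↔ (lp xM) = lp (preserves-I xM)

  onElement-surjective : ∀ y → ∃[ v ] onElement v ≡ y
  onElement-surjective (inj₁ x) = let y , eq = onPoint-surjective x in inj₁ y , cong inj₁ eq
  onElement-surjective (inj₂ M) = let K , eq = onLine-surjective M in inj₂ K , cong inj₂ eq

  -- Δ is the ordinary n-gon with elements e 0, e 1, …, and L is the only
  -- element of Γ over e 0.
  record Picture (n : ℕ) : Set (p₁ ⊔ l₁ ⊔ i₁ ⊔ p₂ ⊔ l₂ ⊔ i₂) where
    field
      e        : ℕ → Δ.Element
      e-step   : ∀ i → _↔_ Δ (e i) (e (suc i))
      e-period : ∀ i → e (n + n + i) ≡ e i
      e-differ : ∀ i d → suc d < n + n → e (suc d + i) ≢ e i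
      e-all    : ∀ s x → ∃[ i ] i < n + n × e (s + i) ≡ x
      e-nbr    : ∀ {x i} → _↔_ Δ (e (suc i)) x → x ≡ e i ⊎ x ≡ e (2 + i)
      prev     : ∀ {v i} → onElement v ≡ e (suc i) → ∃[ u ] _↔_ Γ v u × onElement u ≡ e i
      succ     : ∀ {v i} → onElement v ≡ e i → ∃[ u ] _↔_ Γ v u × onElement u ≡ e (suc i)
      L        : Γ.Element
      L-over   : onElement L ≡ e 0
      L-only   : ∀ {v} → onElement v ≡ e 0 → v ≡ L

swapᴱ : ∀ {p l i} {G : Geometry p l i} → Geometry.Element G → Geometry.Element (dual G)
swapᴱ (inj₁ x) = inj₂ x
swapᴱ (inj₂ M) = inj₁ M

swap-↔ : ∀ {p l i} {G : Geometry p l i} {u v} → _↔_ G u v → _↔_ (dual G) (swapᴱ {G = G} u) (swapᴱ {G = G} v)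
swap-↔ (pl xM) = lp xM
swap-↔ (lp xM) = pl xM

swap-swap : ∀ {p l i} (G : Geometry p l i) u → swapᴱ {G = dual G} (swapᴱ {G = G} u) ≡ u
swap-swap G (inj₁ _) = refl
swap-swap G (inj₂ _) = refl

swap-injective : ∀ {p l i} (G : Geometry p l i) {u v} → swapᴱ {G = G} u ≡ swapᴱ {G = G} v → u ≡ v
swap-injective G {u} {v} eq = trans (sym (swap-swap G u)) (trans (cong (swapᴱ {G = dual G}) eq) (swap-swap G v))

swap-move : ∀ {p l i} (G : Geometry p l i) {u v} → u ≡ swapᴱ {G = G} v → swapᴱ {G = dual G} u ≡ v
swap-move G {v = v} refl = swap-swap G v

module _ {p₁ l₁ i₁ p₂ l₂ i₂} {Γ : Geometry p₁ l₁ i₁} {Δ : Geometry p₂ l₂ i₂} where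

  -- Turns a point `L` into a line, so that only lines have to be treated below.
  dual-picture : {γ : Epimorphism Γ Δ} → ∀ {n} → Picture γ n → Picture (dualEpi γ) n
  dual-picture {γ} {n} pic = record
    { e        = swap ∘ e
    ; e-step   = swap-↔ ∘ e-step
    ; e-period = cong swap ∘ e-period
    ; e-differ = λ i d l → e-differ i d l ∘ swap-injective Δ
    ; e-all    = λ s x → let i , l , eq = e-all s (swap⁻ x) in
                 i , l , trans (cong swap eq) (swap-swap (dual Δ) x)
    ; e-nbr    = λ {x} {i} ex → case e-nbr (subst (λ t → _↔_ Δ t (swap⁻ x)) (swap-swap Δ (e (suc i))) (swap-↔ ex)) of λ
                 { (inj₁ eq) → inj₁ (trans (sym (swap-swap (dual Δ) x)) (cong swap eq))
                 ; (inj₂ eq) → inj₂ (trans (sym (swap-swap (dual Δ) x)) (cong swap eq)) }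
    ; prev     = λ {v} eq → let u , vu , eq′ = prev (trans (sym (over⁻ v)) (swap-move Δ eq)) in
                 swapΓ u , subst (λ t → _↔_ (dual Γ) t (swapΓ u)) (swap-swap (dual Γ) v) (swap-↔ vu) ,
                 trans (over u) (cong swap eq′)
    ; succ     = λ {v} eq → let u , vu , eq′ = succ (trans (sym (over⁻ v)) (swap-move Δ eq)) in
                 swapΓ u , subst (λ t → _↔_ (dual Γ) t (swapΓ u)) (swap-swap (dual Γ) v) (swap-↔ vu) ,
                 trans (over u) (cong swap eq′)
    ; L        = swapΓ L
    ; L-over   = trans (over L) (cong swap L-over)
    ; L-only   = λ {v} eq → trans (sym (swap-swap (dual Γ) v))
                 (cong swapΓ (L-only (trans (sym (over⁻ v)) (swap-move Δ eq))))
    }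
    where
    open Picture pic
    swap = swapᴱ {G = Δ}
    swap⁻ = swapᴱ {G = dual Δ}
    swapΓ = swapᴱ {G = Γ}
    swapΓ⁻ = swapᴱ {G = dual Γ}
    over : ∀ u → onElement (dualEpi γ) (swapΓ u) ≡ swap (onElement γ u)
    over (inj₁ _) = refl
    over (inj₂ _) = refl
    over⁻ : ∀ v → swap⁻ (onElement (dualEpi γ) v) ≡ onElement γ (swapΓ⁻ v)
    over⁻ (inj₁ _) = refl
    over⁻ (inj₂ _) = refl

module PictureFacts {p₁ l₁ i₁ p₂ l₂ i₂} {Γ : Geometry p₁ l₁ i₁} {Δ : Geometry p₂ l₂ i₂} {γ : Epimorphism Γ Δ}
                    (_≟P_ : DecidableEquality (Geometry.Point Δ)) (_≟L_ : DecidableEquality (Geometry.Line Δ))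
                    {n} (pic : Picture γ n) {K : Geometry.Line Γ} (L≡K : Picture.L pic ≡ inj₂ K) where
  open Geometry Γ
  open Epimorphism γ
  open Picture pic
  open Incidence Δ _≟P_ _≟L_ using (graph; module FromClosed)
  open Graph graph using (kind; kind-~)

  Over : ℕ → Element → Set _
  Over i v = onElement γ v ≡ e i

  over-step : ∀ {i u v} → _↔_ Γ u v → Over (suc i) u → Over i v ⊎ Over (2 + i) v
  over-step uv eq = e-nbr (subst (λ t → _↔_ Δ t _) eq (onElement-↔ γ uv))

  differ : ∀ {i v} d → {_ : True (suc d <? n + n)} → Over i v → Over (suc d + i) v → ⊥
  differ {i} d {l} eq eq′ = e-differ i d (toWitness l) (trans (sym eq′) eq)

  K-only : ∀ {M} → Over (n + n) (inj₂ M) → M ≡ K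
  K-only eq = inj₂-injective (trans (L-only (trans eq (trans (cong e (sym (+-identityʳ (n + n)))) (e-period 0)))) L≡K)

  K-over : Over (n + n) (inj₂ K)
  K-over = trans (trans (cong (onElement γ) (sym L≡K)) L-over)
    (sym (trans (cong e (sym (+-identityʳ (n + n)))) (e-period 0)))

  line₀ : kind (e 0) ≡ false
  line₀ = cong kind (sym (trans (cong (onElement γ) (sym L≡K)) L-over))

  kind-parity : ∀ m → kind (e (suc (m + m))) ≡ true
  kind-parity zero    = trans (kind-~ (e-step 0)) (cong not line₀)
  kind-parity (suc m) rewrite +-suc m m = trans (kind-~ (e-step _)) (trans (cong not (kind-~ (e-step _)))
    (cong (not ∘ not) (kind-parity m)))

  -- `e 0` is a line, so the points sit at odd positions and the naming has to start at one of
  -- these.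
  module Named (m : ℕ) where
    s : ℕ
    s = suc (m + m)

    shift-closed : e (s + (n + n)) ≡ e (s + 0)
    shift-closed = trans (cong e (+-comm s (n + n))) (trans (e-period s) (cong e (sym (+-identityʳ s))))

    shift-differ : ∀ {i j} → i < j → j < n + n → e (s + i) ≢ e (s + j)
    shift-differ {i} {j} i<j j< eq with d , refl ← m≤n⇒∃[o]m+o≡n i<j =
      e-differ (s + i) d (≤-<-trans (s≤s (m≤n+m d i)) j<) (trans (cong e (shuffle s i d)) (sym eq))
      where
      shuffle : ∀ s i d → suc d + (s + i) ≡ s + (suc i + d)
      shuffle s i d = trans (+-comm (suc d) (s + i)) (trans (+-assoc s i (suc d)) (cong (s +_) (+-suc i d)))

    open FromClosed n (λ i → e (s + i)) (λ {i} _ → subst (λ t → _↔_ Δ (e (s + i)) (e t)) (sym (+-suc s i)) (e-step (s + i)))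
      shift-closed shift-differ (trans (cong (kind ∘ e) (+-identityʳ s)) (kind-parity m)) public

    names : Naming n Δ
    names = record
      { polygon    = polygon
      ; all-points = λ x → let i , l , eq = e-all s (inj₁ x) in lower (contains i l eq)
      }

    open Naming names public using (vertex; side)

    at-vertex : ∀ j {x} → onPoint x ≡ vertex j → Over (s + (toℕ j + toℕ j)) (inj₁ x)
    at-vertex j eq = trans (cong inj₁ eq) (proj₂ (vertex∃ j))

    vertex-at : ∀ j {x} → Over (s + (toℕ j + toℕ j)) (inj₁ x) → onPoint x ≡ vertex j
    vertex-at j eq = inj₁-injective (trans eq (sym (proj₂ (vertex∃ j))))

    at-side : ∀ j {M} → onLine M ≡ side j → Over (s + suc (toℕ j + toℕ j)) (inj₂ M)
    at-side j eq = trans (cong inj₂ eq) (proj₂ (side∃ j))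

    side-at : ∀ j {M} → Over (s + suc (toℕ j + toℕ j)) (inj₂ M) → onLine M ≡ side j
    side-at j eq = inj₂-injective (trans eq (sym (proj₂ (side∃ j))))

  line-prev : ∀ {x i} → Over (suc i) (inj₁ x) → ∃[ M ] x I M × Over i (inj₂ M)
  line-prev eq with prev eq
  ... | inj₂ M , pl xM , over = M , xM , over

  line-succ : ∀ {x i} → Over i (inj₁ x) → ∃[ M ] x I M × Over (suc i) (inj₂ M)
  line-succ eq with succ eq
  ... | inj₂ M , pl xM , over = M , xM , over

  point-prev : ∀ {M i} → Over (suc i) (inj₂ M) → ∃[ x ] x I M × Over i (inj₁ x)
  point-prev eq with prev eq
  ... | inj₁ x , lp xM , over = x , xM , over

  point-succ : ∀ {M i} → Over i (inj₂ M) → ∃[ x ] x I M × Over (suc i) (inj₁ x)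
  point-succ eq with succ eq
  ... | inj₁ x , lp xM , over = x , xM , over

  -- K is placed at position n + n, so that there are cells before it.
  2n = n + n

  before-K : ∀ {x i} → suc i ≡ 2n → Over i (inj₁ x) → x I K
  before-K 1+i≡ eq = let M , xM , over = line-succ eq in
    subst (_ I_) (K-only (subst (λ t → Over t (inj₂ M)) 1+i≡ over)) xM

  after-K : ∀ {x} → Over (suc 2n) (inj₁ x) → x I K
  after-K eq = let M , xM , over = line-prev eq in subst (_ I_) (K-only over) xM

module _ {p₁ l₁ i₁ p₂ l₂ i₂} {Γ : Geometry p₁ l₁ i₁} {Δ : Geometry p₂ l₂ i₂} {γ : Epimorphism Γ Δ}
         (_≟P_ : DecidableEquality (Geometry.Point Δ)) (_≟L_ : DecidableEquality (Geometry.Line Δ))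
         {K : Geometry.Line Γ} where
  open Geometry Γ
  open Epimorphism γ

  typeA₄ : (pic : Picture γ 4) → Picture.L pic ≡ inj₂ K → TypeA γ 4
  typeA₄ pic L≡K = quadrangle names K record
    { partition = record
      { covers    = (λ xK → case over-step (lp xK) K-over of λ
                      { (inj₁ a) → inj₁ (vertex-at 0F a) ; (inj₂ b) → inj₂ (vertex-at 1F b) })
                  , (λ { (inj₁ a) → before-K refl (at-vertex 0F a) ; (inj₂ b) → after-K (at-vertex 1F b) })
      ; disjoint  = λ (a , b) → differ 1 (at-vertex 0F a) (at-vertex 1F b)
      ; nonempty₁ = onPoint-surjective (vertex 0F)
      ; nonempty₂ = onPoint-surjective (vertex 1F)
      }
    ; C̃-points = (λ c → off-K (at-vertex 2F c) ,
                        let M , xM , bc = line-prev (at-vertex 2F c)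
                            y , yM , b  = point-prev bc
                        in y , vertex-at 1F b , M , xM , yM)
               , (λ { (¬xK , y , b , M , xM , yM) → case over-step (pl yM) (at-vertex 1F b) of λ
                   { (inj₁ ab) → ⊥-elim (¬xK (subst (_ I_) (K-only ab) xM))
                   ; (inj₂ bc) → case over-step (lp xM) bc of λ
                     { (inj₁ b′) → ⊥-elim (¬xK (after-K b′)) ; (inj₂ c) → vertex-at 2F c } } })
    ; D̃-points = (λ d → off-K′ (at-vertex 3F d) ,
                        let M , xM , da = line-succ (at-vertex 3F d)
                            y , yM , a  = point-succ da
                        in y , vertex-at 0F (down a) , M , xM , yM)
               -- One turn later `a` has position 15, next to `da` at 14.
               , (λ { (¬xK , y , a , M , xM , yM) → case over-step (pl yM) (up (at-vertex 0F a)) of λ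
                   { (inj₂ ab) → ⊥-elim (¬xK (subst (_ I_) (K-only (down ab)) xM))
                   ; (inj₁ da) → case over-step (lp xM) da of λ
                     { (inj₂ a′) → ⊥-elim (¬xK (before-K refl (down a′))) ; (inj₁ d) → vertex-at 3F d } } })
    ; ab-lines = (λ ab → sym (K-only (at-side 0F ab))) , (λ { refl → side-at 0F K-over })
    ; bc-lines = (λ bc → let y , yM , b = point-prev (at-side 1F bc)
                         in (y , vertex-at 1F b , yM) , λ { refl → differ 1 K-over (at-side 1F bc) })
               , (λ { ((y , b , yM) , M≢K) → case over-step (pl yM) (at-vertex 1F b) of λ
                   { (inj₁ ab) → ⊥-elim (M≢K (sym (K-only ab))) ; (inj₂ bc) → side-at 1F bc } })
    ; da-lines = (λ da → let y , yM , a = point-succ (at-side 3F da)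
                         in (y , vertex-at 0F (down a) , yM) , λ { refl → differ 5 K-over (at-side 3F da) })
               , (λ { ((y , a , yM) , M≢K) → case over-step (pl yM) (up (at-vertex 0F a)) of λ
                   { (inj₂ ab) → ⊥-elim (M≢K (sym (K-only (down ab)))) ; (inj₁ da) → side-at 3F da } })
    ; cd-lines = (λ cd → let x , xM , c = point-prev (at-side 2F cd)
                             y , yM , d = point-succ (at-side 2F cd)
                         in (x , vertex-at 2F c , xM) , (y , vertex-at 3F d , yM))
               , (λ { ((x , c , xM) , (y , d , yM)) → case over-step (pl xM) (at-vertex 2F c) of λ
                   { (inj₂ cd) → side-at 2F cd
                   -- Unless it is over `cd`, the line would be over both `bc` and `da`.
                   ; (inj₁ bc) → case over-step (pl yM) (at-vertex 3F d) of λ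
                     { (inj₁ cd) → side-at 2F cd ; (inj₂ da) → ⊥-elim (differ 3 bc da) } } })
    }
    where
    open PictureFacts _≟P_ _≟L_ pic L≡K
    -- Vertex 0 is at position 7, so side 0, which is `ab`, is at 8 = `n + n`, the position of `K`.
    open Named 3
    up : ∀ {i v} → Over i v → Over (8 + i) v
    up {i} eq = trans eq (sym (Picture.e-period pic i))
    down : ∀ {i v} → Over (8 + i) v → Over i v
    down {i} eq = trans eq (Picture.e-period pic i)
    off-K : ∀ {x} → Over 11 (inj₁ x) → ¬ x I K
    off-K c xK = case over-step (lp xK) K-over of λ
      { (inj₁ a) → differ 3 a c ; (inj₂ b) → differ 1 b c }
    off-K′ : ∀ {x} → Over 13 (inj₁ x) → ¬ x I K
    off-K′ d xK = case over-step (lp xK) K-over of λ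
      { (inj₁ a) → differ 5 a d ; (inj₂ b) → differ 3 b d }

  typeA₆ : (pic : Picture γ 6) → Picture.L pic ≡ inj₂ K → TypeA γ 6
  typeA₆ pic L≡K = hexagon names K record
    { partition = record
      { covers    = (λ xK → case over-step (lp xK) K-over of λ
                      { (inj₁ b) → inj₂ (vertex-at 1F b) ; (inj₂ c) → inj₁ (vertex-at 2F c) })
                  , (λ { (inj₁ c) → after-K (at-vertex 2F c) ; (inj₂ b) → before-K refl (at-vertex 1F b) })
      ; disjoint  = λ (c , b) → differ 1 (at-vertex 1F b) (at-vertex 2F c)
      ; nonempty₁ = onPoint-surjective (vertex 2F)
      ; nonempty₂ = onPoint-surjective (vertex 1F)
      }
    ; D̃-points = (λ d → off-K (at-vertex 3F d) ,
                        let M , xM , cd = line-prev (at-vertex 3F d)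
                            y , yM , c  = point-prev cd
                        in y , vertex-at 2F c , M , xM , yM)
               , (λ { (¬xK , y , c , M , xM , yM) → case over-step (pl yM) (at-vertex 2F c) of λ
                   { (inj₁ bc) → ⊥-elim (¬xK (subst (_ I_) (K-only bc) xM))
                   ; (inj₂ cd) → case over-step (lp xM) cd of λ
                     { (inj₁ c′) → ⊥-elim (¬xK (after-K c′)) ; (inj₂ d) → vertex-at 3F d } } })
    ; Ã-points = (λ a → off-K′ (at-vertex 0F a) ,
                        let M , xM , ab = line-succ (at-vertex 0F a)
                            y , yM , b  = point-succ ab
                        in y , vertex-at 1F b , M , xM , yM)
               , (λ { (¬xK , y , b , M , xM , yM) → case over-step (pl yM) (at-vertex 1F b) of λ
                   { (inj₂ bc) → ⊥-elim (¬xK (subst (_ I_) (K-only bc) xM))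
                   ; (inj₁ ab) → case over-step (lp xM) ab of λ
                     { (inj₂ b′) → ⊥-elim (¬xK (before-K refl b′)) ; (inj₁ a) → vertex-at 0F a } } })
    ; Ẽ-points = (λ e → (let M , xM , de = line-prev (at-vertex 4F e)
                             y , yM , d  = point-prev de
                         in y , vertex-at 3F d , M , xM , yM) ,
                        λ { (inj₁ c) → differ 3 (at-vertex 2F c) (at-vertex 4F e)
                          ; (inj₂ d) → differ 1 (at-vertex 3F d) (at-vertex 4F e) })
               , (λ { ((y , d , M , xM , yM) , ∉C∪D) → case over-step (pl yM) (at-vertex 3F d) of λ
                   { (inj₁ cd) → ⊥-elim (∉C∪D (case over-step (lp xM) cd of λ
                     { (inj₁ c) → inj₁ (vertex-at 2F c) ; (inj₂ d′) → inj₂ (vertex-at 3F d′) }))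
                   ; (inj₂ de) → case over-step (lp xM) de of λ
                     { (inj₁ d′) → ⊥-elim (∉C∪D (inj₂ (vertex-at 3F d′))) ; (inj₂ e) → vertex-at 4F e } } })
    ; F̃-points = (λ f → (let M , xM , fa = line-succ (at-vertex 5F f)
                              y , yM , a  = point-succ fa
                         in y , vertex-at 0F (down a) , M , xM , yM) ,
                        λ { (inj₁ a) → differ 9 (at-vertex 0F a) (at-vertex 5F f)
                          ; (inj₂ b) → differ 7 (at-vertex 1F b) (at-vertex 5F f) })
               , (λ { ((y , a , M , xM , yM) , ∉A∪B) → case over-step (pl yM) (up (at-vertex 0F a)) of λ
                   { (inj₂ ab) → ⊥-elim (∉A∪B (case over-step (lp xM) ab of λ
                     { (inj₁ a′) → inj₁ (vertex-at 0F (down a′)) ; (inj₂ b) → inj₂ (vertex-at 1F (down b)) }))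
                   ; (inj₁ fa) → case over-step (lp xM) fa of λ
                     { (inj₂ a′) → ⊥-elim (∉A∪B (inj₁ (vertex-at 0F (down a′)))) ; (inj₁ f) → vertex-at 5F f } } })
    ; bc-lines = (λ bc → sym (K-only (at-side 1F bc))) , (λ { refl → side-at 1F K-over })
    ; cd-lines = (λ cd → let y , yM , c = point-prev (at-side 2F cd)
                         in (y , vertex-at 2F c , yM) , λ { refl → differ 1 K-over (at-side 2F cd) })
               , (λ { ((y , c , yM) , M≢K) → case over-step (pl yM) (at-vertex 2F c) of λ
                   { (inj₁ bc) → ⊥-elim (M≢K (sym (K-only bc))) ; (inj₂ cd) → side-at 2F cd } })
    ; ab-lines = (λ ab → let y , yM , b = point-succ (at-side 0F ab)
                         in (y , vertex-at 1F b , yM) , λ { refl → differ 1 (at-side 0F ab) K-over })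
               , (λ { ((y , b , yM) , M≢K) → case over-step (pl yM) (at-vertex 1F b) of λ
                   { (inj₂ bc) → ⊥-elim (M≢K (sym (K-only bc))) ; (inj₁ ab) → side-at 0F ab } })
    ; de-lines = (λ de → let y , yM , d = point-prev (at-side 3F de)
                         in (y , vertex-at 3F d , yM) , λ cd → differ 1 (at-side 2F cd) (at-side 3F de))
               , (λ { ((y , d , yM) , ∉cd) → case over-step (pl yM) (at-vertex 3F d) of λ
                   { (inj₁ cd) → ⊥-elim (∉cd (side-at 2F cd)) ; (inj₂ de) → side-at 3F de } })
    ; fa-lines = (λ fa → let y , yM , a = point-succ (at-side 5F fa)
                         in (y , vertex-at 0F (down a) , yM) , λ ab → differ 9 (at-side 0F ab) (at-side 5F fa))
               , (λ { ((y , a , yM) , ∉ab) → case over-step (pl yM) (up (at-vertex 0F a)) of λ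
                   { (inj₂ ab) → ⊥-elim (∉ab (side-at 0F (down ab))) ; (inj₁ fa) → side-at 5F fa } })
    ; ef-lines = (λ ef → let y , yM , f = point-succ (at-side 4F ef)
                         in (y , vertex-at 5F f , yM) , λ fa → differ 1 (at-side 4F ef) (at-side 5F fa))
               , (λ { ((y , f , yM) , ∉fa) → case over-step (pl yM) (at-vertex 5F f) of λ
                   { (inj₂ fa) → ⊥-elim (∉fa (side-at 5F fa)) ; (inj₁ ef) → side-at 4F ef } })
    }
    where
    open PictureFacts _≟P_ _≟L_ pic L≡K
    -- Vertex 0 is at position 9, so side 1, which is `bc`, is at 12 = `n + n`, the position of `K`.
    open Named 4
    up : ∀ {i v} → Over i v → Over (12 + i) v
    up {i} eq = trans eq (sym (Picture.e-period pic i))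
    down : ∀ {i v} → Over (12 + i) v → Over i v
    down {i} eq = trans eq (Picture.e-period pic i)
    off-K : ∀ {x} → Over 15 (inj₁ x) → ¬ x I K
    off-K c xK = case over-step (lp xK) K-over of λ
      { (inj₁ a) → differ 3 a c ; (inj₂ b) → differ 1 b c }
    off-K′ : ∀ {x} → Over 9 (inj₁ x) → ¬ x I K
    off-K′ a xK = case over-step (lp xK) K-over of λ
      { (inj₁ b) → differ 1 a b ; (inj₂ c) → differ 3 a c }

-- Finite subsets from lists

module _ {a} {A : Set a} (_≟_ : DecidableEquality A) where
  open import Data.List.Membership.DecPropositional _≟_ using (_∈?_)

  finite-list : (xs : List A) → Finite (_∈ xs)
  finite-list [] = 0 , (λ ()) , (λ { {()} }) , (λ ()) , λ { (() , _) }
  finite-list (x ∷ xs) with x ∈? xs | finite-list xs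
  ... | yes x∈xs | k , f , f-inj , to , from =
    k , f , f-inj , (λ { (here refl) → to x∈xs ; (there y∈) → to y∈ }) , (there ∘ from)
  ... | no  x∉xs | k , f , f-inj , to , from =
    suc k , g , g-inj , to′ , λ { (zero , refl) → here refl ; (suc j , eq) → there (from (j , eq)) }
    where
    g : Fin (suc k) → A
    g zero    = x
    g (suc j) = f j
    g-inj : Injective _≡_ _≡_ g
    g-inj {zero}  {zero}  _  = refl
    g-inj {zero}  {suc j} eq = ⊥-elim (x∉xs (from (j , sym eq)))
    g-inj {suc j} {zero}  eq = ⊥-elim (x∉xs (from (j , eq)))
    g-inj {suc i} {suc j} eq = cong suc (f-inj eq)
    to′ : ∀ {y} → y ∈ x ∷ xs → ∃[ j ] g j ≡ y
    to′ (here refl) = zero , refl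
    to′ (there y∈)  = let j , eq = to y∈ in suc j , eq

  finite-subset : ∀ {ℓ} {P : Pred A ℓ} → Decidable P → (xs : List A) → (∀ {x} → P x → x ∈ xs) → Finite P
  finite-subset P? xs P⊆xs =
    let k , f , f-inj , to , from = finite-list (filter P? xs)
    in k , f , f-inj , (λ px → to (∈-filter⁺ P? (P⊆xs px) px)) , λ e → proj₂ (∈-filter⁻ P? {xs = xs} (from e))

-- A fibre with one element

module SingleFibre {ℓ} (em : ExcludedMiddle (lsuc ℓ)) {κ h : ℕ} (κ-odd : κ ≡ suc (h + h))
                   (Γ : Geometry ℓ ℓ ℓ) (weakΓ : IsWeakPolygon (3 + κ) Γ) (thickΓ : IsThick Γ)
                   (lfg : LocallyFinitelyGenerated Γ (3 + κ))
                   (Δ : Geometry ℓ ℓ ℓ) (weakΔ : IsWeakPolygon (3 + κ) Δ)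
                   (γ : Epimorphism Γ Δ) where

  em₀ : ExcludedMiddle ℓ
  em₀ = lower-em em

  dec : {A : Set ℓ} → DecidableEquality A
  dec x y = em₀

  n L : ℕ
  n = 3 + κ
  L = n + n

  graphΓ graphΔ : Graph ℓ ℓ
  graphΓ = Incidence.graph Γ dec dec
  graphΔ = Incidence.graph Δ dec dec

  polyΓ : IsPolygonal n graphΓ
  polyΓ = Incidence.FromWeak.polygonal Γ dec dec weakΓ

  polyΔ : IsPolygonal n graphΔ
  polyΔ = Incidence.FromWeak.polygonal Δ dec dec weakΔ

  module Γ where
    open Geometry Γ public
    open Graph graphΓ public hiding (V)
    open IsPolygonal polyΓ public

  module Δ where
    open Geometry Δ public
    open Graph graphΔ public hiding (V)
    open IsPolygonal polyΔ public

  g : Γ.Element → Δ.Element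
  g = onElement γ

  homγ : Hom graphΓ graphΔ
  homγ = record
    { map      = g
    ; map-~    = onElement-↔ γ
    ; map-kind = λ { (inj₁ _) → refl ; (inj₂ _) → refl }
    }

  valency≥3 : ∀ v → AtLeast 3 (v Γ.~_)
  valency≥3 (inj₁ x) = let f , f-inj , f∈ = proj₁ thickΓ x in inj₂ ∘ f , f-inj ∘ inj₂-injective , pl ∘ f∈
  valency≥3 (inj₂ M) = let f , f-inj , f∈ = proj₂ thickΓ M in inj₁ ∘ f , f-inj ∘ inj₁-injective , lp ∘ f∈

  thirdΓ : ∀ m u v → ∃[ t ] m Γ.~ t × t ≢ u × t ≢ v
  thirdΓ m u v = let f , f-inj , f~ = valency≥3 m
                     j , ≢u , ≢v = avoid dec f f-inj u v in f j , f~ j , ≢u , ≢v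

  module Cells (C : Δ.Cycle L) where
    open Apartment polyΔ C

    InCell : ℕ → Γ.Element → Set ℓ
    InCell i v = fold (g v) ≡ vtx i

    over-cell : ∀ i → ∃[ v ] g v ≡ vtx i
    over-cell i = onElement-surjective γ (vtx i)

    module Generated (two : ∀ i → ∃[ u ] ∃[ v ] InCell i u × InCell i v × u ≢ v) where

      CΓ : Γ.Cycle L
      CΓ = Incidence.FromWeak.some-cycle Γ dec dec weakΓ

      module AΓ = Apartment polyΓ CΓ

      neighbours : Γ.Element → List Γ.Element
      neighbours v = tabulate (proj₁ (valency≥3 v))

      -- The first two entries keep the cell from shrinking to one element; the neighbours make the
      -- hull a thick n-gon.
      seeds : ℕ → List Γ.Element
      seeds i = proj₁ (two i) ∷ proj₁ (proj₂ (two i)) ∷ neighbours (AΓ.vtx i)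

      -- A line is represented among the generators by two of its points, which bring it back into
      -- the hull.
      points-of : Γ.Element → List Γ.Point
      points-of (inj₁ x) = x ∷ []
      points-of (inj₂ M) = let f , _ = proj₂ thickΓ M in f 0F ∷ f 1F ∷ []

      generators : List Γ.Point
      generators = concat (mapᴸ points-of (concat (mapᴸ seeds (upTo L))))

      open Hull em Γ dec dec polyΓ (_∈ generators)

      points-generate : ∀ {x v} → x ∈ points-of v → v ∈ concat (mapᴸ seeds (upTo L)) → x ∈ generators
      points-generate x∈ v∈ = ∈-concat⁺′ x∈ (∈-map⁺ points-of v∈)

      seed-member : ∀ v → v ∈ concat (mapᴸ seeds (upTo L)) → Member v
      seed-member (inj₁ x) v∈ = generators-in (points-generate (here refl) v∈)
      seed-member (inj₂ M) v∈ = let f , f-inj , f∈ = proj₂ thickΓ M in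
        joins-in (points-generate {f 0F} {inj₂ M} (here refl) v∈)
          (points-generate {f 1F} {inj₂ M} (there (here refl)) v∈)
          (λ eq → case f-inj eq of λ ()) (f∈ 0F) (f∈ 1F)

      seeded : ∀ {i v} → i < L → v ∈ seeds i → Member v
      seeded {v = v} i<L v∈ = seed-member v (∈-concat⁺′ v∈ (∈-map⁺ seeds (∈-upTo⁺ i<L)))

      thick-cycle : ∀ j → AtLeast 3 (λ v → AΓ.vtx j Γ.~ v × Member v)
      thick-cycle j with AΓ.representative j
      ... | r , r<L , same =
        let f , f-inj , f~ = valency≥3 (AΓ.vtx r)
        in f , f-inj , λ t → subst (Γ._~ f t) (sym (same 0)) (f~ t) ,
                            seeded r<L (there (there (∈-tabulate⁺ {f = f} t)))

      polyS : IsPolygonal n Sub.graph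
      polyS = sub-polygonal polyΓ (hull-closed) CΓ thick-cycle

      thirdS : ∀ m u v → ∃[ t ] Graph._~_ Sub.graph m t × t ≢ u × t ≢ v
      thirdS m u v = let f , f-inj , f~ = sub-thick polyΓ hull-closed CΓ thick-cycle m
                         j , ≢u , ≢v = avoid (Graph._≟ⱽ_ Sub.graph) f f-inj u v
                     in f j , f~ j , ≢u , ≢v

      cell-members : ∀ i → ∃[ u ] ∃[ v ] InCell i (ι u) × InCell i (ι v) × u ≢ v
      cell-members i =
        let r , r<L , same        = representative i
            u , v , eu , ev , u≢v = two r
            u′ , u≡ = ι⁻¹ u (seeded {r} r<L (here refl))
            v′ , v≡ = ι⁻¹ v (seeded {r} r<L (there (here refl)))
        in u′ , v′ , trans (cong (λ t → fold (g t)) u≡) (trans eu (sym (same 0))) ,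
                     trans (cong (λ t → fold (g t)) v≡) (trans ev (sym (same 0))) ,
           λ eq → u≢v (trans (sym u≡) (trans (cong ι eq) v≡))

      hull-weak : IsSubPolygon Γ n (⟨_⟩ₚ Γ n (_∈ generators)) (⟨_⟩ₗ Γ n (_∈ generators))
      hull-weak = Sub.ToWeak.weak polyS (proj₁ (cell-members 0))

      hull-finite : Finite (⟨_⟩ₚ Γ n (_∈ generators)) × Finite (⟨_⟩ₗ Γ n (_∈ generators))
      hull-finite = lfg (_∈ generators) (finite-list dec generators) hull-weak

      enumerate : ∀ {A : Set ℓ} {P : Pred A (lsuc ℓ)} → Finite P →
                  Σ[ xs ∈ List (Refinement A P) ] Unique xs × (∀ x → x ∈ xs)
      enumerate {A} {P} (k , f , f-inj , to , from) = tabulate f′ ,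
        Unique.tabulate⁺ (λ eq → f-inj (cong value eq)) , complete
        where
        f′ : Fin k → (Refinement A P)
        f′ j = f j ,ʳ [ from (j , refl) ]
        complete : ∀ x → x ∈ tabulate f′
        complete (x ,ʳ [ px ]) with to (recompute em px)
        ... | j , eq = subst (_∈ tabulate f′) (value-injective eq) (∈-tabulate⁺ {f = f′} j)

      vertices : Σ[ vs ∈ List (Graph.V Sub.graph) ] Unique vs × (∀ v → v ∈ vs)
      vertices =
        let finite-points , finite-lines = hull-finite
            ps , ps-unique , ps-complete = enumerate finite-points
            ls , ls-unique , ls-complete = enumerate finite-lines
        in mapᴸ inj₁ ps ++ mapᴸ inj₂ ls ,
           Unique.++⁺ (Unique.map⁺ inj₁-injective ps-unique) (Unique.map⁺ inj₂-injective ls-unique)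
             (λ (v∈ , v∈′) → case trans (sym (proj₂ (proj₂ (∈-map⁻ inj₁ v∈)))) (proj₂ (proj₂ (∈-map⁻ inj₂ v∈′))) of λ ()) ,
           λ { (inj₁ x) → ∈-++⁺ˡ (∈-map⁺ inj₁ (ps-complete x))
             ; (inj₂ M) → ∈-++⁺ʳ (mapᴸ inj₁ ps) (∈-map⁺ inj₂ (ls-complete M)) }

      homS : Hom Sub.graph graphΔ
      homS = record
        { map      = λ v → fold (g (ι v))
        ; map-~    = λ uv → fold-~ (onElement-↔ γ (ι-~ uv))
        ; map-kind = λ { v@(inj₁ _) → fold-kind (g (ι v)) ; v@(inj₂ _) → fold-kind (g (ι v)) }
        }

      cell-step : ∀ {i u v} → Graph._~_ Sub.graph u v → Lift (lsuc ℓ) (InCell (suc i) (ι u)) →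
                  Lift (lsuc ℓ) (InCell i (ι v)) ⊎ Lift (lsuc ℓ) (InCell (suc (suc i)) (ι v))
      cell-step uv (lift eu) with fold-nbr (onElement-↔ γ (ι-~ uv)) eu
      ... | inj₁ ev = inj₁ (lift ev)
      ... | inj₂ ev = inj₂ (lift ev)

      -- The elements of the hull live one level higher, so the cells are lifted to where they can
      -- be counted.
      module F = Finite em polyS polyΔ homS C (proj₁ vertices) (proj₁ (proj₂ vertices)) (proj₂ (proj₂ vertices))
                        thirdS (λ i v → Lift (lsuc ℓ) (InCell i (ι v))) lower lift cell-step
                        (λ i → proj₁ (cell-members i) , lift (proj₁ (proj₂ (proj₂ (cell-members i)))))

      impossible : ⊥
      impossible =
        let i , single = F.singleton-cell {h} κ-odd
            u , v , eu , ev , u≢v = cell-members i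
        in u≢v (single (lift eu) (lift ev))

    Single : ℕ → Set ℓ
    Single i = ∀ {u v} → InCell i u → InCell i v → u ≡ v

    single-cell : ∃[ i ] Single i
    single-cell with em₀ {∃[ i ] Single i}
    ... | yes found = found
    ... | no  none  = ⊥-elim (Generated.impossible λ i → two i)
      where
      two : ∀ i → ∃[ u ] ∃[ v ] InCell i u × InCell i v × u ≢ v
      two i with em₀ {∃[ u ] ∃[ v ] InCell i u × InCell i v × u ≢ v}
      ... | yes found = found
      ... | no  none′ = ⊥-elim (none (i , λ {u} {v} eu ev → same u v eu ev))
        where
        same : ∀ u v → InCell i u → InCell i v → u ≡ v
        same u v eu ev with dec u v
        ... | yes u≡v = u≡v
        ... | no  u≢v = ⊥-elim (none′ (u , v , eu , ev , u≢v))

    -- The fibre over `vtx i` lies in cell `i` because `fold` fixes the cycle.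
    single-fibre : ∃[ i ] ∃[ v ] g v ≡ vtx i × (∀ {u} → g u ≡ vtx i → u ≡ v)
    single-fibre =
      let i , single = single-cell
          v , over   = over-cell i
      in i , v , over , λ over′ → single (trans (cong fold over′) (fold-fixes i)) (trans (cong fold over) (fold-fixes i))

-- The lines of Δ have two points

two-elements : ∀ {a ℓ} {A : Set a} {P : Pred A ℓ} → HasSize P 2 →
               ∀ {x y z} → P x → P y → x ≢ y → P z → z ≡ x ⊎ z ≡ y
two-elements (f , _ , to , _) px py x≢y pz with to px | to py | to pz
... | 0F , refl | 0F , refl | _ = ⊥-elim (x≢y refl)
... | 1F , refl | 1F , refl | _ = ⊥-elim (x≢y refl)
... | 0F , refl | 1F , refl | 0F , refl = inj₁ refl
... | 0F , refl | 1F , refl | 1F , refl = inj₂ refl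
... | 1F , refl | 0F , refl | 0F , refl = inj₂ refl
... | 1F , refl | 0F , refl | 1F , refl = inj₁ refl

module ThinImage {ℓ} (em : ExcludedMiddle (lsuc ℓ)) {κ h : ℕ} (κ-odd : κ ≡ suc (h + h))
                 (Γ : Geometry ℓ ℓ ℓ) (weakΓ : IsWeakPolygon (3 + κ) Γ) (thickΓ : IsThick Γ)
                 (lfg : LocallyFinitelyGenerated Γ (3 + κ))
                 (Δ : Geometry ℓ ℓ ℓ) (weakΔ : IsWeakPolygon (3 + κ) Δ)
                 (two-lines : ∀ x → HasSize (λ M → Geometry._I_ Δ x M) 2)
                 (γ : Epimorphism Γ Δ) where
  open SingleFibre em {h = h} κ-odd Γ weakΓ thickΓ lfg Δ weakΔ γ
  open HomFacts polyΓ polyΔ homγ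

  C₀ : Δ.Cycle L
  C₀ = Incidence.FromWeak.some-cycle Δ dec dec weakΔ

  lift-to : ∀ {v y x z f k f′} → g v ≡ x → g y ≡ z → Δ.Walk x f k f′ z → suc (suc k) ≡ n →
            ∃[ u ] ∃[ ζ ] Γ.Walk v u k ζ y × g u ≡ f × g ζ ≡ f′
  lift-to refl refl = lift-walk

  -- Surjectivity becomes local: prolong `x ~ z` to `n - 1` edges, choose an element over the end
  -- and lift the walk.
  over-nbr : ∀ {v x z} → g v ≡ x → x Δ.~ z → ∃[ u ] v Γ.~ u × g u ≡ z
  over-nbr gv xz =
    let _ , t , w , _     = Δ.prolong (Δ.edge xz) (suc κ) z≤n
        y , gy            = onElement-surjective γ t
        u , _ , w′ , gu , _ = lift-to gv gy w refl
    in u , Γ.first~ w′ , gu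

  OneOver : Γ.Element → Δ.Element → Set ℓ
  OneOver v m = ∀ {u u′} → v Γ.~ u → v Γ.~ u′ → g u ≡ m → g u′ ≡ m → u ≡ u′

  n-1+n-1<L : suc (suc κ) + suc (suc κ) < L
  n-1+n-1<L = +-mono-< (n<1+n (2 + κ)) (n<1+n (2 + κ))

  -- a and b have a common opposite element z, reached through c; the lines
  -- over m correspond to elements near z.
  one-over-transport : ∀ {m a b c v w} → m Δ.~ b → m Δ.~ c → a ≢ c → b ≢ c →
                       g v ≡ a → g w ≡ b → OneOver w m → OneOver v m
  one-over-transport {m} {a} {b} {c} {v} {w} mb mc a≢c b≢c gv gw one {u} {u′} vu vu′ gu gu′ =
    let q , z , D , _ = Δ.prolong (Δ.edge mc) (suc κ) z≤n
        y , gy        = onElement-surjective γ z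
        r , D′ , z≢r  = Δ.unsnoc D
        through : ∀ {u} → v Γ.~ u → g u ≡ m →
                  ∃[ ζ ] Γ.Walk v u (2 + κ) ζ y × (∃[ s ] Γ.Walk w s (2 + κ) ζ y × g s ≡ m)
        through = λ vu gu →
          let t , ζ , w₁ , gt , gζ = lift-to gu gy D refl
              s , ρ , w₂ , gs , gρ = lift-to gw gζ (Δ.cons (Δ.~-sym mb) (≢-sym b≢c) D′) refl
          in ζ , Γ.cons vu (λ t≡v → a≢c (trans (sym gv) (trans (cong g (sym t≡v)) gt))) w₁ ,
             s , Γ.snoc w₂ (Γ.last~ w₁) (λ y≡ρ → z≢r (trans (sym gy) (trans (cong g y≡ρ) gρ))) , gs
        ζ  , w₁  , s  , w₂  , gs  = through vu gu
        ζ′ , w₁′ , s′ , w₂′ , gs′ = through vu′ gu′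
        s≡s′ = one (Γ.first~ w₂) (Γ.first~ w₂′) gs gs′
        ζ≡ζ′ = proj₂ (Γ.unique-after w₂ (subst (λ t → Γ.Walk w t (2 + κ) ζ′ y) (sym s≡s′) w₂′) n-1+n-1<L)
    in proj₂ (Γ.unique-after (Γ.rev w₁) (Γ.rev (subst (λ t → Γ.Walk v u′ (2 + κ) t y) (sym ζ≡ζ′) w₁′)) n-1+n-1<L)

  -- Every line through the point `v` lies over one of the two lines through `x`, so `v` would be on
  -- at most two lines.
  two-over-impossible : ∀ {v x m m′} → g v ≡ inj₁ x → inj₁ x Δ.~ m → inj₁ x Δ.~ m′ → m ≢ m′ →
                        OneOver v m → OneOver v m′ → ⊥
  two-over-impossible {v} {x} gv xm xm′ m≢m′ one one′ =
    let u  , vu  , gu        = over-nbr gv xm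
        u′ , vu′ , gu′       = over-nbr gv xm′
        t , vt , t≢u , t≢u′  = thirdΓ v u u′
    in case two-of xm xm′ m≢m′ (subst (Δ._~ g t) gv (onElement-↔ γ vt)) of λ
      { (inj₁ gt) → t≢u (one vt vu gt gu) ; (inj₂ gt) → t≢u′ (one′ vt vu′ gt gu′) }
    where
    two-of : ∀ {m m′ t} → inj₁ x Δ.~ m → inj₁ x Δ.~ m′ → m ≢ m′ → inj₁ x Δ.~ t → t ≡ m ⊎ t ≡ m′
    two-of (pl a) (pl b) m≢m′ (pl c) with two-elements (two-lines x) a b (m≢m′ ∘ cong inj₂) c
    ... | inj₁ refl = inj₁ refl
    ... | inj₂ refl = inj₂ refl

  module ThickLines (third : ∀ M u v → ∃[ t ] inj₂ M Δ.~ t × t ≢ u × t ≢ v) where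

    module _ {e K} (K-over : g K ≡ e) (K-only : ∀ {u} → g u ≡ e → u ≡ K) where

      distinct-images : ∀ {u v x y} → g u ≡ x → g v ≡ y → x ≢ y → u ≢ v
      distinct-images gu gv x≢y refl = x≢y (trans (sym gu) gv)

      nbr-K : ∀ {u m} → g u ≡ m → m Δ.~ e → u Γ.~ K
      nbr-K gu me = let q , uq , gq = over-nbr gu me in subst (_ Γ.~_) (K-only gq) uq

      -- Elements over `m` are adjacent to `K`, the only element over `e`; two of them next to `w`
      -- would close a circuit of four edges.
      one-over₂ : ∀ {m b w} → m Δ.~ e → b ≢ e → g w ≡ b → OneOver w m
      one-over₂ me b≢e gw wu wu′ gu gu′ = Γ.unique-first
        (Γ.cons wu (distinct-images K-over gw (≢-sym b≢e)) (Γ.edge (nbr-K gu me)))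
        (Γ.cons wu′ (distinct-images K-over gw (≢-sym b≢e)) (Γ.edge (nbr-K gu′ me)))
        (≤-trans (s≤s (s≤s (s≤s (m≤n+m 2 (κ + suc κ))))) (≤-reflexive (shuffle κ)))
        where
        shuffle : ∀ κ → 3 + (κ + suc κ + 2) ≡ 3 + κ + (3 + κ)
        shuffle κ = cong (3 +_) (trans (+-assoc κ (suc κ) 2) (cong (κ +_) (+-comm (suc κ) 2)))

      -- An element over `m` reaches `K` through an element over `a`, so two of them next to `w`
      -- would close a walk of six edges, while `n + n` is at least 8 for odd `κ`.
      one-over₃ : ∀ {m a b w} → a Δ.~ e → m Δ.~ a → m ≢ e → b ≢ a → g w ≡ b → OneOver w m
      one-over₃ {m} {a} {b} {w} ae ma m≢e b≢a gw wu wu′ gu gu′ =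
        Γ.unique-first (proj₂ (walk wu gu)) (proj₂ (walk wu′ gu′)) bound
        where
        walk : ∀ {u} → w Γ.~ u → g u ≡ m → Γ.Reach w u 2 K
        walk wu gu = let q , uq , gq = over-nbr gu ma in
          q , Γ.cons wu (distinct-images gq gw (≢-sym b≢a))
            (Γ.cons uq (distinct-images K-over gu (≢-sym m≢e)) (Γ.edge (nbr-K gq ae)))
        bound : 3 + 3 < L
        bound = subst (λ k → 3 + 3 < 3 + k + (3 + k)) (sym κ-odd)
          (s≤s (s≤s (s≤s (s≤s (≤-trans (m≤n+m 3 (h + h + suc (h + h))) (≤-reflexive (shuffle (h + h))))))))
          where
          shuffle : ∀ k → k + suc k + 3 ≡ k + (3 + suc k)
          shuffle k = trans (+-assoc k (suc k) 3) (cong (k +_) (+-comm (suc k) 3))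

      -- Each line through `x` has two further points: over one of them uniqueness holds by
      -- `one-over₂`, and the other leads to the common opposite that carries it over to `K`.
      point-impossible : ∀ {x} → e ≡ inj₁ x → ⊥
      point-impossible {x} refl =
        let m  , em  , _    = Δ.extend (inj₁ x) (inj₁ x)
            m′ , em′ , m′≢m = Δ.extend m (inj₁ x)
        in two-over-impossible K-over em em′ (≢-sym m′≢m) (one em) (one em′)
        where
        one : ∀ {m} → inj₁ x Δ.~ m → OneOver K m
        one (pl {M = M} xM) =
          let b , mb , b≢e , _   = third M (inj₁ x) (inj₁ x)
              c , mc , c≢e , c≢b = third M (inj₁ x) b
              w , gw             = onElement-surjective γ b
          in one-over-transport mb mc (≢-sym c≢e) (≢-sym c≢b) K-over gw (one-over₂ (lp xM) b≢e gw)

      -- Of the two lines through a point `x` of `M`, one is `M`, with only `K` over it; for the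
      -- other, uniqueness is transported from a further point as before, now with circuits of six
      -- edges.
      line-impossible : ∀ {M} → e ≡ inj₂ M → ⊥
      line-impossible {M} refl with Δ.extend (inj₂ M) (inj₂ M)
      ... | inj₁ x , lp xM , _ with Δ.extend (inj₂ M) (inj₁ x)
      ...   | inj₂ N , pl xN , N≢M =
        let v , gv             = onElement-surjective γ (inj₁ x)
            b , mb , b≢a , _   = third N (inj₁ x) (inj₁ x)
            c , mc , c≢a , c≢b = third N (inj₁ x) b
            w , gw             = onElement-surjective γ b
        in two-over-impossible gv (pl xM) (pl xN) (≢-sym N≢M)
             (λ _ _ gu gu′ → trans (K-only gu) (sym (K-only gu′)))
             (one-over-transport mb mc (≢-sym c≢a) (≢-sym c≢b) gv gw
               (one-over₃ (pl xM) (lp xN) N≢M b≢a gw))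

    impossible : ⊥
    impossible with Cells.single-fibre C₀
    ... | i , K , K-over , K-only with Δ.Cycle.vtx C₀ i
    ...   | inj₁ _ = point-impossible K-over K-only refl
    ...   | inj₂ _ = line-impossible K-over K-only refl

  first-pair : ∀ M → ∃[ x ] ∃[ y ] x Δ.I M × y Δ.I M × x ≢ y
  first-pair M with Δ.extend (inj₂ M) (inj₂ M)
  ... | inj₁ x , lp xM , _ with Δ.extend (inj₁ x) (inj₂ M)
  ...   | inj₁ y , lp yM , y≢x = x , y , xM , yM , λ x≡y → y≢x (cong inj₁ (sym x≡y))

  order≡1 : ∀ s → (∀ M → HasSize1+ (λ x → Geometry._I_ Δ x M) s) → s ≡ fin 1
  order≡1 (fin zero) size with Δ.extend (Δ.Cycle.vtx C₀ 0) (Δ.Cycle.vtx C₀ 0)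
  ... | c , vc , _ = case ends vc of λ (M , _) →
    let x , y , xM , yM , x≢y = first-pair M
        f , _ , to , _        = size M
        i , fi≡x              = to xM
        j , fj≡y              = to yM
    in ⊥-elim (x≢y (trans (sym fi≡x) (trans (cong f (Fin1 i j)) fj≡y)))
    where
    ends : ∀ {u v} → u Δ.~ v → ∃[ M ] (u ≡ inj₂ M ⊎ v ≡ inj₂ M)
    ends (pl _) = _ , inj₂ refl
    ends (lp _) = _ , inj₁ refl
    Fin1 : (i j : Fin 1) → i ≡ j
    Fin1 0F 0F = refl
  order≡1 (fin (suc zero)) _ = refl
  order≡1 (fin (suc (suc k))) size = ⊥-elim (ThickLines.impossible third)
    where
    third : ∀ M u v → ∃[ t ] inj₂ M Δ.~ t × t ≢ u × t ≢ v
    third M u v =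
      let f , f-inj , _ , f∈ = size M
          j , ≢u , ≢v = avoid dec (λ j → inj₁ (f (j ↑ˡ k))) (λ eq → ↑ˡ-injective k _ _ (f-inj (inj₁-injective eq))) u v
      in inj₁ (f (j ↑ˡ k)) , lp (f∈ (_ , refl)) , ≢u , ≢v
  -- A line with no third point besides `u` and `v` would have its points in a list of at most two.
  order≡1 ∞ size = ⊥-elim (ThickLines.impossible third)
    where
    point-list : Δ.Element → List Δ.Point
    point-list (inj₁ x) = x ∷ []
    point-list (inj₂ _) = []
    listed : ∀ {x} u → inj₁ x ≡ u → x ∈ point-list u
    listed _ refl = here refl
    third : ∀ M u v → ∃[ t ] inj₂ M Δ.~ t × t ≢ u × t ≢ v
    third M u v with em₀ {∃[ t ] inj₂ M Δ.~ t × t ≢ u × t ≢ v}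
    ... | yes found = found
    ... | no  none  = ⊥-elim (size M (finite-subset dec (λ _ → em₀) (point-list u ++ point-list v) only))
      where
      only : ∀ {x} → x Δ.I M → x ∈ point-list u ++ point-list v
      only {x} xM with dec (inj₁ x) u | dec (inj₁ x) v
      ... | yes x≡u | _       = ∈-++⁺ˡ (listed u x≡u)
      ... | no  _   | yes x≡v = ∈-++⁺ʳ (point-list u) (listed v x≡v)
      ... | no  x≢u | no  x≢v = ⊥-elim (none (inj₁ x , lp xM , x≢u , x≢v))

  module ThinLines (two-points : ∀ M → HasSize (λ x → x Δ.I M) 2) where

    two-nbrs : ∀ {y a b c} → y Δ.~ a → y Δ.~ b → a ≢ b → y Δ.~ c → c ≡ a ⊎ c ≡ b
    two-nbrs (pl a) (pl b) a≢b (pl c) with two-elements (two-lines _) a b (a≢b ∘ cong inj₂) c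
    ... | inj₁ refl = inj₁ refl
    ... | inj₂ refl = inj₂ refl
    two-nbrs (lp a) (lp b) a≢b (lp c) with two-elements (two-points _) a b (a≢b ∘ cong inj₁) c
    ... | inj₁ refl = inj₁ refl
    ... | inj₂ refl = inj₂ refl

    module _ (C : Δ.Cycle L) where
      open Apartment polyΔ C

      cycle-nbr : ∀ {x} i → vtx (suc i) Δ.~ x → x ≡ vtx i ⊎ x ≡ vtx (2 + i)
      cycle-nbr i = two-nbrs (Δ.~-sym (step i)) (step (suc i)) (≢-sym (turn i))

      -- Every vertex of Δ now has only two neighbours, so a walk that starts on the cycle cannot
      -- leave it.
      covered : ∀ x → ∃[ i ] i < L × vtx i ≡ x
      covered x with found (Δ.diam (vtx 0) x)
        where
        along-walk : ∀ {y z k p} i → Δ.Walk (vtx i) z k p y → ∃[ j ] y ≡ vtx j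
        -- The index is `n + n + i` less one, because `cycle-nbr` speaks of the neighbours of a
        -- successor.
        along-walk i w with cycle-nbr (2 + κ + n + i) (subst (Δ._~ _) (sym (period i)) (Δ.first~ w))
        along-walk i (Δ.edge _)     | inj₁ eq = _ , eq
        along-walk i (Δ.edge _)     | inj₂ eq = _ , eq
        along-walk i (Δ.cons _ _ w) | inj₁ refl = along-walk _ w
        along-walk i (Δ.cons _ _ w) | inj₂ refl = along-walk _ w
        found : _ → ∃[ j ] x ≡ vtx j
        found (inj₁ refl)                = 0 , refl
        found (inj₂ (_ , _ , _ , _ , w)) = along-walk 0 w
      ... | j , x≡ = let r , r<L , same = representative j in r , r<L , sym (trans x≡ (same 0))

    picture : Picture γ n
    picture with Cells.single-fibre C₀
    ... | i , K , K-over , K-only = record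
      { e        = Δ.Cycle.vtx C
      ; e-step   = Δ.Cycle.step C
      ; e-period = Δ.Cycle.period C
      ; e-differ = Δ.cycle-distinct C
      ; e-all    = λ s → covered (Δ.shift s C)
      ; e-nbr    = λ {_} {j} → cycle-nbr C j
      ; prev     = λ {_} {j} gv → over-nbr gv (Δ.~-sym (Δ.Cycle.step C j))
      ; succ     = λ {_} {j} gv → over-nbr gv (Δ.Cycle.step C j)
      ; L        = K
      ; L-over   = trans K-over K≡
      ; L-only   = λ gv → K-only (trans gv (sym K≡))
      }
      where
      -- The cycle is turned so that the single fibre lies over position 0.
      C = Δ.shift i C₀
      K≡ : Δ.Cycle.vtx C₀ i ≡ Δ.Cycle.vtx C 0
      K≡ = cong (Δ.Cycle.vtx C₀) (sym (+-identityʳ i))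

-- The two types

typeA⊎typeB : ∀ {ℓ} {Γ Δ : Geometry ℓ ℓ ℓ} {γ : Epimorphism Γ Δ} {n} → (∀ {A : Set ℓ} → DecidableEquality A) →
              n ≡ 4 ⊎ n ≡ 6 → Picture γ n → TypeA γ n ⊎ TypeB γ n
typeA⊎typeB dec n≡ pic with Picture.L pic in eq
typeA⊎typeB dec (inj₁ refl) pic | inj₂ _ = inj₁ (typeA₄ dec dec pic eq)
typeA⊎typeB dec (inj₂ refl) pic | inj₂ _ = inj₁ (typeA₆ dec dec pic eq)
typeA⊎typeB {Γ = Γ} dec (inj₁ refl) pic | inj₁ _ = inj₂ (typeA₄ dec dec (dual-picture pic) (cong (swapᴱ {G = Γ}) eq))
typeA⊎typeB {Γ = Γ} dec (inj₂ refl) pic | inj₁ _ = inj₂ (typeA₆ dec dec (dual-picture pic) (cong (swapᴱ {G = Γ}) eq))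

corollary6p4 : ∀ {ℓ : Level} → ExcludedMiddle (lsuc ℓ) →
    (n : ℕ) → n ≡ 4 ⊎ n ≡ 6 →
    (Γ : Geometry ℓ ℓ ℓ) → IsThickPolygon n Γ → LocallyFinitelyGenerated Γ n →
    (Δ : Geometry ℓ ℓ ℓ) (s : ℕ∞) → IsThinPolygon n Δ → HasOrder Δ s (fin 1) →
    (γ : Epimorphism Γ Δ) →
    s ≡ fin 1 × (TypeA γ n ⊎ TypeB γ n)
corollary6p4 em n n≡ Γ (weakΓ , thickΓ) lfg Δ s (weakΔ , _) (on-lines , on-points) γ =
  reduce (odd n≡)
  where
  odd : n ≡ 4 ⊎ n ≡ 6 → ∃[ κ ] ∃[ h ] n ≡ 3 + κ × κ ≡ suc (h + h)
  -- `κ` is `n - 3`, and `n` is `4 + (h + h)`.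
  odd (inj₁ refl) = 1 , 0 , refl , refl
  odd (inj₂ refl) = 3 , 1 , refl , refl
  reduce : ∃[ κ ] ∃[ h ] n ≡ 3 + κ × κ ≡ suc (h + h) → s ≡ fin 1 × (TypeA γ n ⊎ TypeB γ n)
  reduce (κ , h , refl , κ-odd) = s≡1 , typeA⊎typeB dec n≡
    (ThinLines.picture λ M → subst (HasSize1+ (λ x → Geometry._I_ Δ x M)) s≡1 (on-lines M))
    where
    open ThinImage em {h = h} κ-odd Γ weakΓ thickΓ lfg Δ weakΔ on-points γ
    open SingleFibre em {h = h} κ-odd Γ weakΓ thickΓ lfg Δ weakΔ γ using (dec)
    s≡1 : s ≡ fin 1
    s≡1 = order≡1 s on-lines
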